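{- Let $\Lambda_{24}$ be the Leech lattice (even unimodular, minimal norm $4$), written in the standard coordinates in which the Mathieu group $M_{24}$ acts on $\Lambda_{24}$ by permuting the $24$ coordinates, and let $M_{23}\subset M_{24}$ be the stabilizer of one coordinate. Let $g\in M_{23}$ have order $N>1$ and let $\Lambda_g=\{v\in\Lambda_{24}: gv=v\}$ be the fixed sublattice. Then $\Lambda_g$ is strongly $N$-modular. Moreover, if $N\in\{2,3,5,6,7,11,14,15,23\}$, then $\Lambda_g$ has dimension $D_N=24\,d(N)/\prod_{p\mid N}(p+1)$ and is extremal, i.e. its minimal norm equals $2[D_N/D_N]+2=4$.
   Context: $d(N)$ is the number of divisors of $N$. For a rational lattice $\Lambda$ and a set $\Pi$ of primes, the $\Pi$-dual $\Lambda^{*_\Pi}$ is the set of $v\in\Lambda\otimes\mathbb{Q}$ with $v\cdot u\in\mathbb{Z}_p$ for all $u\in\Lambda$, $p\in\Pi$, and $v\cdot u\in\mathbb{Z}_p$ for all $u\in\Lambda^*$, $p\notin\Pi$. An $m$-modularity of an integral lattice $\Lambda$ is a similarity $\sigma$ of $\Lambda\otimes\mathbb{R}$ multiplying norms by $m$ with $\sigma(\Lambda^{*_{\Pi(m)}})=\Lambda$, where $\Pi(m)$ is the set of primes dividing $m$. The level of an integral lattice is the smallest $l$ with $\sqrt{l}\,\Lambda^*$ integral. $\Lambda$ is strongly $N$-modular if it is integral, its level divides $N$, and it has an $m$-modularity for every $m\mid N$ with $\gcd(m,N/m)=1$. -}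

module Defs where

open import Data.Nat as ℕ using (ℕ; zero; suc; _≤_; _<_; _≡ᵇ_; NonZero)
open import Data.Nat.Divisibility using (_∣_)
open import Data.Nat.Properties using (m*n≢0)
open import Data.Fin.Permutation using (Permutation′; _⟨$⟩ʳ_)
open import Data.List.Membership.Propositional using (_∈_)
open import Data.Nat.Primality using (Prime)
open import Data.Nat.GCD using (gcd)
open import Data.Nat.Divisibility using (_∣?_)
open import Data.Integer as ℤ using (ℤ; +_)
open import Data.Integer.DivMod using (_%_)
open import Data.Rational as ℚ using (ℚ; 0ℚ)
open import Data.Bool using (Bool; true; false; _xor_; _∧_)
open import Data.Fin using (Fin)
open import Data.Vec as Vec using (Vec; []; _∷_)
open import Data.List as List using (List)
open import Data.Product using (Σ; ∃; ∃-syntax; _×_; _,_)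
open import Data.Empty using (⊥)
open import Relation.Nullary using (¬_; Dec; yes; no)
open import Relation.Binary.PropositionalEquality using (_≡_; _≢_)

Σℚ : ∀ {n} → (Fin n → ℚ) → ℚ
Σℚ {zero}  f = 0ℚ
Σℚ {suc n} f = f Data.Fin.zero ℚ.+ Σℚ (λ i → f (Data.Fin.suc i))

Σℤ : ∀ {n} → (Fin n → ℤ) → ℤ
Σℤ {zero}  f = + 0
Σℤ {suc n} f = f Data.Fin.zero ℤ.+ Σℤ (λ i → f (Data.Fin.suc i))

XOR : ∀ {n} → (Fin n → Bool) → Bool
XOR {zero}  f = false
XOR {suc n} f = f Data.Fin.zero xor XOR (λ i → f (Data.Fin.suc i))

countDiv : ℕ → ℕ → ℕ
countDiv n zero = 0
countDiv n (suc k) with suc k ∣? n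
... | yes _ = suc (countDiv n k)
... | no  _ = countDiv n k

d : ℕ → ℕ
d n = countDiv n n

prodPrimes : ℕ → ℕ → ℕ
prodPrimes n zero = 1
prodPrimes n (suc k) with Data.Nat.Primality.prime? (suc k) | suc k ∣? n
... | yes _ | yes _ = (suc k ℕ.+ 1) ℕ.* prodPrimes n k
... | _     | _     = prodPrimes n k

∏p+1 : ℕ → ℕ
∏p+1 n = prodPrimes n n

prodPrimes-nonZero : ∀ n k → NonZero (prodPrimes n k)
prodPrimes-nonZero n zero = _
prodPrimes-nonZero n (suc k) with Data.Nat.Primality.prime? (suc k) | suc k ∣? n
... | yes _ | yes _ = m*n≢0 (suc k ℕ.+ 1) (prodPrimes n k) {{_}} {{prodPrimes-nonZero n k}}
... | yes _ | no _  = prodPrimes-nonZero n k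
... | no _  | _     = prodPrimes-nonZero n k

D : ℕ → ℕ
D n = ℕ._/_ (24 ℕ.* d n) (∏p+1 n) {{prodPrimes-nonZero n n}}

_∈ℤ[_] : ℚ → ℕ → Set
q ∈ℤ[ p ] = ¬ (p ∣ ℚ.denominatorℕ q)

IsInteger : ℚ → Set
IsInteger q = ∃[ z ] q ≡ (z ℚ./ 1)

-- Ambient space ℚ^24 in the standard Leech coordinates.
-- A vector x represents x/√8 ∈ ℝ^24, so the inner product is Σ xᵢyᵢ / 8.

Vec24 : Set
Vec24 = Fin 24 → ℚ

_·_ : Vec24 → Vec24 → ℚ
x · y = Σℚ (λ i → x i ℚ.* y i) ℚ.* (+ 1 ℚ./ 8)

norm : Vec24 → ℚ
norm x = x · x

_+ᵥ_ : Vec24 → Vec24 → Vec24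
(x +ᵥ y) i = x i ℚ.+ y i

_•_ : ℚ → Vec24 → Vec24
(c • x) i = c ℚ.* x i

_≈_ : Vec24 → Vec24 → Set
x ≈ y = ∀ i → x i ≡ y i

0ᵥ : Vec24
0ᵥ i = 0ℚ

Lattice : Set₁
Lattice = Vec24 → Set

-- The extended binary Golay code C (extended cyclic code generated by
-- x^11+x^10+x^6+x^5+x^4+x^2+1, with an overall parity bit).

golayRows : Vec (Vec Bool 24) 12
golayRows =
    (true ∷ false ∷ true ∷ false ∷ true ∷ true ∷ true ∷ false ∷ false ∷ false ∷ true ∷ true ∷ false ∷ false ∷ false ∷ false ∷ false ∷ false ∷ false ∷ false ∷ false ∷ false ∷ false ∷ true ∷ [])
  ∷ (false ∷ true ∷ false ∷ true ∷ false ∷ true ∷ true ∷ true ∷ false ∷ false ∷ false ∷ true ∷ true ∷ false ∷ false ∷ false ∷ false ∷ false ∷ false ∷ false ∷ false ∷ false ∷ false ∷ true ∷ [])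
  ∷ (false ∷ false ∷ true ∷ false ∷ true ∷ false ∷ true ∷ true ∷ true ∷ false ∷ false ∷ false ∷ true ∷ true ∷ false ∷ false ∷ false ∷ false ∷ false ∷ false ∷ false ∷ false ∷ false ∷ true ∷ [])
  ∷ (false ∷ false ∷ false ∷ true ∷ false ∷ true ∷ false ∷ true ∷ true ∷ true ∷ false ∷ false ∷ false ∷ true ∷ true ∷ false ∷ false ∷ false ∷ false ∷ false ∷ false ∷ false ∷ false ∷ true ∷ [])
  ∷ (false ∷ false ∷ false ∷ false ∷ true ∷ false ∷ true ∷ false ∷ true ∷ true ∷ true ∷ false ∷ false ∷ false ∷ true ∷ true ∷ false ∷ false ∷ false ∷ false ∷ false ∷ false ∷ false ∷ true ∷ [])
  ∷ (false ∷ false ∷ false ∷ false ∷ false ∷ true ∷ false ∷ true ∷ false ∷ true ∷ true ∷ true ∷ false ∷ false ∷ false ∷ true ∷ true ∷ false ∷ false ∷ false ∷ false ∷ false ∷ false ∷ true ∷ [])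
  ∷ (false ∷ false ∷ false ∷ false ∷ false ∷ false ∷ true ∷ false ∷ true ∷ false ∷ true ∷ true ∷ true ∷ false ∷ false ∷ false ∷ true ∷ true ∷ false ∷ false ∷ false ∷ false ∷ false ∷ true ∷ [])
  ∷ (false ∷ false ∷ false ∷ false ∷ false ∷ false ∷ false ∷ true ∷ false ∷ true ∷ false ∷ true ∷ true ∷ true ∷ false ∷ false ∷ false ∷ true ∷ true ∷ false ∷ false ∷ false ∷ false ∷ true ∷ [])
  ∷ (false ∷ false ∷ false ∷ false ∷ false ∷ false ∷ false ∷ false ∷ true ∷ false ∷ true ∷ false ∷ true ∷ true ∷ true ∷ false ∷ false ∷ false ∷ true ∷ true ∷ false ∷ false ∷ false ∷ true ∷ [])
  ∷ (false ∷ false ∷ false ∷ false ∷ false ∷ false ∷ false ∷ false ∷ false ∷ true ∷ false ∷ true ∷ false ∷ true ∷ true ∷ true ∷ false ∷ false ∷ false ∷ true ∷ true ∷ false ∷ false ∷ true ∷ [])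
  ∷ (false ∷ false ∷ false ∷ false ∷ false ∷ false ∷ false ∷ false ∷ false ∷ false ∷ true ∷ false ∷ true ∷ false ∷ true ∷ true ∷ true ∷ false ∷ false ∷ false ∷ true ∷ true ∷ false ∷ true ∷ [])
  ∷ (false ∷ false ∷ false ∷ false ∷ false ∷ false ∷ false ∷ false ∷ false ∷ false ∷ false ∷ true ∷ false ∷ true ∷ false ∷ true ∷ true ∷ true ∷ false ∷ false ∷ false ∷ true ∷ true ∷ true ∷ [])
  ∷ []

golayGen : Fin 12 → Fin 24 → Bool
golayGen i j = Vec.lookup (Vec.lookup golayRows i) j

InGolay : (Fin 24 → Bool) → Set
InGolay w = Σ (Fin 12 → Bool) λ c → ((∀ j → w j ≡ XOR (λ (i : Fin 12) → c i ∧ golayGen i j)))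

-- The Leech lattice Λ₂₄ in standard coordinates (SPLAG ch. 4, scaled by √8):
-- x = (x₁..x₂₄) ∈ ℤ²⁴ lies in Λ₂₄ iff for some m ∈ {0,1}: every xᵢ ≡ m (mod 2),
-- for each ν the set {i : xᵢ ≡ ν (mod 4)} is a C-set, and Σ xᵢ ≡ 4m (mod 8).

LeechInt : (Fin 24 → ℤ) → Set
LeechInt z = ∃[ m ] (m ≤ 1
  × (∀ i → z i % (+ 2) ≡ m)
  × (∀ ν → ν < 4 → InGolay (λ i → (z i % (+ 4)) ≡ᵇ ν))
  × (Σℤ z % (+ 8) ≡ 4 ℕ.* m))

Leech : Lattice
Leech x = ∃[ z ] ((∀ i → x i ≡ (z i ℚ./ 1)) × LeechInt z)

InM24 : Permutation′ 24 → Set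
InM24 g = ∀ w → InGolay w → InGolay (λ i → w (g ⟨$⟩ʳ i))

pow : Permutation′ 24 → ℕ → Fin 24 → Fin 24
pow g zero    i = i
pow g (suc k) i = g ⟨$⟩ʳ (pow g k i)

IsIdentity : (Fin 24 → Fin 24) → Set
IsIdentity f = ∀ i → f i ≡ i

HasOrder : Permutation′ 24 → ℕ → Set
HasOrder g N = 0 < N × IsIdentity (pow g N) × (∀ k → 0 < k → k < N → ¬ IsIdentity (pow g k))

Λfix : Permutation′ 24 → Lattice
Λfix g x = Leech x × (∀ i → x (g ⟨$⟩ʳ i) ≡ x i)

-- Λ ⊗ ℚ, realised inside ℚ²⁴ as {x : n x ∈ Λ for some n ≥ 1}
ΛQ : Lattice → Vec24 → Set
ΛQ Λ x = ∃[ n ] Λ ((+ suc n ℚ./ 1) • x)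

Dual : Lattice → Lattice
Dual Λ v = ΛQ Λ v × (∀ u → Λ u → IsInteger (v · u))

ΠDual : ℕ → Lattice → Lattice
ΠDual m Λ v = ΛQ Λ v
  × (∀ u → Λ u → ∀ p → Prime p → p ∣ m → (v · u) ∈ℤ[ p ])
  × (∀ u → Dual Λ u → ∀ p → Prime p → ¬ (p ∣ m) → (v · u) ∈ℤ[ p ])

Integral : Lattice → Set
Integral Λ = ∀ u v → Λ u → Λ v → IsInteger (u · v)

-- √l Λ* is integral
ScaledDualIntegral : Lattice → ℕ → Set
ScaledDualIntegral Λ l = ∀ v w → Dual Λ v → Dual Λ w → IsInteger ((+ l ℚ./ 1) ℚ.* (v · w))

IsLevel : Lattice → ℕ → Set
IsLevel Λ l = 0 < l × ScaledDualIntegral Λ l × (∀ l′ → 0 < l′ → ScaledDualIntegral Λ l′ → l ≤ l′)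

IsModularity : ℕ → Lattice → (Vec24 → Vec24) → Set
IsModularity m Λ σ =
    (∀ x → ΛQ Λ x → ΛQ Λ (σ x))
  × (∀ x y → ΛQ Λ x → ΛQ Λ y → σ (x +ᵥ y) ≈ (σ x +ᵥ σ y))
  × (∀ c x → ΛQ Λ x → σ (c • x) ≈ (c • σ x))
  × (∀ x → ΛQ Λ x → norm (σ x) ≡ (+ m ℚ./ 1) ℚ.* norm x)
  × (∀ x → ΠDual m Λ x → Λ (σ x))
  × (∀ y → Λ y → ∃[ x ] (ΠDual m Λ x × σ x ≈ y))

StronglyModular : ℕ → Lattice → Set
StronglyModular N Λ = Integral Λ
  × (∃[ l ] (IsLevel Λ l × l ∣ N))
  × (∀ m k → m ℕ.* k ≡ N → gcd m k ≡ 1 → ∃[ σ ] IsModularity m Λ σ)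

linComb : ∀ {n} → (Fin n → ℚ) → (Fin n → Vec24) → Vec24
linComb c b j = Σℚ (λ i → c i ℚ.* b i j)

HasDim : Lattice → ℕ → Set
HasDim Λ n = ∃[ b ] ((∀ (i : Fin n) → ΛQ Λ (b i))
  × (∀ c → linComb c b ≈ 0ᵥ → ∀ i → c i ≡ 0ℚ)
  × (∀ x → ΛQ Λ x → ∃[ c ] (x ≈ linComb c b)))

MinNorm : Lattice → ℚ → Set
MinNorm Λ μ = (∃[ v ] (Λ v × ¬ (v ≈ 0ᵥ) × norm v ≡ μ))
  × (∀ v → Λ v → ¬ (v ≈ 0ᵥ) → μ ℚ.≤ norm v)

exceptionalN : List ℕ
exceptionalN = 2 List.∷ 3 List.∷ 5 List.∷ 6 List.∷ 7 List.∷ 11 List.∷ 14 List.∷ 15 List.∷ 23 List.∷ List.[]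

{-# OPTIONS --safe #-}
module Submission where

-- A presentation of a lattice by a basis F with integral Gram matrix G and H = N G⁻¹ integral reduces strong
-- N-modularity to integer matrix identities, one matrix A for each exact divisor m of N. An element of M₂₃ is moved
-- by conjugation in M₂₄, which is five times transitive on the coordinates, until its images of five points form one
-- of twelve patterns; the pointwise stabiliser of five points has order 48, so 576 permutations remain, and each of
-- them or its inverse is conjugate to one of eleven representatives. For these, a basis of the fixed lattice is
-- verified by Leech vectors L dual to it. Extremality is the minimal norm 4 of the Leech lattice.

open import Defs
open import Algebra.Bundles using (CommutativeSemiring; CommutativeRing)
import Algebra.Properties.Semiring.Sum as SemiringSum
import Algebra.Structures
open import Data.Bool as Bool using (Bool; true; false; T; not; _∧_; _∨_; _xor_; if_then_else_)
import Data.Bool.Properties as Bool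
open import Data.Empty using (⊥-elim)
open import Data.Fin as Fin using (Fin; toℕ; #_)
open import Data.Fin.Patterns
open import Data.Fin.Permutation as Perm using (Permutation′; _⟨$⟩ʳ_; _⟨$⟩ˡ_)
import Data.Fin.Properties as Fin
open import Data.Integer as ℤ using (ℤ; +_; -[1+_])
import Data.Integer.DivMod as ℤ
import Data.Integer.Properties as ℤ
open import Data.Integer.Tactic.RingSolver using (solve-∀)
open import Data.List as List using (List)
open import Data.List.Membership.Propositional using (_∈_)
import Data.List.Relation.Unary.All as All
open import Data.List.Relation.Unary.Any using (here; there)
open import Data.Nat as ℕ using (ℕ; zero; suc; _<_; _≤_; _*_; NonZero)
open import Data.Nat.Coprimality as Coprimality using (Coprime)
open import Data.Nat.Divisibility using (_∣_; divides)
import Data.Nat.Divisibility as ∣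
import Data.Nat.DivMod as ℕ
open import Data.Nat.GCD using (gcd; gcd-greatest; gcd[m,n]≡0⇒m≡0; gcd[m,n]∣m; gcd[m,n]∣n)
open import Data.Nat.Primality using (Prime; ¬prime[1])
open import Data.Nat.Primality.Factorisation using (factorise)
import Data.Nat.Properties as ℕ
open import Data.Product using (Σ; ∃-syntax; _×_; _,_; proj₁; proj₂)
open import Data.Rational as ℚ using (ℚ; _/_)
import Data.Rational.Properties as ℚ
import Data.Rational.Unnormalised as ℚᵘ
import Data.Rational.Unnormalised.Properties as ℚᵘ
open import Data.Sum using (_⊎_; inj₁; inj₂)
open import Data.Unit using (tt)
open import Data.Vec as Vec using (Vec; []; _∷_; lookup; tabulate)
import Data.Vec.Properties as Vec
open import Function using (_∘_; id; case_of_)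
open import Relation.Binary.Definitions using (tri<; tri≈; tri>)
open import Relation.Binary.PropositionalEquality
open import Relation.Nullary using (¬_; Dec; yes; no)
open import Algebra.Properties.CommutativeSemigroup
  (CommutativeRing.*-commutativeSemigroup ℚ.+-*-commutativeRing) using () renaming (x∙yz≈y∙xz to *-leftComm)

-- The vectors `L` exist because the Leech lattice is unimodular and the fixed lattice is primitive
-- in it: every integral linear form on the fixed lattice is the inner product with some Leech
-- vector, in particular each coordinate form of a basis. Verifying them uses only that Leech inner
-- products are integral; the coordinates of an arbitrary fixed vector are then read off as inner
-- products with `L`, and completeness of the basis becomes one matrix identity instead of an index
-- computation. The group enters only as the automorphisms of the code, and M₂₃ has 10200960
-- elements, so no check can run over its elements. The substitute is the uniqueness of the octad
-- through five points: an automorphism fixing enough points preserves many octads, and these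
-- separate the remaining points. This bounds the stabilisers from above, while explicit
-- permutations bound the orbits from below. All finite facts are evaluations of Boolean tests
-- closed by `refl`.

-- The sums of Defs are separate recursions; each of them satisfies the two
-- defining equations of a finite sum, and all laws follow from these.
module SumLaws {A : Set} (_⊕_ _⊗_ : A → A → A) (0# 1# : A)
  (laws : Algebra.Structures.IsCommutativeSemiring _≡_ _⊕_ _⊗_ 0# 1#)
  (S : ∀ {n} → (Fin n → A) → A)
  (S-zero : ∀ (f : Fin 0 → A) → S f ≡ 0#)
  (S-suc : ∀ {n} (f : Fin (suc n) → A) → S f ≡ f Fin.zero ⊕ S (f ∘ Fin.suc)) where

  private
    R : CommutativeSemiring _ _
    R = record { isCommutativeSemiring = laws }
    module R = CommutativeSemiring R
    module ∑ = SemiringSum R.semiring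

  S≡sum : ∀ {n} (f : Fin n → A) → S f ≡ ∑.sum f
  S≡sum {zero}  f = S-zero f
  S≡sum {suc n} f = trans (S-suc f) (cong (f Fin.zero ⊕_) (S≡sum (f ∘ Fin.suc)))

  Σ-cong : ∀ {n} {f g : Fin n → A} → (∀ i → f i ≡ g i) → S f ≡ S g
  Σ-cong {f = f} {g} e = trans (S≡sum f) (trans (∑.sum-cong-≗ e) (sym (S≡sum g)))

  Σ-+ : ∀ {n} (f g : Fin n → A) → S (λ i → f i ⊕ g i) ≡ S f ⊕ S g
  Σ-+ f g = trans (S≡sum _) (trans (∑.∑-distrib-+ f g) (sym (cong₂ _⊕_ (S≡sum f) (S≡sum g))))

  Σ-*ˡ : ∀ {n} c (f : Fin n → A) → S (λ i → c ⊗ f i) ≡ c ⊗ S f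
  Σ-*ˡ c f = trans (S≡sum _) (trans (sym (∑.*-distribˡ-sum c f)) (cong (c ⊗_) (sym (S≡sum f))))

  Σ-*ʳ : ∀ {n} c (f : Fin n → A) → S (λ i → f i ⊗ c) ≡ S f ⊗ c
  Σ-*ʳ c f = trans (S≡sum _) (trans (sym (∑.*-distribʳ-sum c f)) (cong (_⊗ c) (sym (S≡sum f))))

  Σ-swap : ∀ {m n} (f : Fin m → Fin n → A) → S (λ i → S (f i)) ≡ S (λ j → S (λ i → f i j))
  Σ-swap f = trans (Σ-cong (λ i → S≡sum (f i))) (trans (S≡sum _) (trans (∑.∑-comm f)
    (sym (trans (Σ-cong (λ j → S≡sum (λ i → f i j))) (S≡sum _)))))

  Σ-permute : ∀ {n} (f : Fin n → A) (π : Permutation′ n) → S (λ i → f (π ⟨$⟩ʳ i)) ≡ S f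
  Σ-permute f π = trans (S≡sum _) (trans (sym (∑.sum-permute f π)) (sym (S≡sum f)))

  Σ-0 : ∀ {n} {f : Fin n → A} → (∀ i → f i ≡ 0#) → S f ≡ 0#
  Σ-0 {zero}  {f} e = S-zero f
  Σ-0 {suc n} {f} e = trans (S-suc f) (trans (cong₂ _⊕_ (e Fin.zero) (Σ-0 (e ∘ Fin.suc))) (R.+-identityˡ 0#))

  Σ-assoc : ∀ {m n} (a : Fin m → A) (M : Fin m → Fin n → A) (b : Fin n → A) →
            S (λ i → a i ⊗ S (λ j → M i j ⊗ b j)) ≡ S (λ j → S (λ i → a i ⊗ M i j) ⊗ b j)
  Σ-assoc a M b = begin
    S (λ i → a i ⊗ S (λ j → M i j ⊗ b j))   ≡⟨ Σ-cong (λ i → sym (Σ-*ˡ (a i) (λ j → M i j ⊗ b j))) ⟩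
    S (λ i → S (λ j → a i ⊗ (M i j ⊗ b j))) ≡⟨ Σ-cong (λ i → Σ-cong (λ j → sym (R.*-assoc (a i) (M i j) (b j)))) ⟩
    S (λ i → S (λ j → (a i ⊗ M i j) ⊗ b j)) ≡⟨ Σ-swap (λ i j → (a i ⊗ M i j) ⊗ b j) ⟩
    S (λ j → S (λ i → (a i ⊗ M i j) ⊗ b j)) ≡⟨ Σ-cong (λ j → Σ-*ʳ (b j) (λ i → a i ⊗ M i j)) ⟩
    S (λ j → S (λ i → a i ⊗ M i j) ⊗ b j)   ∎
    where open ≡-Reasoning

  Σ-adjoint : ∀ {m n} (w : Fin n → A) (c : Fin m → A) (M : Fin m → Fin n → A) →
              S (λ j → w j ⊗ S (λ i → c i ⊗ M i j)) ≡ S (λ i → c i ⊗ S (λ j → w j ⊗ M i j))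
  Σ-adjoint w c M = begin
    S (λ j → w j ⊗ S (λ i → c i ⊗ M i j))   ≡⟨ Σ-cong (λ j → sym (Σ-*ˡ (w j) (λ i → c i ⊗ M i j))) ⟩
    S (λ j → S (λ i → w j ⊗ (c i ⊗ M i j))) ≡⟨ Σ-swap (λ j i → w j ⊗ (c i ⊗ M i j)) ⟩
    S (λ i → S (λ j → w j ⊗ (c i ⊗ M i j))) ≡⟨ Σ-cong (λ i → Σ-cong (λ j → x∙yz≈y∙xz (w j) (c i) (M i j))) ⟩
    S (λ i → S (λ j → c i ⊗ (w j ⊗ M i j))) ≡⟨ Σ-cong (λ i → Σ-*ˡ (c i) (λ j → w j ⊗ M i j)) ⟩
    S (λ i → c i ⊗ S (λ j → w j ⊗ M i j))   ∎
    where
    open ≡-Reasoning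
    open import Algebra.Properties.CommutativeSemigroup R.*-commutativeSemigroup using (x∙yz≈y∙xz)

  indicator : ∀ {n} → Fin n → Fin n → A
  indicator i j with i Fin.≟ j
  ... | yes _ = 1#
  ... | no  _ = 0#

  indicator-suc : ∀ {n} (i j : Fin n) → indicator (Fin.suc i) (Fin.suc j) ≡ indicator i j
  indicator-suc i j with i Fin.≟ j
  ... | yes _ = refl
  ... | no  _ = refl

  Σ-indicator : ∀ {n} (i : Fin n) (f : Fin n → A) → S (λ j → indicator i j ⊗ f j) ≡ f i
  Σ-indicator {suc n} Fin.zero f =
    trans (S-suc _) (trans (cong₂ _⊕_ (R.*-identityˡ _) (Σ-0 (λ j → R.zeroˡ _))) (R.+-identityʳ _))
  Σ-indicator {suc n} (Fin.suc i) f =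
    trans (S-suc _) (trans (cong₂ _⊕_ (R.zeroˡ _)
      (trans (Σ-cong (λ j → cong (_⊗ f (Fin.suc j)) (indicator-suc i j))) (Σ-indicator i (f ∘ Fin.suc))))
      (R.+-identityˡ _))

Σℕ : ∀ {n} → (Fin n → ℕ) → ℕ
Σℕ {zero}  f = 0
Σℕ {suc n} f = f Fin.zero ℕ.+ Σℕ (f ∘ Fin.suc)

module QΣ = SumLaws ℚ._+_ ℚ._*_ ℚ.0ℚ ℚ.1ℚ (CommutativeRing.isCommutativeSemiring ℚ.+-*-commutativeRing)
  Σℚ (λ _ → refl) (λ _ → refl)
module ZΣ = SumLaws ℤ._+_ ℤ._*_ (+ 0) (+ 1) ℤ.+-*-isCommutativeSemiring Σℤ (λ _ → refl) (λ _ → refl)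
module NΣ = SumLaws ℕ._+_ ℕ._*_ 0 1 ℕ.+-*-isCommutativeSemiring Σℕ (λ _ → refl) (λ _ → refl)
module BΣ = SumLaws _xor_ _∧_ false true (CommutativeRing.isCommutativeSemiring Bool.xor-∧-commutativeRing)
  XOR (λ _ → refl) (λ _ → refl)

-- Integers inside the rationals

ι : ℤ → ℚ
ι z = z / 1

toℚᵘ-ι : ∀ z → ℚ.toℚᵘ (ι z) ℚᵘ.≃ ℚᵘ.mkℚᵘ z 0
toℚᵘ-ι z = ℚ.toℚᵘ-fromℚᵘ (ℚᵘ.mkℚᵘ z 0)

ι-+ : ∀ a b → ι (a ℤ.+ b) ≡ ι a ℚ.+ ι b
ι-+ a b = ℚ.toℚᵘ-injective (ℚᵘ.≃-trans (toℚᵘ-ι (a ℤ.+ b)) (ℚᵘ.≃-sym (ℚᵘ.≃-trans (ℚ.toℚᵘ-homo-+ (ι a) (ι b))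
  (ℚᵘ.≃-trans (ℚᵘ.+-cong (toℚᵘ-ι a) (toℚᵘ-ι b)) (ℚᵘ.*≡* (lemma a b))))))
  where
  lemma : ∀ a b → (a ℤ.* + 1 ℤ.+ b ℤ.* + 1) ℤ.* + 1 ≡ (a ℤ.+ b) ℤ.* + 1
  lemma = solve-∀

ι-* : ∀ a b → ι (a ℤ.* b) ≡ ι a ℚ.* ι b
ι-* a b = ℚ.toℚᵘ-injective (ℚᵘ.≃-trans (toℚᵘ-ι (a ℤ.* b)) (ℚᵘ.≃-sym (ℚᵘ.≃-trans (ℚ.toℚᵘ-homo-* (ι a) (ι b))
  (ℚᵘ.≃-trans (ℚᵘ.*-cong (toℚᵘ-ι a) (toℚᵘ-ι b)) (ℚᵘ.*≡* refl)))))

ι-injective : ∀ {a b} → ι a ≡ ι b → a ≡ b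
ι-injective {a} {b} e with ℚᵘ.≃-trans (ℚᵘ.≃-sym (toℚᵘ-ι a)) (ℚᵘ.≃-trans (ℚᵘ.≃-reflexive (cong ℚ.toℚᵘ e)) (toℚᵘ-ι b))
... | ℚᵘ.*≡* e′ = trans (sym (ℤ.*-identityʳ a)) (trans e′ (ℤ.*-identityʳ b))

ι-Σ : ∀ {n} (f : Fin n → ℤ) → ι (Σℤ f) ≡ Σℚ (ι ∘ f)
ι-Σ {zero}  f = refl
ι-Σ {suc n} f = trans (ι-+ (f Fin.zero) (Σℤ (f ∘ Fin.suc))) (cong (ι (f Fin.zero) ℚ.+_) (ι-Σ (f ∘ Fin.suc)))

ι-mono-≤ : ∀ {a b} → a ℤ.≤ b → ι a ℚ.≤ ι b
ι-mono-≤ {a} {b} a≤b = ℚ.toℚᵘ-cancel-≤ (ℚᵘ.≤-respˡ-≃ (ℚᵘ.≃-sym (toℚᵘ-ι a)) (ℚᵘ.≤-respʳ-≃ (ℚᵘ.≃-sym (toℚᵘ-ι b))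
  (ℚᵘ.*≤* (subst₂ ℤ._≤_ (sym (ℤ.*-identityʳ a)) (sym (ℤ.*-identityʳ b)) a≤b))))

-- Packed tables and Boolean tests

decode : (b : ℕ) .{{_ : NonZero b}} (n : ℕ) → ℕ → Vec ℕ n
decode b zero    k = []
-- The least significant digit comes first, so the rightmost digit of a numeral is entry 0.
decode b (suc n) k = k ℕ.% b ∷ decode b n (k ℕ./ b)

≡⇒T : ∀ {b} → b ≡ true → T b
≡⇒T refl = tt

T-∧ˡ : ∀ {x y} → T (x ∧ y) → T x
T-∧ˡ {true} _ = tt

T-∧ʳ : ∀ {x y} → T (x ∧ y) → T y
T-∧ʳ {true} t = t

T-∧ : ∀ {x y} → T x → T y → T (x ∧ y)
T-∧ {true} _ t = t

T-imp : ∀ {x y} → T (not x ∨ y) → T x → T y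
T-imp {true} t _ = t

-- Finite facts are tested by Boolean functions, whose evaluation builds no proof terms; the
-- soundness lemmas extract proofs from a single `true`.
allᵇ : ∀ {n} → (Fin n → Bool) → Bool
allᵇ {zero}  p = true
allᵇ {suc n} p = p Fin.zero ∧ allᵇ (p ∘ Fin.suc)

allᵇ-sound : ∀ {n} (p : Fin n → Bool) → T (allᵇ p) → ∀ i → T (p i)
allᵇ-sound p t Fin.zero    = T-∧ˡ t
allᵇ-sound p t (Fin.suc i) = allᵇ-sound (p ∘ Fin.suc) (T-∧ʳ {p Fin.zero} t) i

anyᵇ : ∀ {n} → (Fin n → Bool) → Bool
anyᵇ {zero}  p = false
anyᵇ {suc n} p = p Fin.zero ∨ anyᵇ (p ∘ Fin.suc)

anyᵇ-sound : ∀ {n} (p : Fin n → Bool) → T (anyᵇ p) → ∃[ i ] T (p i)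
anyᵇ-sound {suc n} p t with p Fin.zero in eq
... | true  = Fin.zero , subst T (sym eq) tt
... | false with anyᵇ-sound (p ∘ Fin.suc) t
...   | i , q = Fin.suc i , q

_=ᶠ_ : ∀ {n} → Fin n → Fin n → Bool
i =ᶠ j = toℕ i ℕ.≡ᵇ toℕ j

=ᶠ-sound : ∀ {n} {i j : Fin n} → T (i =ᶠ j) → i ≡ j
=ᶠ-sound {i = i} {j} t = Fin.toℕ-injective (ℕ.≡ᵇ⇒≡ (toℕ i) (toℕ j) t)

=ᶠ-complete : ∀ {n} {i j : Fin n} → i ≡ j → T (i =ᶠ j)
=ᶠ-complete {i = i} {j} e = ℕ.≡⇒≡ᵇ (toℕ i) (toℕ j) (cong toℕ e)

T-≢ : ∀ {n} {i j : Fin n} → i ≢ j → T (not (i =ᶠ j))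
T-≢ {i = i} {j} i≢j = go (i =ᶠ j) refl
  where
  go : ∀ b → (i =ᶠ j) ≡ b → T (not b)
  go true  e = i≢j (=ᶠ-sound (≡⇒T e))
  go false e = tt

_=ᵇ_ : Bool → Bool → Bool
x =ᵇ y = not (x xor y)

=ᵇ-sound : ∀ {x y} → T (x =ᵇ y) → x ≡ y
=ᵇ-sound {true}  {true}  _ = refl
=ᵇ-sound {false} {false} _ = refl

T⇒≡ : ∀ {b} → T b → b ≡ true
T⇒≡ {true} _ = refl

bit : Bool → ℕ
bit b = if b then 1 else 0

⟦_⟧ : Bool → ℤ
⟦ b ⟧ = + bit b

wt : ∀ {n} → (Fin n → Bool) → ℕ
wt w = Σℕ (bit ∘ w)

wt≡0 : ∀ {n} (w : Fin n → Bool) → wt w ≡ 0 → ∀ i → w i ≡ false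
wt≡0 w e Fin.zero with w Fin.zero
... | false = refl
wt≡0 w e (Fin.suc i) = wt≡0 (w ∘ Fin.suc) (ℕ.m+n≡0⇒n≡0 (bit (w Fin.zero)) e) i

⟦wt⟧ : ∀ {n} (w : Fin n → Bool) → Σℤ (⟦_⟧ ∘ w) ≡ + wt w
⟦wt⟧ {zero}  w = refl
⟦wt⟧ {suc n} w = trans (cong (ℤ._+_ ⟦ w Fin.zero ⟧) (⟦wt⟧ (w ∘ Fin.suc))) (sym (ℤ.pos-+ (bit (w Fin.zero)) _))

-- The bridge from binary orthogonality of codewords to divisibility by 2 of integer sums.
Σ⟦⟧-even : ∀ {n} (w : Fin n → Bool) → ∃[ t ] Σℤ (⟦_⟧ ∘ w) ≡ ⟦ XOR w ⟧ ℤ.+ + 2 ℤ.* t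
Σ⟦⟧-even {zero}  w = + 0 , refl
Σ⟦⟧-even {suc n} w with Σ⟦⟧-even (w ∘ Fin.suc)
... | t , e with carry (w Fin.zero) (XOR (w ∘ Fin.suc))
  where
  carry : ∀ a b → ∃[ s ] ⟦ a ⟧ ℤ.+ ⟦ b ⟧ ≡ ⟦ a xor b ⟧ ℤ.+ + 2 ℤ.* s
  carry true  true  = + 1 , refl
  carry true  false = + 0 , refl
  carry false true  = + 0 , refl
  carry false false = + 0 , refl
...   | s , e′ = s ℤ.+ t , trans (cong (ℤ._+_ ⟦ w Fin.zero ⟧) e) (rearrange ⟦ w Fin.zero ⟧ ⟦ XOR (w ∘ Fin.suc) ⟧ ⟦ w Fin.zero xor XOR (w ∘ Fin.suc) ⟧ s t e′)
  where
  assoc₂ : ∀ a b t → a ℤ.+ (b ℤ.+ + 2 ℤ.* t) ≡ (a ℤ.+ b) ℤ.+ + 2 ℤ.* t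
  assoc₂ = solve-∀
  collect : ∀ c s t → (c ℤ.+ + 2 ℤ.* s) ℤ.+ + 2 ℤ.* t ≡ c ℤ.+ + 2 ℤ.* (s ℤ.+ t)
  collect = solve-∀
  rearrange : ∀ a b c s t → a ℤ.+ b ≡ c ℤ.+ + 2 ℤ.* s → a ℤ.+ (b ℤ.+ + 2 ℤ.* t) ≡ c ℤ.+ + 2 ℤ.* (s ℤ.+ t)
  rearrange a b c s t e = trans (assoc₂ a b t) (trans (cong (λ x → x ℤ.+ + 2 ℤ.* t) e) (collect c s t))

-- The Golay code

dot : ∀ {n} → (Fin n → Bool) → (Fin n → Bool) → Bool
dot v w = XOR (λ j → v j ∧ w j)

dot-comm : ∀ {n} (v w : Fin n → Bool) → dot v w ≡ dot w v
dot-comm v w = BΣ.Σ-cong (λ j → Bool.∧-comm (v j) (w j))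

-- D is dual to the basis G, and R expresses what is left of each unit vector as a codeword.
module SelfDualCode {m n} (G D R : Fin m → Fin n → Bool)
  (orthogonal : ∀ i k → dot (G i) (G k) ≡ false)
  (resolution : ∀ j l → BΣ.indicator j l ≡ XOR (λ i → G i j ∧ D i l) xor XOR (λ k → R k j ∧ G k l))
  (even : ∀ k → XOR (G k) ≡ false) where

  InCode : (Fin n → Bool) → Set
  InCode w = Σ (Fin m → Bool) λ c → ∀ j → w j ≡ XOR (λ i → c i ∧ G i j)

  code-cong : ∀ {v w} → (∀ i → v i ≡ w i) → InCode w → InCode v
  code-cong e (c , p) = c , λ j → trans (e j) (p j)

  dot-code : ∀ v {w} → InCode w → (∀ k → dot v (G k) ≡ false) → dot v w ≡ false
  dot-code v (c , p) orth =
    trans (BΣ.Σ-cong (λ j → cong (v j ∧_) (p j)))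
    (trans (BΣ.Σ-adjoint v c G)
    (BΣ.Σ-0 (λ i → trans (cong (c i ∧_) (orth i)) (Bool.∧-zeroʳ (c i)))))

  code⇒orth : ∀ {w} → InCode w → ∀ k → dot w (G k) ≡ false
  code⇒orth {w} w∈C k = trans (dot-comm w (G k)) (dot-code (G k) w∈C (orthogonal k))

  code-dot : ∀ {v w} → InCode v → InCode w → dot v w ≡ false
  code-dot {v} v∈C w∈C = dot-code v w∈C (code⇒orth v∈C)

  -- Pairing w with the resolution of each unit vector kills the codeword part, by orthogonality;
  -- what remains writes w in terms of the rows, with coefficients `dot w (D i)`. Membership in the
  -- code is thus tested by as many parity checks as there are rows.
  orth⇒code : ∀ {w} → (∀ k → dot w (G k) ≡ false) → InCode w
  orth⇒code {w} orth = (λ i → dot w (D i)) , λ j → begin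
    w j ≡⟨ BΣ.Σ-indicator j w ⟨
    XOR (λ l → BΣ.indicator j l ∧ w l)
      ≡⟨ BΣ.Σ-cong (λ l → trans (cong (_∧ w l) (resolution j l)) (Bool.∧-comm _ (w l))) ⟩
    XOR (λ l → w l ∧ (XOR (λ i → G i j ∧ D i l) xor XOR (λ k → R k j ∧ G k l)))
      ≡⟨ BΣ.Σ-cong (λ l → Bool.∧-distribˡ-xor (w l) _ _) ⟩
    XOR (λ l → (w l ∧ XOR (λ i → G i j ∧ D i l)) xor (w l ∧ XOR (λ k → R k j ∧ G k l)))
      ≡⟨ BΣ.Σ-+ (λ l → w l ∧ XOR (λ i → G i j ∧ D i l)) (λ l → w l ∧ XOR (λ k → R k j ∧ G k l)) ⟩
    XOR (λ l → w l ∧ XOR (λ i → G i j ∧ D i l)) xor XOR (λ l → w l ∧ XOR (λ k → R k j ∧ G k l))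
      ≡⟨ cong₂ _xor_ (BΣ.Σ-adjoint w (λ i → G i j) D)
          (trans (BΣ.Σ-adjoint w (λ k → R k j) G)
          (BΣ.Σ-0 (λ k → trans (cong (R k j ∧_) (orth k)) (Bool.∧-zeroʳ (R k j))))) ⟩
    XOR (λ i → G i j ∧ dot w (D i)) xor false ≡⟨ Bool.xor-identityʳ _ ⟩
    XOR (λ i → G i j ∧ dot w (D i)) ≡⟨ BΣ.Σ-cong (λ i → Bool.∧-comm (G i j) _) ⟩
    XOR (λ i → dot w (D i) ∧ G i j) ∎
    where open ≡-Reasoning

  code-xor : ∀ {v w} → InCode v → InCode w → InCode (λ i → v i xor w i)
  code-xor {v} {w} v∈C w∈C = orth⇒code λ k → trans
    (BΣ.Σ-cong (λ j → Bool.∧-distribʳ-xor (G k j) (v j) (w j)))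
    (trans (BΣ.Σ-+ (λ j → v j ∧ G k j) (λ j → w j ∧ G k j))
    (cong₂ _xor_ (code⇒orth v∈C k) (code⇒orth w∈C k)))

  code-const : ∀ b → InCode (λ _ → b)
  code-const false = orth⇒code (λ k → BΣ.Σ-0 {n} (λ j → refl))
  code-const true  = orth⇒code even

  -- The pairing is invariant under permutations: `w ∘ π⁻¹` against a row equals w against the row
  -- composed with π, which is again a codeword.
  code-permute⁻¹ : (π : Permutation′ n) → (∀ w → InCode w → InCode (λ i → w (π ⟨$⟩ʳ i))) →
                   ∀ w → InCode w → InCode (λ i → w (π ⟨$⟩ˡ i))
  code-permute⁻¹ π π∈Aut w w∈C = orth⇒code λ k → begin
    XOR (λ i → w (π ⟨$⟩ˡ i) ∧ G k i) ≡⟨ BΣ.Σ-permute (λ i → w (π ⟨$⟩ˡ i) ∧ G k i) π ⟨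
    XOR (λ i → w (π ⟨$⟩ˡ (π ⟨$⟩ʳ i)) ∧ G k (π ⟨$⟩ʳ i))
      ≡⟨ BΣ.Σ-cong (λ i → cong (λ x → w x ∧ G k (π ⟨$⟩ʳ i)) (Perm.inverseˡ π)) ⟩
    dot w (λ i → G k (π ⟨$⟩ʳ i)) ≡⟨ code-dot w∈C (π∈Aut (G k) (BΣ.indicator k , λ j → sym (BΣ.Σ-indicator k (λ i → G i j)))) ⟩
    false ∎
    where open ≡-Reasoning

  -- By self-duality it is enough to test the permuted rows against the rows.
  code-permute : (π : Permutation′ n) → (∀ i k → dot (λ j → G i (π ⟨$⟩ʳ j)) (G k) ≡ false) →
                 ∀ w → InCode w → InCode (λ i → w (π ⟨$⟩ʳ i))
  code-permute π orth w w∈C@(c , p) = orth⇒code λ k → begin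
    dot (λ j → w (π ⟨$⟩ʳ j)) (G k)
      ≡⟨ BΣ.Σ-cong (λ j → trans (cong (_∧ G k j) (p (π ⟨$⟩ʳ j))) (Bool.∧-comm _ (G k j))) ⟩
    XOR (λ j → G k j ∧ XOR (λ i → c i ∧ G i (π ⟨$⟩ʳ j))) ≡⟨ BΣ.Σ-adjoint (G k) c (λ i j → G i (π ⟨$⟩ʳ j)) ⟩
    XOR (λ i → c i ∧ dot (G k) (λ j → G i (π ⟨$⟩ʳ j)))
      ≡⟨ BΣ.Σ-0 (λ i → trans (cong (c i ∧_) (trans (dot-comm (G k) _) (orth i k))) (Bool.∧-zeroʳ (c i))) ⟩
    false ∎
    where open ≡-Reasoning

bitMatrix : ∀ {n} → Vec ℕ n → Fin n → Fin 24 → Bool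
bitMatrix ks i j = lookup (decode 10 24 (lookup ks i)) j ℕ.≡ᵇ 1

-- The first twelve columns of the generator matrix form a unitriangular block. `golayDual` is
-- supported on these coordinates and inverts that block; `golayRest` is supported on the other
-- twelve, where the unit vectors still differ from combinations of `golayDual` by codewords.
golayDual golayRest : Fin 12 → Fin 24 → Bool
golayDual = bitMatrix
  ( 000000000000000000000001 ∷ 000000000000000000000010 ∷ 000000000000000000000101
  ∷ 000000000000000000001010 ∷ 000000000000000000010100 ∷ 000000000000000000101001
  ∷ 000000000000000001010010 ∷ 000000000000000010100100 ∷ 000000000000000101001001
  ∷ 000000000000001010010011 ∷ 000000000000010100100111 ∷ 000000000000101001001111 ∷ [])
golayRest = bitMatrix
  ( 110001110101000000000000 ∷ 010010011111000000000000 ∷ 000100111110000000000000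
  ∷ 001001111100000000000000 ∷ 010011111000000000000000 ∷ 000111110000000000000000
  ∷ 001111100000000000000000 ∷ 011111000000000000000000 ∷ 011110000000000000000000
  ∷ 011100000000000000000000 ∷ 011000000000000000000000 ∷ 010000000000000000000000 ∷ [])

=ᵇ-matrix-sound : ∀ {m n} (A B : Fin m → Fin n → Bool) → allᵇ (λ i → allᵇ (λ j → A i j =ᵇ B i j)) ≡ true →
                  ∀ i j → A i j ≡ B i j
=ᵇ-matrix-sound A B t i j =
  =ᵇ-sound (allᵇ-sound (λ j → A i j =ᵇ B i j) (allᵇ-sound (λ i → allᵇ (λ j → A i j =ᵇ B i j)) (≡⇒T t) i) j)

module Golay = SelfDualCode golayGen golayDual golayRest
  (=ᵇ-matrix-sound (λ i k → dot (golayGen i) (golayGen k)) (λ i k → false) refl)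
  (=ᵇ-matrix-sound BΣ.indicator
    (λ j l → XOR (λ i → golayGen i j ∧ golayDual i l) xor XOR (λ k → golayRest k j ∧ golayGen k l)) refl)
  (λ k → =ᵇ-matrix-sound {1} (λ _ k → XOR (golayGen k)) (λ _ _ → false) refl Fin.zero k)

goodWeight : ℕ → Bool
goodWeight k = (k ℕ.≡ᵇ 0) ∨ ((8 ℕ.≤ᵇ k) ∧ (k ℕ.% 4 ℕ.≡ᵇ 0))

weight : ∀ {n} → Vec Bool n → ℕ
weight []       = 0
weight (b ∷ bs) = bit b ℕ.+ weight bs

weight≡wt : ∀ {n} (w : Vec Bool n) → weight w ≡ wt (lookup w)
weight≡wt []      = refl
weight≡wt (b ∷ w) = cong (bit b ℕ.+_) (weight≡wt w)

-- Branching on one coefficient at a time shares the partial sums, so that all 4096 Golay words cost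
-- about one vector addition each.
spanGood : ∀ {m n} → Vec (Vec Bool n) m → Vec Bool n → Bool
spanGood []       acc = goodWeight (weight acc)
spanGood (r ∷ rs) acc = spanGood rs acc ∧ spanGood rs (Vec.zipWith _xor_ acc r)

spanGood-sound : ∀ {m n} (rs : Vec (Vec Bool n) m) acc → T (spanGood rs acc) → ∀ (c : Fin m → Bool) →
  T (goodWeight (wt (λ j → lookup acc j xor XOR (λ i → c i ∧ lookup (lookup rs i) j))))
spanGood-sound [] acc t c =
  subst (T ∘ goodWeight) (trans (weight≡wt acc) (NΣ.Σ-cong (λ j → cong bit (sym (Bool.xor-identityʳ (lookup acc j)))))) t
spanGood-sound (r ∷ rs) acc t c with c Fin.zero
... | false = spanGood-sound rs acc (T-∧ˡ t) (c ∘ Fin.suc)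
... | true  = subst (T ∘ goodWeight)
  (NΣ.Σ-cong (λ j → cong bit (trans (cong (_xor _) (Vec.lookup-zipWith _xor_ j acc r)) (Bool.xor-assoc (lookup acc j) _ _))))
  (spanGood-sound rs _ (T-∧ʳ {spanGood rs acc} t) (c ∘ Fin.suc))

span-weight : ∀ {m n} (rs : Vec (Vec Bool n) m) → spanGood rs (Vec.replicate n false) ≡ true →
  ∀ {w} (c : Fin m → Bool) → (∀ j → w j ≡ XOR (λ i → c i ∧ lookup (lookup rs i) j)) →
  wt w ≡ 0 ⊎ (8 ≤ wt w × wt w ℕ.% 4 ≡ 0)
span-weight {m} {n} rs t {w} c p with wt w | subst (T ∘ goodWeight) good (spanGood-sound rs (Vec.replicate n false) (≡⇒T t) c)
  where
  good : wt (λ j → lookup (Vec.replicate n false) j xor XOR (λ i → c i ∧ lookup (lookup rs i) j)) ≡ wt w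
  good = NΣ.Σ-cong (λ j → cong bit (trans (cong (_xor XOR (λ i → c i ∧ lookup (lookup rs i) j))
    (Vec.lookup-replicate j false)) (sym (p j))))
... | zero  | _ = inj₁ refl
... | suc k | t = inj₂ (ℕ.≤ᵇ⇒≤ 8 (suc k) (T-∧ˡ t) , ℕ.≡ᵇ⇒≡ _ 0 (T-∧ʳ {8 ℕ.≤ᵇ suc k} t))

golay-weight : ∀ {w} → InGolay w → wt w ≡ 0 ⊎ (8 ≤ wt w × wt w ℕ.% 4 ≡ 0)
golay-weight {w} (c , p) = span-weight golayRows refl {w} c p

-- Remainders and squares of integers

%-unique : ∀ {r} q n .{{_ : NonZero n}} .{{_ : ℤ.NonZero (+ n)}} → r < n → (+ r ℤ.+ q ℤ.* + n) ℤ.% + n ≡ r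
%-unique {r} q n@(suc _) r<n = ℤ.+-injective (ℤ.i-j≡0⇒i≡j (+ s) (+ r) (ℤ.∣i∣≡0⇒i≡0 small))
  where
  x : ℤ
  x = + r ℤ.+ q ℤ.* + n
  s : ℕ
  s = x ℤ.% + n
  q′ : ℤ
  q′ = x ℤ./ + n
  diff : + s ℤ.- + r ≡ (q ℤ.- q′) ℤ.* + n
  diff = regroup (+ s) (+ r) q q′ (+ n) (ℤ.a≡a%n+[a/n]*n x (+ n))
    where
    move : ∀ s r q′ n → s ℤ.- r ≡ (s ℤ.+ q′ ℤ.* n) ℤ.- (r ℤ.+ q′ ℤ.* n)
    move = solve-∀
    back : ∀ r q q′ n → (r ℤ.+ q ℤ.* n) ℤ.- (r ℤ.+ q′ ℤ.* n) ≡ (q ℤ.- q′) ℤ.* n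
    back = solve-∀
    regroup : ∀ s r q q′ n → r ℤ.+ q ℤ.* n ≡ s ℤ.+ q′ ℤ.* n → s ℤ.- r ≡ (q ℤ.- q′) ℤ.* n
    regroup s r q q′ n e = trans (move s r q′ n) (trans (cong (λ t → t ℤ.- (r ℤ.+ q′ ℤ.* n)) (sym e)) (back r q q′ n))
  bound : ℤ.∣ + s ℤ.- + r ∣ < n
  bound = ℕ.≤-<-trans (subst (ℕ._≤ s ℕ.⊔ r) (cong ℤ.∣_∣ (sym (ℤ.m-n≡m⊖n s r))) (ℤ.∣m⊝n∣≤m⊔n s r))
    (ℕ.⊔-lub (ℤ.n%d<d x (+ n)) r<n)
  multiple : ℤ.∣ + s ℤ.- + r ∣ ≡ ℤ.∣ q ℤ.- q′ ∣ * n
  multiple = trans (cong ℤ.∣_∣ diff) (ℤ.abs-* (q ℤ.- q′) (+ n))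
  -- Two residues below n that differ by a multiple of n coincide.
  small : ℤ.∣ + s ℤ.- + r ∣ ≡ 0
  small with ℤ.∣ q ℤ.- q′ ∣ | multiple
  ... | zero  | e = e
  ... | suc k | e = ⊥-elim (ℕ.<⇒≱ bound (subst (n ℕ.≤_) (sym e) (ℕ.m≤m+n n (k * n))))

square-abs : ∀ i → i ℤ.* i ≡ + (ℤ.∣ i ∣ * ℤ.∣ i ∣)
square-abs (+ n)    = sym (ℤ.pos-* n n)
square-abs -[1+ n ] = refl

square-nonneg : ∀ i → + 0 ℤ.≤ i ℤ.* i
square-nonneg i = subst (+ 0 ℤ.≤_) (sym (square-abs i)) (ℤ.+≤+ ℕ.z≤n)

square-pos : ∀ i → i ≢ + 0 → + 1 ℤ.≤ i ℤ.* i
square-pos (+ zero)  i≢0 = ⊥-elim (i≢0 refl)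
square-pos (+ suc n) i≢0 = ℤ.+≤+ (ℕ.s≤s ℕ.z≤n)
square-pos -[1+ n ]  i≢0 = ℤ.+≤+ (ℕ.s≤s ℕ.z≤n)

odd≢0 : ∀ y → + 1 ℤ.+ y ℤ.* + 2 ≢ + 0
odd≢0 y e with trans (sym (%-unique y 2 (ℕ.s≤s (ℕ.s≤s ℕ.z≤n)))) (cong (λ x → x ℤ.% + 2) e)
... | ()

square≡self-mod2 : ∀ y → ∃[ t ] y ℤ.* y ≡ y ℤ.+ + 2 ℤ.* t
square≡self-mod2 y with y ℤ.% + 2 | ℤ.n%d<d y (+ 2) | ℤ.a≡a%n+[a/n]*n y (+ 2)
... | 0 | _ | e = _ , subst (λ y → y ℤ.* y ≡ y ℤ.+ + 2 ℤ.* (q ℤ.* q ℤ.* + 2 ℤ.- q)) (sym e) (lemma q)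
  where
  q : ℤ
  q = y ℤ./ + 2
  lemma : ∀ q → (+ 0 ℤ.+ q ℤ.* + 2) ℤ.* (+ 0 ℤ.+ q ℤ.* + 2) ≡ (+ 0 ℤ.+ q ℤ.* + 2) ℤ.+ + 2 ℤ.* (q ℤ.* q ℤ.* + 2 ℤ.- q)
  lemma = solve-∀
... | 1 | _ | e = _ , subst (λ y → y ℤ.* y ≡ y ℤ.+ + 2 ℤ.* (q ℤ.* q ℤ.* + 2 ℤ.+ q)) (sym e) (lemma q)
  where
  q : ℤ
  q = y ℤ./ + 2
  lemma : ∀ q → (+ 1 ℤ.+ q ℤ.* + 2) ℤ.* (+ 1 ℤ.+ q ℤ.* + 2) ≡ (+ 1 ℤ.+ q ℤ.* + 2) ℤ.+ + 2 ℤ.* (q ℤ.* q ℤ.* + 2 ℤ.+ q)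
  lemma = solve-∀
... | suc (suc _) | ℕ.s≤s (ℕ.s≤s ()) | _

Σℤ-mono : ∀ {n} {f g : Fin n → ℤ} → (∀ i → f i ℤ.≤ g i) → Σℤ f ℤ.≤ Σℤ g
Σℤ-mono {zero}  f≤g = ℤ.≤-refl
Σℤ-mono {suc n} f≤g = ℤ.+-mono-≤ (f≤g Fin.zero) (Σℤ-mono (f≤g ∘ Fin.suc))

Σℤ-const : ∀ n k → Σℤ {n} (λ _ → k) ≡ + n ℤ.* k
Σℤ-const zero    k = refl
Σℤ-const (suc n) k = trans (cong (ℤ._+_ k) (Σℤ-const n k)) (sym (ℤ.suc-* (+ n) k))

Σℤ-pos : ∀ {n} (f : Fin n → ℕ) → Σℤ (λ i → + f i) ≡ + Σℕ f
Σℤ-pos {zero}  f = refl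
Σℤ-pos {suc n} f = cong (ℤ._+_ (+ f Fin.zero)) (Σℤ-pos (f ∘ Fin.suc))

Σℕ≡0 : ∀ {n} (f : Fin n → ℕ) → Σℕ f ≡ 0 → ∀ i → f i ≡ 0
Σℕ≡0 f e Fin.zero    = ℕ.m+n≡0⇒m≡0 (f Fin.zero) e
Σℕ≡0 f e (Fin.suc i) = Σℕ≡0 (f ∘ Fin.suc) (ℕ.m+n≡0⇒n≡0 (f Fin.zero) e) i

-- The Leech lattice

-- The code and the length stay variables, with 24 supplied by an equation, so that sums are not
-- unfolded into 24 terms during the algebra. What is assumed of the code is linearity, the all-one
-- word, self-orthogonality and the weights.
module LeechLattice {n} (n≡24 : n ≡ 24) (C : (Fin n → Bool) → Set)
  (C-cong : ∀ {v w} → (∀ i → v i ≡ w i) → C w → C v)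
  (C-xor : ∀ {v w} → C v → C w → C (λ i → v i xor w i))
  (C-const : ∀ b → C (λ _ → b))
  (C-dot : ∀ {v w} → C v → C w → dot v w ≡ false)
  (C-weight : ∀ {w} → C w → wt w ≡ 0 ⊎ (8 ≤ wt w × wt w ℕ.% 4 ≡ 0)) where

  InLeech : (Fin n → ℤ) → Set
  InLeech z = ∃[ m ] (m ≤ 1
    × (∀ i → z i ℤ.% + 2 ≡ m)
    × (∀ ν → ν < 4 → C (λ i → (z i ℤ.% + 4) ℕ.≡ᵇ ν))
    × (Σℤ z ℤ.% + 8 ≡ 4 * m))

  -- The vector m·1 + 2c + 4y, with the codeword c read as a 0/1 vector.
  record Glue (z : Fin n → ℤ) : Set where
    field
      m : Bool
      c : Fin n → Bool
      c∈C : C c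
      y : Fin n → ℤ
      z≡ : ∀ i → z i ≡ ⟦ m ⟧ ℤ.+ + 2 ℤ.* ⟦ c i ⟧ ℤ.+ + 4 ℤ.* y i
      t : ℤ
      Σy≡ : Σℤ y ≡ ⟦ m ⟧ ℤ.+ + 2 ℤ.* t

  Σ-const : ∀ k → Σℤ {n} (λ _ → k) ≡ + 24 ℤ.* k
  Σ-const k = trans (Σℤ-const n k) (cong (λ n → + n ℤ.* k) n≡24)

  C-wt4 : ∀ {c} → C c → ∃[ a ] Σℤ (⟦_⟧ ∘ c) ≡ + 4 ℤ.* a
  C-wt4 {c} c∈C with C-weight c∈C
  ... | inj₁ e = + 0 , trans (⟦wt⟧ c) (cong +_ e)
  ... | inj₂ (_ , e) = + (wt c ℕ./ 4) , trans (⟦wt⟧ c) (trans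
    (cong +_ (trans (ℕ.m≡m%n+[m/n]*n (wt c) 4) (trans (cong (ℕ._+ wt c ℕ./ 4 * 4) e) (ℕ.*-comm (wt c ℕ./ 4) 4))))
    (ℤ.pos-* 4 (wt c ℕ./ 4)))

  C-even : ∀ {c} → C c → XOR c ≡ false
  C-even {c} c∈C = trans (BΣ.Σ-cong (λ j → sym (Bool.∧-identityʳ (c j)))) (C-dot c∈C (C-const true))

  Σ-glue : ∀ k (f g : Fin n → ℤ) → Σℤ (λ i → k ℤ.+ + 2 ℤ.* f i ℤ.+ + 4 ℤ.* g i) ≡ + 24 ℤ.* k ℤ.+ + 2 ℤ.* Σℤ f ℤ.+ + 4 ℤ.* Σℤ g
  Σ-glue k f g = trans (ZΣ.Σ-+ (λ i → k ℤ.+ + 2 ℤ.* f i) (λ i → + 4 ℤ.* g i)) (cong₂ ℤ._+_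
    (trans (ZΣ.Σ-+ (λ _ → k) (λ i → + 2 ℤ.* f i)) (cong₂ ℤ._+_ (Σ-const k) (ZΣ.Σ-*ˡ (+ 2) f)))
    (ZΣ.Σ-*ˡ (+ 4) g))

  mod4 : ∀ m r → r < 4 → r ℕ.% 2 ≡ bit m → + r ≡ ⟦ m ⟧ ℤ.+ + 2 ℤ.* ⟦ r ℕ.≡ᵇ (2 ℕ.+ bit m) ⟧
  mod4 false 0 _ _ = refl
  mod4 true  1 _ _ = refl
  mod4 false 2 _ _ = refl
  mod4 true  3 _ _ = refl
  mod4 m (suc (suc (suc (suc _)))) (ℕ.s≤s (ℕ.s≤s (ℕ.s≤s (ℕ.s≤s ())))) _
  mod4 false 1 _ ()
  mod4 false 3 _ ()
  mod4 true 0 _ ()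
  mod4 true 2 _ ()

  mod4-mod2 : ∀ z → z ℤ.% + 4 ℕ.% 2 ≡ z ℤ.% + 2
  mod4-mod2 z = sym (trans (cong (λ x → x ℤ.% + 2) z≡) (%-unique q 2 (ℕ.m%n<n r 2)))
    where
    r : ℕ
    r = z ℤ.% + 4
    q : ℤ
    q = + (r ℕ./ 2) ℤ.+ (z ℤ./ + 4) ℤ.* + 2
    lemma : ∀ a b c → (a ℤ.+ b ℤ.* + 2) ℤ.+ c ℤ.* + 4 ≡ a ℤ.+ (b ℤ.+ c ℤ.* + 2) ℤ.* + 2
    lemma = solve-∀
    z≡ : z ≡ + (r ℕ.% 2) ℤ.+ q ℤ.* + 2
    z≡ = trans (ℤ.a≡a%n+[a/n]*n z (+ 4)) (trans (cong (λ x → x ℤ.+ (z ℤ./ + 4) ℤ.* + 4)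
      (trans (cong +_ (ℕ.m≡m%n+[m/n]*n r 2)) (trans (ℤ.pos-+ (r ℕ.% 2) _) (cong (ℤ._+_ (+ (r ℕ.% 2))) (ℤ.pos-* (r ℕ./ 2) 2)))))
      (lemma (+ (r ℕ.% 2)) (+ (r ℕ./ 2)) (z ℤ./ + 4)))

  -- One residue class modulo 4 determines c. Writing wt c = 4a, the sum condition reads 24m + 8a +
  -- 4Σy = 4m + 8q, which gives Σy = m + 2(q - 3m - a).
  glue : ∀ z m → (∀ i → z i ℤ.% + 2 ≡ bit m) → C (λ i → (z i ℤ.% + 4) ℕ.≡ᵇ (2 ℕ.+ bit m)) →
         Σℤ z ℤ.% + 8 ≡ 4 * bit m → Glue z
  glue z m parity c∈C sum = record
    { m = m ; c = c ; c∈C = c∈C ; y = y ; z≡ = z≡ ; t = t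
    ; Σy≡ = ℤ.*-cancelˡ-≡ (+ 4) (Σℤ y) _ (quarter (Σℤ z) (Σℤ y) ⟦ m ⟧ (Σℤ (⟦_⟧ ∘ c)) a q sum≡ (proj₂ (C-wt4 c∈C))
        (trans (ℤ.a≡a%n+[a/n]*n (Σℤ z) (+ 8)) (cong (λ x → x ℤ.+ q ℤ.* + 8) (trans (cong +_ sum) (ℤ.pos-* 4 (bit m)))))) }
    where
    c : Fin n → Bool
    c i = (z i ℤ.% + 4) ℕ.≡ᵇ (2 ℕ.+ bit m)
    y : Fin n → ℤ
    y i = z i ℤ./ + 4
    a q t : ℤ
    a = proj₁ (C-wt4 c∈C)
    q = Σℤ z ℤ./ + 8
    t = q ℤ.- + 3 ℤ.* ⟦ m ⟧ ℤ.- a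
    z≡ : ∀ i → z i ≡ ⟦ m ⟧ ℤ.+ + 2 ℤ.* ⟦ c i ⟧ ℤ.+ + 4 ℤ.* y i
    z≡ i = trans (ℤ.a≡a%n+[a/n]*n (z i) (+ 4)) (cong₂ ℤ._+_
      (mod4 m (z i ℤ.% + 4) (ℤ.n%d<d (z i) (+ 4)) (trans (mod4-mod2 (z i)) (parity i)))
      (ℤ.*-comm (y i) (+ 4)))
    sum≡ : Σℤ z ≡ + 24 ℤ.* ⟦ m ⟧ ℤ.+ + 2 ℤ.* Σℤ (⟦_⟧ ∘ c) ℤ.+ + 4 ℤ.* Σℤ y
    sum≡ = trans (ZΣ.Σ-cong z≡) (Σ-glue ⟦ m ⟧ (⟦_⟧ ∘ c) y)
    quarter : ∀ s Y m c a q → s ≡ + 24 ℤ.* m ℤ.+ + 2 ℤ.* c ℤ.+ + 4 ℤ.* Y → c ≡ + 4 ℤ.* a → s ≡ + 4 ℤ.* m ℤ.+ q ℤ.* + 8 →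
      + 4 ℤ.* Y ≡ + 4 ℤ.* (m ℤ.+ + 2 ℤ.* (q ℤ.- + 3 ℤ.* m ℤ.- a))
    quarter s Y m c a q e₁ refl e₂ = trans (isolate m a Y) (trans (cong (λ s → s ℤ.- + 24 ℤ.* m ℤ.- + 8 ℤ.* a) (trans (sym e₁) e₂)) (collect m a q))
      where
      isolate : ∀ m a Y → + 4 ℤ.* Y ≡ (+ 24 ℤ.* m ℤ.+ + 2 ℤ.* (+ 4 ℤ.* a) ℤ.+ + 4 ℤ.* Y) ℤ.- + 24 ℤ.* m ℤ.- + 8 ℤ.* a
      isolate = solve-∀
      collect : ∀ m a q → (+ 4 ℤ.* m ℤ.+ q ℤ.* + 8) ℤ.- + 24 ℤ.* m ℤ.- + 8 ℤ.* a ≡ + 4 ℤ.* (m ℤ.+ + 2 ℤ.* (q ℤ.- + 3 ℤ.* m ℤ.- a))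
      collect = solve-∀

  leech⇒glue : ∀ {z} → InLeech z → Glue z
  leech⇒glue {z} (0 , _ , parity , sets , sum) = glue z false parity (sets 2 (ℕ.s≤s (ℕ.s≤s (ℕ.s≤s ℕ.z≤n)))) sum
  leech⇒glue {z} (1 , _ , parity , sets , sum) = glue z true  parity (sets 3 ℕ.≤-refl) sum
  leech⇒glue (suc (suc _) , ℕ.s≤s () , _)

  glue⇒leech : ∀ {z} → Glue z → InLeech z
  glue⇒leech {z} record { m = m ; c = c ; c∈C = c∈C ; y = y ; z≡ = z≡ ; t = t ; Σy≡ = Σy≡ } =
    bit m , bit≤1 m , parity , (λ ν ν<4 → C-cong (λ i → cong (ℕ._≡ᵇ ν) (residue i)) (sets m ν ν<4)) , sum
    where
    bit≤1 : ∀ b → bit b ≤ 1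
    bit≤1 true  = ℕ.s≤s ℕ.z≤n
    bit≤1 false = ℕ.z≤n
    parity : ∀ i → z i ℤ.% + 2 ≡ bit m
    parity i = trans (cong (λ x → x ℤ.% + 2) (trans (z≡ i) (lemma ⟦ m ⟧ ⟦ c i ⟧ (y i))))
      (%-unique (⟦ c i ⟧ ℤ.+ + 2 ℤ.* y i) 2 (ℕ.s≤s (bit≤1 m)))
      where
      lemma : ∀ m c y → m ℤ.+ + 2 ℤ.* c ℤ.+ + 4 ℤ.* y ≡ m ℤ.+ (c ℤ.+ + 2 ℤ.* y) ℤ.* + 2
      lemma = solve-∀
    residue : ∀ i → z i ℤ.% + 4 ≡ bit m ℕ.+ 2 * bit (c i)
    residue i = trans (cong (λ x → x ℤ.% + 4) (trans (z≡ i) (trans (cong (ℤ._+_ (⟦ m ⟧ ℤ.+ + 2 ℤ.* ⟦ c i ⟧)) (ℤ.*-comm (+ 4) (y i)))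
        (cong (λ x → x ℤ.+ y i ℤ.* + 4) (sym (trans (ℤ.pos-+ (bit m) _) (cong (ℤ._+_ ⟦ m ⟧) (ℤ.pos-* 2 (bit (c i))))))))))
      (%-unique (y i) 4 (ℕ.s≤s (ℕ.+-mono-≤ (bit≤1 m) (ℕ.*-monoʳ-≤ 2 (bit≤1 (c i))))))
    complement : C (not ∘ c)
    complement = C-cong (λ i → sym (Bool.true-xor _)) (C-xor (C-const true) c∈C)
    sets : ∀ m ν → ν < 4 → C (λ i → (bit m ℕ.+ 2 * bit (c i)) ℕ.≡ᵇ ν)
    sets false 0 _ = C-cong (λ i → cases (c i)) complement where
      cases : ∀ b → ((2 * bit b) ℕ.≡ᵇ 0) ≡ not b
      cases true = refl
      cases false = refl
    sets false 1 _ = C-cong (λ i → cases (c i)) (C-const false) where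
      cases : ∀ b → ((2 * bit b) ℕ.≡ᵇ 1) ≡ false
      cases true = refl
      cases false = refl
    sets false 2 _ = C-cong (λ i → cases (c i)) c∈C where
      cases : ∀ b → ((2 * bit b) ℕ.≡ᵇ 2) ≡ b
      cases true = refl
      cases false = refl
    sets false 3 _ = C-cong (λ i → cases (c i)) (C-const false) where
      cases : ∀ b → ((2 * bit b) ℕ.≡ᵇ 3) ≡ false
      cases true = refl
      cases false = refl
    sets true 0 _ = C-cong (λ i → refl) (C-const false)
    -- The residues 1 + 2b of odd vectors are those of the even case shifted by one, and the two
    -- comparisons agree by computation.
    sets true (suc ν) (ℕ.s≤s ν<3) = sets false ν (ℕ.m≤n⇒m≤1+n ν<3)
    sets false (suc (suc (suc (suc _)))) (ℕ.s≤s (ℕ.s≤s (ℕ.s≤s (ℕ.s≤s ()))))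
    sum : Σℤ z ℤ.% + 8 ≡ 4 * bit m
    sum = trans (cong (λ x → x ℤ.% + 8) (trans (trans (ZΣ.Σ-cong z≡) (Σ-glue ⟦ m ⟧ (⟦_⟧ ∘ c) y))
        (trans (total ⟦ m ⟧ t _ _ _ (proj₂ (C-wt4 c∈C)) Σy≡) (cong (λ x → x ℤ.+ q ℤ.* + 8) (sym (ℤ.pos-* 4 (bit m)))))))
      (%-unique q 8 (ℕ.s≤s (ℕ.≤-trans (ℕ.*-monoʳ-≤ 4 (bit≤1 m)) (ℕ.m≤m+n 4 3))))
      where
      q : ℤ
      q = + 3 ℤ.* ⟦ m ⟧ ℤ.+ proj₁ (C-wt4 c∈C) ℤ.+ t
      total : ∀ m t a c Y → c ≡ + 4 ℤ.* a → Y ≡ m ℤ.+ + 2 ℤ.* t →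
              + 24 ℤ.* m ℤ.+ + 2 ℤ.* c ℤ.+ + 4 ℤ.* Y ≡ + 4 ℤ.* m ℤ.+ (+ 3 ℤ.* m ℤ.+ a ℤ.+ t) ℤ.* + 8
      total m t a _ _ refl refl = lemma m t a
        where
        lemma : ∀ m t a → + 24 ℤ.* m ℤ.+ + 2 ℤ.* (+ 4 ℤ.* a) ℤ.+ + 4 ℤ.* (m ℤ.+ + 2 ℤ.* t) ≡ + 4 ℤ.* m ℤ.+ (+ 3 ℤ.* m ℤ.+ a ℤ.+ t) ℤ.* + 8
        lemma = solve-∀

  C-∧-even : ∀ {c c′} → C c → C c′ → ∃[ k ] Σℤ (λ i → ⟦ c i ∧ c′ i ⟧) ≡ + 2 ℤ.* k
  C-∧-even {c} {c′} c∈C c′∈C with Σ⟦⟧-even (λ i → c i ∧ c′ i)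
  ... | k , e = k , trans e (trans (cong (λ b → ⟦ b ⟧ ℤ.+ + 2 ℤ.* k) (C-dot c∈C c′∈C)) (ℤ.+-identityˡ _))

  Σ-bilinear : ∀ μ μ′ (f g : Fin n → ℤ) → Σℤ (λ i → μ ℤ.* f i ℤ.+ μ′ ℤ.* g i) ≡ μ ℤ.* Σℤ f ℤ.+ μ′ ℤ.* Σℤ g
  Σ-bilinear μ μ′ f g = trans (ZΣ.Σ-+ (λ i → μ ℤ.* f i) (λ i → μ′ ℤ.* g i)) (cong₂ ℤ._+_ (ZΣ.Σ-*ˡ μ f) (ZΣ.Σ-*ˡ μ′ g))

  -- In the expanded product every group of terms is divisible by 8: codeword weights are multiples
  -- of 4, two codewords meet in an even number of points, and Σy ≡ m modulo 2 makes the two terms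
  -- 4μΣy′ and 4μ′Σy add up to a multiple of 8.
  leech-inner : ∀ {z z′} → InLeech z → InLeech z′ → ∃[ q ] Σℤ (λ i → z i ℤ.* z′ i) ≡ + 8 ℤ.* q
  leech-inner {z} {z′} z∈Λ z′∈Λ = _ , (begin
    Σℤ (λ i → z i ℤ.* z′ i)
      ≡⟨ ZΣ.Σ-cong (λ i → trans (cong₂ ℤ._*_ (g.z≡ i) (g′.z≡ i)) (expand (g.c i) (g.y i) (g′.c i) (g′.y i))) ⟩
    Σℤ (λ i → (μ ℤ.* μ′ ℤ.+ + 2 ℤ.* f i ℤ.+ + 4 ℤ.* h i) ℤ.+ (+ 4 ℤ.* cc i ℤ.+ + 8 ℤ.* r i))
      ≡⟨ ZΣ.Σ-+ (λ i → μ ℤ.* μ′ ℤ.+ + 2 ℤ.* f i ℤ.+ + 4 ℤ.* h i) (λ i → + 4 ℤ.* cc i ℤ.+ + 8 ℤ.* r i) ⟩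
    Σℤ (λ i → μ ℤ.* μ′ ℤ.+ + 2 ℤ.* f i ℤ.+ + 4 ℤ.* h i) ℤ.+ Σℤ (λ i → + 4 ℤ.* cc i ℤ.+ + 8 ℤ.* r i)
      ≡⟨ cong₂ ℤ._+_ (Σ-glue (μ ℤ.* μ′) f h) (Σ-bilinear (+ 4) (+ 8) cc r) ⟩
    + 24 ℤ.* (μ ℤ.* μ′) ℤ.+ + 2 ℤ.* Σℤ f ℤ.+ + 4 ℤ.* Σℤ h ℤ.+ (+ 4 ℤ.* Σℤ cc ℤ.+ + 8 ℤ.* Σℤ r)
      ≡⟨ cong₂ (λ F H → + 24 ℤ.* (μ ℤ.* μ′) ℤ.+ + 2 ℤ.* F ℤ.+ + 4 ℤ.* H ℤ.+ (+ 4 ℤ.* Σℤ cc ℤ.+ + 8 ℤ.* Σℤ r))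
          (Σ-bilinear μ μ′ (⟦_⟧ ∘ g′.c) (⟦_⟧ ∘ g.c)) (Σ-bilinear μ μ′ g′.y g.y) ⟩
    _ ≡⟨ divide μ μ′ (proj₁ (C-wt4 g.c∈C)) (proj₁ (C-wt4 g′.c∈C)) g.t g′.t (proj₁ (C-∧-even g.c∈C g′.c∈C)) (Σℤ r)
          (proj₂ (C-wt4 g.c∈C)) (proj₂ (C-wt4 g′.c∈C)) g.Σy≡ g′.Σy≡ (proj₂ (C-∧-even g.c∈C g′.c∈C)) ⟩
    + 8 ℤ.* _ ∎)
    where
    open ≡-Reasoning
    module g = Glue (leech⇒glue z∈Λ)
    module g′ = Glue (leech⇒glue z′∈Λ)
    μ μ′ : ℤ
    μ = ⟦ g.m ⟧
    μ′ = ⟦ g′.m ⟧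
    f h cc r : Fin n → ℤ
    f i = μ ℤ.* ⟦ g′.c i ⟧ ℤ.+ μ′ ℤ.* ⟦ g.c i ⟧
    h i = μ ℤ.* g′.y i ℤ.+ μ′ ℤ.* g.y i
    cc i = ⟦ g.c i ∧ g′.c i ⟧
    r i = ⟦ g.c i ⟧ ℤ.* g′.y i ℤ.+ ⟦ g′.c i ⟧ ℤ.* g.y i ℤ.+ + 2 ℤ.* (g.y i ℤ.* g′.y i)
    bit-∧ : ∀ a b → ⟦ a ⟧ ℤ.* ⟦ b ⟧ ≡ ⟦ a ∧ b ⟧
    bit-∧ true  true  = refl
    bit-∧ true  false = refl
    bit-∧ false b     = refl
    ring : ∀ m m′ c y c′ y′ → (m ℤ.+ + 2 ℤ.* c ℤ.+ + 4 ℤ.* y) ℤ.* (m′ ℤ.+ + 2 ℤ.* c′ ℤ.+ + 4 ℤ.* y′) ≡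
      (m ℤ.* m′ ℤ.+ + 2 ℤ.* (m ℤ.* c′ ℤ.+ m′ ℤ.* c) ℤ.+ + 4 ℤ.* (m ℤ.* y′ ℤ.+ m′ ℤ.* y))
      ℤ.+ (+ 4 ℤ.* (c ℤ.* c′) ℤ.+ + 8 ℤ.* (c ℤ.* y′ ℤ.+ c′ ℤ.* y ℤ.+ + 2 ℤ.* (y ℤ.* y′)))
    ring = solve-∀
    expand : ∀ c y c′ y′ → (μ ℤ.+ + 2 ℤ.* ⟦ c ⟧ ℤ.+ + 4 ℤ.* y) ℤ.* (μ′ ℤ.+ + 2 ℤ.* ⟦ c′ ⟧ ℤ.+ + 4 ℤ.* y′) ≡
      (μ ℤ.* μ′ ℤ.+ + 2 ℤ.* (μ ℤ.* ⟦ c′ ⟧ ℤ.+ μ′ ℤ.* ⟦ c ⟧) ℤ.+ + 4 ℤ.* (μ ℤ.* y′ ℤ.+ μ′ ℤ.* y))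
      ℤ.+ (+ 4 ℤ.* ⟦ c ∧ c′ ⟧ ℤ.+ + 8 ℤ.* (⟦ c ⟧ ℤ.* y′ ℤ.+ ⟦ c′ ⟧ ℤ.* y ℤ.+ + 2 ℤ.* (y ℤ.* y′)))
    expand c y c′ y′ = trans (ring μ μ′ ⟦ c ⟧ y ⟦ c′ ⟧ y′) (cong (λ x →
      (μ ℤ.* μ′ ℤ.+ + 2 ℤ.* (μ ℤ.* ⟦ c′ ⟧ ℤ.+ μ′ ℤ.* ⟦ c ⟧) ℤ.+ + 4 ℤ.* (μ ℤ.* y′ ℤ.+ μ′ ℤ.* y))
      ℤ.+ (+ 4 ℤ.* x ℤ.+ + 8 ℤ.* (⟦ c ⟧ ℤ.* y′ ℤ.+ ⟦ c′ ⟧ ℤ.* y ℤ.+ + 2 ℤ.* (y ℤ.* y′)))) (bit-∧ c c′))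
    divide : ∀ μ μ′ a a′ t t′ k R {c c′ Y Y′ K} → c ≡ + 4 ℤ.* a → c′ ≡ + 4 ℤ.* a′ →
      Y ≡ μ ℤ.+ + 2 ℤ.* t → Y′ ≡ μ′ ℤ.+ + 2 ℤ.* t′ → K ≡ + 2 ℤ.* k →
      + 24 ℤ.* (μ ℤ.* μ′) ℤ.+ + 2 ℤ.* (μ ℤ.* c′ ℤ.+ μ′ ℤ.* c) ℤ.+ + 4 ℤ.* (μ ℤ.* Y′ ℤ.+ μ′ ℤ.* Y) ℤ.+ (+ 4 ℤ.* K ℤ.+ + 8 ℤ.* R) ≡
      + 8 ℤ.* (+ 4 ℤ.* (μ ℤ.* μ′) ℤ.+ (μ ℤ.* a′ ℤ.+ μ′ ℤ.* a) ℤ.+ (μ ℤ.* t′ ℤ.+ μ′ ℤ.* t) ℤ.+ k ℤ.+ R)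
    divide μ μ′ a a′ t t′ k R refl refl refl refl refl = lemma μ μ′ a a′ t t′ k R
      where
      lemma : ∀ μ μ′ a a′ t t′ k R →
        + 24 ℤ.* (μ ℤ.* μ′) ℤ.+ + 2 ℤ.* (μ ℤ.* (+ 4 ℤ.* a′) ℤ.+ μ′ ℤ.* (+ 4 ℤ.* a))
        ℤ.+ + 4 ℤ.* (μ ℤ.* (μ′ ℤ.+ + 2 ℤ.* t′) ℤ.+ μ′ ℤ.* (μ ℤ.+ + 2 ℤ.* t)) ℤ.+ (+ 4 ℤ.* (+ 2 ℤ.* k) ℤ.+ + 8 ℤ.* R) ≡
        + 8 ℤ.* (+ 4 ℤ.* (μ ℤ.* μ′) ℤ.+ (μ ℤ.* a′ ℤ.+ μ′ ℤ.* a) ℤ.+ (μ ℤ.* t′ ℤ.+ μ′ ℤ.* t) ℤ.+ k ℤ.+ R)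
      lemma = solve-∀

  leech-8 : ∀ (w : Fin n → ℤ) → InLeech (λ i → + 8 ℤ.* w i)
  leech-8 w = glue⇒leech record
    { m = false ; c = λ _ → false ; c∈C = C-const false ; y = λ i → + 2 ℤ.* w i ; z≡ = λ i → lemma (w i)
    ; t = Σℤ w ; Σy≡ = trans (ZΣ.Σ-*ˡ (+ 2) w) (sym (ℤ.+-identityˡ _)) }
    where
    lemma : ∀ w → + 8 ℤ.* w ≡ + 0 ℤ.+ + 2 ℤ.* + 0 ℤ.+ + 4 ℤ.* (+ 2 ℤ.* w)
    lemma = solve-∀

  -- Addition of glue vectors is binary addition with carries.
  leech-+ : ∀ {z z′} → InLeech z → InLeech z′ → InLeech (λ i → z i ℤ.+ z′ i)
  leech-+ {z} {z′} z∈Λ z′∈Λ = glue⇒leech record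
    { m = g.m xor g′.m ; c = λ i → e xor (g.c i xor g′.c i) ; c∈C = C-xor (C-const e) (C-xor g.c∈C g′.c∈C)
    ; y = λ i → (g.y i ℤ.+ g′.y i) ℤ.+ ⟦ κ i ⟧
    ; z≡ = λ i → trans (cong₂ ℤ._+_ (g.z≡ i) (g′.z≡ i)) (digits (g.c i) (g.y i) (g′.c i) (g′.y i))
    ; t = g.t ℤ.+ g′.t ℤ.+ ⟦ e ⟧ ℤ.+ k
    ; Σy≡ = trans (ZΣ.Σ-+ (λ i → g.y i ℤ.+ g′.y i) (⟦_⟧ ∘ κ)) (trans (cong₂ ℤ._+_ (ZΣ.Σ-+ g.y g′.y) Σκ) (total g.m g′.m g.t g′.t k g.Σy≡ g′.Σy≡)) }
    where
    module g = Glue (leech⇒glue z∈Λ)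
    module g′ = Glue (leech⇒glue z′∈Λ)
    e : Bool
    e = g.m ∧ g′.m
    κ : Fin n → Bool
    κ i = (e ∧ (g.c i xor g′.c i)) xor (g.c i ∧ g′.c i)
    XOR-κ : XOR κ ≡ false
    XOR-κ = trans (BΣ.Σ-+ (λ i → e ∧ (g.c i xor g′.c i)) (λ i → g.c i ∧ g′.c i))
      (cong₂ _xor_ (trans (BΣ.Σ-*ˡ e (λ i → g.c i xor g′.c i)) (trans (cong (e ∧_) (C-even (C-xor g.c∈C g′.c∈C))) (Bool.∧-zeroʳ e)))
        (C-dot g.c∈C g′.c∈C))
    k : ℤ
    k = proj₁ (Σ⟦⟧-even κ)
    Σκ : Σℤ (⟦_⟧ ∘ κ) ≡ + 2 ℤ.* k
    Σκ = trans (proj₂ (Σ⟦⟧-even κ)) (trans (cong (λ b → ⟦ b ⟧ ℤ.+ + 2 ℤ.* k) XOR-κ) (ℤ.+-identityˡ _))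
    carry : ∀ m m′ c c′ → ⟦ m ⟧ ℤ.+ ⟦ m′ ⟧ ℤ.+ + 2 ℤ.* (⟦ c ⟧ ℤ.+ ⟦ c′ ⟧) ≡
      ⟦ m xor m′ ⟧ ℤ.+ + 2 ℤ.* ⟦ (m ∧ m′) xor (c xor c′) ⟧ ℤ.+ + 4 ℤ.* ⟦ ((m ∧ m′) ∧ (c xor c′)) xor (c ∧ c′) ⟧
    carry true  true  true  true  = refl
    carry true  true  true  false = refl
    carry true  true  false true  = refl
    carry true  true  false false = refl
    carry true  false true  true  = refl
    carry true  false true  false = refl
    carry true  false false true  = refl
    carry true  false false false = refl
    carry false true  true  true  = refl
    carry false true  true  false = refl
    carry false true  false true  = refl
    carry false true  false false = refl
    carry false false true  true  = refl
    carry false false true  false = refl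
    carry false false false true  = refl
    carry false false false false = refl
    digits : ∀ c y c′ y′ → (⟦ g.m ⟧ ℤ.+ + 2 ℤ.* ⟦ c ⟧ ℤ.+ + 4 ℤ.* y) ℤ.+ (⟦ g′.m ⟧ ℤ.+ + 2 ℤ.* ⟦ c′ ⟧ ℤ.+ + 4 ℤ.* y′) ≡
      ⟦ g.m xor g′.m ⟧ ℤ.+ + 2 ℤ.* ⟦ e xor (c xor c′) ⟧ ℤ.+ + 4 ℤ.* ((y ℤ.+ y′) ℤ.+ ⟦ (e ∧ (c xor c′)) xor (c ∧ c′) ⟧)
    digits c y c′ y′ = trans (gather ⟦ g.m ⟧ ⟦ c ⟧ y ⟦ g′.m ⟧ ⟦ c′ ⟧ y′)
      (trans (cong (λ x → x ℤ.+ + 4 ℤ.* (y ℤ.+ y′)) (carry g.m g′.m c c′)) (spread ⟦ g.m xor g′.m ⟧ ⟦ e xor (c xor c′) ⟧ ⟦ (e ∧ (c xor c′)) xor (c ∧ c′) ⟧ (y ℤ.+ y′)))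
      where
      gather : ∀ m c y m′ c′ y′ → (m ℤ.+ + 2 ℤ.* c ℤ.+ + 4 ℤ.* y) ℤ.+ (m′ ℤ.+ + 2 ℤ.* c′ ℤ.+ + 4 ℤ.* y′) ≡
        (m ℤ.+ m′ ℤ.+ + 2 ℤ.* (c ℤ.+ c′)) ℤ.+ + 4 ℤ.* (y ℤ.+ y′)
      gather = solve-∀
      spread : ∀ m c κ y → (m ℤ.+ + 2 ℤ.* c ℤ.+ + 4 ℤ.* κ) ℤ.+ + 4 ℤ.* y ≡ m ℤ.+ + 2 ℤ.* c ℤ.+ + 4 ℤ.* (y ℤ.+ κ)
      spread = solve-∀
    total : ∀ m m′ t t′ k {Y Y′} → Y ≡ ⟦ m ⟧ ℤ.+ + 2 ℤ.* t → Y′ ≡ ⟦ m′ ⟧ ℤ.+ + 2 ℤ.* t′ →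
      Y ℤ.+ Y′ ℤ.+ + 2 ℤ.* k ≡ ⟦ m xor m′ ⟧ ℤ.+ + 2 ℤ.* (t ℤ.+ t′ ℤ.+ ⟦ m ∧ m′ ⟧ ℤ.+ k)
    total m m′ t t′ k refl refl = trans (gather ⟦ m ⟧ ⟦ m′ ⟧ t t′ k)
      (trans (cong (λ x → x ℤ.+ + 2 ℤ.* (t ℤ.+ t′ ℤ.+ k)) (half m m′)) (spread ⟦ m xor m′ ⟧ ⟦ m ∧ m′ ⟧ t t′ k))
      where
      half : ∀ m m′ → ⟦ m ⟧ ℤ.+ ⟦ m′ ⟧ ≡ ⟦ m xor m′ ⟧ ℤ.+ + 2 ℤ.* ⟦ m ∧ m′ ⟧
      half true  true  = refl
      half true  false = refl
      half false true  = refl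
      half false false = refl
      gather : ∀ m m′ t t′ k → (m ℤ.+ + 2 ℤ.* t) ℤ.+ (m′ ℤ.+ + 2 ℤ.* t′) ℤ.+ + 2 ℤ.* k ≡ (m ℤ.+ m′) ℤ.+ + 2 ℤ.* (t ℤ.+ t′ ℤ.+ k)
      gather = solve-∀
      spread : ∀ m e t t′ k → (m ℤ.+ + 2 ℤ.* e) ℤ.+ + 2 ℤ.* (t ℤ.+ t′ ℤ.+ k) ≡ m ℤ.+ + 2 ℤ.* (t ℤ.+ t′ ℤ.+ e ℤ.+ k)
      spread = solve-∀

  leech-cong : ∀ {z z′} → (∀ i → z i ≡ z′ i) → InLeech z → InLeech z′
  leech-cong e z∈Λ = glue⇒leech record
    { m = g.m ; c = g.c ; c∈C = g.c∈C ; y = g.y ; z≡ = λ i → trans (sym (e i)) (g.z≡ i) ; t = g.t ; Σy≡ = g.Σy≡ }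
    where
    module g = Glue (leech⇒glue z∈Λ)

  leech-ℕ* : ∀ {z} k → InLeech z → InLeech (λ i → + k ℤ.* z i)
  leech-ℕ* {z} zero    z∈Λ = leech-8 (λ _ → + 0)
  leech-ℕ* {z} (suc k) z∈Λ = leech-cong (λ i → sym (ℤ.suc-* (+ k) (z i))) (leech-+ z∈Λ (leech-ℕ* k z∈Λ))

  -- Negation is reduced to addition by -k = 7k + 8(-k), since every multiple of 8 in ℤ²⁴ is a Leech
  -- vector.
  leech-* : ∀ {z} k → InLeech z → InLeech (λ i → k ℤ.* z i)
  leech-* {z} (+ k)     z∈Λ = leech-ℕ* k z∈Λ
  leech-* {z} -[1+ k ]  z∈Λ = leech-cong (λ i → sym (lemma (+ suc k) (z i)))
    (leech-+ (leech-ℕ* 7 (leech-ℕ* (suc k) z∈Λ)) (leech-8 (λ i → -[1+ k ] ℤ.* z i)))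
    where
    lemma : ∀ k z → ℤ.- k ℤ.* z ≡ + 7 ℤ.* (k ℤ.* z) ℤ.+ + 8 ℤ.* (ℤ.- k ℤ.* z)
    lemma = solve-∀

  leech-Σ : ∀ {d} (c : Fin d → ℤ) {f : Fin d → Fin n → ℤ} → (∀ j → InLeech (f j)) → InLeech (λ i → Σℤ (λ j → c j ℤ.* f j i))
  leech-Σ {zero}  c f∈Λ = leech-8 (λ _ → + 0)
  leech-Σ {suc d} c f∈Λ = leech-+ (leech-* (c Fin.zero) (f∈Λ Fin.zero)) (leech-Σ (c ∘ Fin.suc) (f∈Λ ∘ Fin.suc))

  leech-permute : ∀ {z} (π : Permutation′ n) → (∀ {w} → C w → C (λ i → w (π ⟨$⟩ʳ i))) → InLeech z → InLeech (λ i → z (π ⟨$⟩ʳ i))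
  leech-permute {z} π π∈Aut (m , m≤1 , parity , sets , sum) =
    m , m≤1 , (λ i → parity (π ⟨$⟩ʳ i)) , (λ ν ν<4 → π∈Aut (sets ν ν<4)) , trans (cong (λ x → x ℤ.% + 8) (ZΣ.Σ-permute z π)) sum

  -- Odd vectors have norm Σz² ≡ 0 mod 16 and every coordinate contributes at least 1; even vectors with
  -- c ≠ 0 have at least eight coordinates ≡ 2 mod 4; and in 4y the sum Σy² is even.
  leech-min : ∀ {z} → InLeech z → ¬ (∀ i → z i ≡ + 0) → + 32 ℤ.≤ Σℤ (λ i → z i ℤ.* z i)
  leech-min {z} z∈Λ z≢0 = cases (leech⇒glue z∈Λ)
    where
    open ≡-Reasoning
    cases : Glue z → + 32 ℤ.≤ Σℤ (λ i → z i ℤ.* z i)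
    cases record { m = true ; c = c ; c∈C = c∈C ; y = y ; z≡ = z≡ ; t = t ; Σy≡ = Σy≡ } =
      subst (+ 32 ℤ.≤_) (sym Σz²) (ℤ.*-monoˡ-≤-nonNeg (+ 16) (two≤ u 24≤16u))
      where
      a R u : ℤ
      a = proj₁ (C-wt4 c∈C)
      r : Fin n → ℤ
      r i = y i ℤ.* y i ℤ.+ ⟦ c i ⟧ ℤ.* y i
      R = Σℤ r
      u = + 2 ℤ.+ + 2 ℤ.* a ℤ.+ t ℤ.+ R
      square : ∀ c y → (+ 1 ℤ.+ + 2 ℤ.* ⟦ c ⟧ ℤ.+ + 4 ℤ.* y) ℤ.* (+ 1 ℤ.+ + 2 ℤ.* ⟦ c ⟧ ℤ.+ + 4 ℤ.* y) ≡
        + 1 ℤ.+ + 2 ℤ.* (+ 4 ℤ.* ⟦ c ⟧ ℤ.+ + 4 ℤ.* y) ℤ.+ + 4 ℤ.* (+ 4 ℤ.* (y ℤ.* y ℤ.+ ⟦ c ⟧ ℤ.* y))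
      square true  = lemma where
        lemma : ∀ y → (+ 3 ℤ.+ + 4 ℤ.* y) ℤ.* (+ 3 ℤ.+ + 4 ℤ.* y) ≡
          + 1 ℤ.+ + 2 ℤ.* (+ 4 ℤ.* + 1 ℤ.+ + 4 ℤ.* y) ℤ.+ + 4 ℤ.* (+ 4 ℤ.* (y ℤ.* y ℤ.+ + 1 ℤ.* y))
        lemma = solve-∀
      square false = lemma where
        lemma : ∀ y → (+ 1 ℤ.+ + 4 ℤ.* y) ℤ.* (+ 1 ℤ.+ + 4 ℤ.* y) ≡
          + 1 ℤ.+ + 2 ℤ.* (+ 4 ℤ.* + 0 ℤ.+ + 4 ℤ.* y) ℤ.+ + 4 ℤ.* (+ 4 ℤ.* (y ℤ.* y ℤ.+ + 0 ℤ.* y))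
        lemma = solve-∀
      collect : ∀ a t R {w Y} → w ≡ + 4 ℤ.* a → Y ≡ + 1 ℤ.+ + 2 ℤ.* t →
        + 24 ℤ.* + 1 ℤ.+ + 2 ℤ.* (+ 4 ℤ.* w ℤ.+ + 4 ℤ.* Y) ℤ.+ + 4 ℤ.* (+ 4 ℤ.* R) ≡ + 16 ℤ.* (+ 2 ℤ.+ + 2 ℤ.* a ℤ.+ t ℤ.+ R)
      collect a t R refl refl = lemma a t R where
        lemma : ∀ a t R → + 24 ℤ.* + 1 ℤ.+ + 2 ℤ.* (+ 4 ℤ.* (+ 4 ℤ.* a) ℤ.+ + 4 ℤ.* (+ 1 ℤ.+ + 2 ℤ.* t)) ℤ.+ + 4 ℤ.* (+ 4 ℤ.* R)
          ≡ + 16 ℤ.* (+ 2 ℤ.+ + 2 ℤ.* a ℤ.+ t ℤ.+ R)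
        lemma = solve-∀
      Σz² : Σℤ (λ i → z i ℤ.* z i) ≡ + 16 ℤ.* u
      Σz² = begin
        Σℤ (λ i → z i ℤ.* z i) ≡⟨ ZΣ.Σ-cong (λ i → trans (cong₂ ℤ._*_ (z≡ i) (z≡ i)) (square (c i) (y i))) ⟩
        Σℤ (λ i → + 1 ℤ.+ + 2 ℤ.* (+ 4 ℤ.* ⟦ c i ⟧ ℤ.+ + 4 ℤ.* y i) ℤ.+ + 4 ℤ.* (+ 4 ℤ.* r i))
          ≡⟨ Σ-glue (+ 1) (λ i → + 4 ℤ.* ⟦ c i ⟧ ℤ.+ + 4 ℤ.* y i) (λ i → + 4 ℤ.* r i) ⟩
        + 24 ℤ.* + 1 ℤ.+ + 2 ℤ.* Σℤ (λ i → + 4 ℤ.* ⟦ c i ⟧ ℤ.+ + 4 ℤ.* y i) ℤ.+ + 4 ℤ.* Σℤ (λ i → + 4 ℤ.* r i)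
          ≡⟨ cong₂ (λ p q → + 24 ℤ.* + 1 ℤ.+ + 2 ℤ.* p ℤ.+ + 4 ℤ.* q) (Σ-bilinear (+ 4) (+ 4) (⟦_⟧ ∘ c) y) (ZΣ.Σ-*ˡ (+ 4) r) ⟩
        + 24 ℤ.* + 1 ℤ.+ + 2 ℤ.* (+ 4 ℤ.* Σℤ (⟦_⟧ ∘ c) ℤ.+ + 4 ℤ.* Σℤ y) ℤ.+ + 4 ℤ.* (+ 4 ℤ.* R)
          ≡⟨ collect a t R (proj₂ (C-wt4 c∈C)) Σy≡ ⟩
        + 16 ℤ.* u ∎
      odd : ∀ i → z i ≢ + 0
      odd i z≡0 = odd≢0 (⟦ c i ⟧ ℤ.+ + 2 ℤ.* y i) (trans (lemma ⟦ c i ⟧ (y i)) (trans (sym (z≡ i)) z≡0))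
        where
        lemma : ∀ c y → + 1 ℤ.+ (c ℤ.+ + 2 ℤ.* y) ℤ.* + 2 ≡ + 1 ℤ.+ + 2 ℤ.* c ℤ.+ + 4 ℤ.* y
        lemma = solve-∀
      24≤16u : + 24 ℤ.≤ + 16 ℤ.* u
      24≤16u = subst₂ ℤ._≤_ (Σ-const (+ 1)) Σz² (Σℤ-mono {n} {λ _ → + 1} (λ i → square-pos (z i) (odd i)))
      two≤ : ∀ u → + 24 ℤ.≤ + 16 ℤ.* u → + 2 ℤ.≤ u
      two≤ (+ 0) (ℤ.+≤+ ())
      two≤ (+ 1) (ℤ.+≤+ p) = ⊥-elim (ℕ.<⇒≱ (ℕ.m≤m+n 17 7) p)
      two≤ (+ suc (suc k)) p = ℤ.+≤+ (ℕ.s≤s (ℕ.s≤s ℕ.z≤n))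
      two≤ -[1+ k ] ()
    cases record { m = false ; c = c ; c∈C = c∈C ; y = y ; z≡ = z≡ ; t = t ; Σy≡ = Σy≡ } with C-weight c∈C
    ... | inj₂ (8≤wt , _) = ℤ.≤-trans
          (subst (+ 32 ℤ.≤_) (sym (trans (ZΣ.Σ-*ˡ (+ 4) (⟦_⟧ ∘ c)) (cong (ℤ._*_ (+ 4)) (⟦wt⟧ c)))) (ℤ.*-monoˡ-≤-nonNeg (+ 4) (ℤ.+≤+ 8≤wt)))
          (Σℤ-mono (λ i → bound (c i) (y i) (z≡ i)))
      where
      bound : ∀ {z} c y → z ≡ + 0 ℤ.+ + 2 ℤ.* ⟦ c ⟧ ℤ.+ + 4 ℤ.* y → + 4 ℤ.* ⟦ c ⟧ ℤ.≤ z ℤ.* z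
      bound {z} false y _ = square-nonneg z
      bound true y refl = subst (+ 4 ℤ.≤_) (sym (lemma y))
        (ℤ.*-monoˡ-≤-nonNeg (+ 4) (square-pos (+ 1 ℤ.+ y ℤ.* + 2) (odd≢0 y)))
        where
        lemma : ∀ y → (+ 0 ℤ.+ + 2 ℤ.* + 1 ℤ.+ + 4 ℤ.* y) ℤ.* (+ 0 ℤ.+ + 2 ℤ.* + 1 ℤ.+ + 4 ℤ.* y) ≡ + 4 ℤ.* ((+ 1 ℤ.+ y ℤ.* + 2) ℤ.* (+ 1 ℤ.+ y ℤ.* + 2))
        lemma = solve-∀
    ... | inj₁ wt≡0′ = subst (+ 32 ℤ.≤_) (sym Σz²) (ℤ.*-monoˡ-≤-nonNeg (+ 16) (subst (+ 2 ℤ.≤_) (sym Σy²) (even-pos S (proj₁ S-even) (proj₂ S-even) S≢0)))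
      where
      S : ℕ
      S = Σℕ (λ i → ℤ.∣ y i ∣ * ℤ.∣ y i ∣)
      Σy² : Σℤ (λ i → y i ℤ.* y i) ≡ + S
      Σy² = trans (ZΣ.Σ-cong (λ i → square-abs (y i))) (Σℤ-pos (λ i → ℤ.∣ y i ∣ * ℤ.∣ y i ∣))
      z≡4y : ∀ i → z i ≡ + 4 ℤ.* y i
      z≡4y i = trans (z≡ i) (trans (cong (λ b → + 0 ℤ.+ + 2 ℤ.* ⟦ b ⟧ ℤ.+ + 4 ℤ.* y i) (wt≡0 c wt≡0′ i)) (ℤ.+-identityˡ (+ 4 ℤ.* y i)))
      Σz² : Σℤ (λ i → z i ℤ.* z i) ≡ + 16 ℤ.* Σℤ (λ i → y i ℤ.* y i)
      Σz² = trans (ZΣ.Σ-cong (λ i → trans (cong₂ ℤ._*_ (z≡4y i) (z≡4y i)) (lemma (y i)))) (ZΣ.Σ-*ˡ (+ 16) (λ i → y i ℤ.* y i))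
        where
        lemma : ∀ y → (+ 4 ℤ.* y) ℤ.* (+ 4 ℤ.* y) ≡ + 16 ℤ.* (y ℤ.* y)
        lemma = solve-∀
      S-even : ∃[ h ] + S ≡ + 2 ℤ.* h
      S-even = t ℤ.+ Σℤ half , (begin
        + S ≡⟨ Σy² ⟨
        Σℤ (λ i → y i ℤ.* y i) ≡⟨ ZΣ.Σ-cong (λ i → proj₂ (square≡self-mod2 (y i))) ⟩
        Σℤ (λ i → y i ℤ.+ + 2 ℤ.* half i) ≡⟨ ZΣ.Σ-+ y (λ i → + 2 ℤ.* half i) ⟩
        Σℤ y ℤ.+ Σℤ (λ i → + 2 ℤ.* half i) ≡⟨ cong₂ ℤ._+_ (trans Σy≡ (ℤ.+-identityˡ (+ 2 ℤ.* t))) (ZΣ.Σ-*ˡ (+ 2) half) ⟩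
        + 2 ℤ.* t ℤ.+ + 2 ℤ.* Σℤ half ≡⟨ ℤ.*-distribˡ-+ (+ 2) t (Σℤ half) ⟨
        + 2 ℤ.* (t ℤ.+ Σℤ half) ∎)
        where
        half : Fin n → ℤ
        half i = proj₁ (square≡self-mod2 (y i))
      S≢0 : S ≢ 0
      S≢0 S≡0 = z≢0 λ i → trans (z≡4y i) (cong (ℤ._*_ (+ 4)) (ℤ.∣i∣≡0⇒i≡0 (square-0 (Σℕ≡0 (λ i → ℤ.∣ y i ∣ * ℤ.∣ y i ∣) S≡0 i))))
        where
        square-0 : ∀ {k} → k * k ≡ 0 → k ≡ 0
        square-0 {zero} _ = refl
      even-pos : ∀ S h → + S ≡ + 2 ℤ.* h → S ≢ 0 → + 2 ℤ.≤ + S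
      even-pos 0 h e S≢0 = ⊥-elim (S≢0 refl)
      even-pos 1 h e _ = ⊥-elim (odd≢0 (ℤ.- h) (trans (cong (λ x → x ℤ.+ ℤ.- h ℤ.* + 2) e) (lemma h)))
        where
        lemma : ∀ h → + 2 ℤ.* h ℤ.+ ℤ.- h ℤ.* + 2 ≡ + 0
        lemma = solve-∀
      even-pos (suc (suc S)) _ _ _ = ℤ.+≤+ (ℕ.s≤s (ℕ.s≤s ℕ.z≤n))

module Leechℤ = LeechLattice refl InGolay Golay.code-cong Golay.code-xor Golay.code-const Golay.code-dot golay-weight

-- Integrality of rationals

-- Clearing denominators gives n · numerator = z · denominator, and the fraction is reduced.
denominator∣ : ∀ n q → IsInteger (ι (+ n) ℚ.* q) → ℚ.denominatorℕ q ∣ n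
denominator∣ n q@(ℚ.mkℚ num d c) (z , e) =
  Coprimality.coprime-divisor (Coprimality.sym (Coprimality.recompute c)) (divides ℤ.∣ z ∣ abs≡)
  where
  cleared : (+ n ℤ.* num) ℤ.* + 1 ≡ z ℤ.* + suc (d ℕ.+ 0)
  cleared with ℚᵘ.≃-trans (ℚᵘ.≃-sym (ℚᵘ.≃-trans (ℚ.toℚᵘ-homo-* (ι (+ n)) q) (ℚᵘ.*-cong (toℚᵘ-ι (+ n)) ℚᵘ.≃-refl)))
                  (ℚᵘ.≃-trans (ℚᵘ.≃-reflexive (cong ℚ.toℚᵘ e)) (toℚᵘ-ι z))
  ... | ℚᵘ.*≡* e′ = e′
  abs≡ : ℤ.∣ num ∣ * n ≡ ℤ.∣ z ∣ * suc d
  abs≡ = trans (ℕ.*-comm ℤ.∣ num ∣ n) (trans (sym (ℤ.abs-* (+ n) num)) (trans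
    (cong ℤ.∣_∣ (trans (sym (ℤ.*-identityʳ (+ n ℤ.* num))) (trans cleared (cong (λ k → z ℤ.* + suc k) (ℕ.+-identityʳ d)))))
    (ℤ.abs-* z (+ suc d))))

clear-denominator : ∀ n q → ℚ.denominatorℕ q ∣ n → IsInteger (ι (+ n) ℚ.* q)
clear-denominator n q@(ℚ.mkℚ num d c) (divides k refl) = + k ℤ.* num , ℚ.toℚᵘ-injective
  (ℚᵘ.≃-trans (ℚ.toℚᵘ-homo-* (ι (+ (k * suc d))) q) (ℚᵘ.≃-trans (ℚᵘ.*-cong (toℚᵘ-ι (+ (k * suc d))) ℚᵘ.≃-refl)
  (ℚᵘ.≃-trans (ℚᵘ.*≡* (trans (ℤ.*-identityʳ _) (trans (cong (λ x → x ℤ.* num) (ℤ.pos-* k (suc d)))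
    (trans (lemma (+ k) (+ suc d) num) (cong (λ x → (+ k ℤ.* num) ℤ.* + suc x) (sym (ℕ.+-identityʳ d)))))))
  (ℚᵘ.≃-sym (toℚᵘ-ι (+ k ℤ.* num))))))
  where
  lemma : ∀ k d n → (k ℤ.* d) ℤ.* n ≡ (k ℤ.* n) ℤ.* d
  lemma = solve-∀

integer-ι : ∀ z → IsInteger (ι z)
integer-ι z = z , refl

integer-+ : ∀ {p q} → IsInteger p → IsInteger q → IsInteger (p ℚ.+ q)
integer-+ (a , refl) (b , refl) = a ℤ.+ b , sym (ι-+ a b)

integer-* : ∀ {p q} → IsInteger p → IsInteger q → IsInteger (p ℚ.* q)
integer-* (a , refl) (b , refl) = a ℤ.* b , sym (ι-* a b)

integer-Σ : ∀ {n} {f : Fin n → ℚ} → (∀ i → IsInteger (f i)) → IsInteger (Σℚ f)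
integer-Σ {zero}  int = + 0 , refl
integer-Σ {suc n} int = integer-+ (int Fin.zero) (integer-Σ (int ∘ Fin.suc))

denominator∣1 : ∀ {q} → ℚ.denominatorℕ q ∣ 1 → IsInteger q
denominator∣1 {q} d∣1 = subst IsInteger (ℚ.*-identityˡ q) (clear-denominator 1 q d∣1)

primeDivisor : ∀ n .{{_ : NonZero n}} → n ≢ 1 → ∃[ p ] (Prime p × p ∣ n)
primeDivisor n n≢1 with factorise n
... | record { factors = List.[] ; isFactorisation = e } = ⊥-elim (n≢1 e)
... | record { factors = p List.∷ ps ; isFactorisation = e ; factorsPrime = pr All.∷ _ } =
  p , pr , subst (p ∣_) (sym e) (∣.m∣m*n _)

locally-integer : ∀ q → (∀ p → Prime p → q ∈ℤ[ p ]) → IsInteger q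
locally-integer q@(ℚ.mkℚ _ d _) local with suc d ℕ.≟ 1
... | yes d≡1 = denominator∣1 (∣.∣-reflexive d≡1)
... | no  d≢1 with primeDivisor (suc d) d≢1
...   | p , pr , p∣d = ⊥-elim (local p pr p∣d)

-- A prime dividing both the denominator and k does not divide m, so the local condition excludes
-- it. Hence the denominator is coprime to k, and as it divides mk it divides m. Applied to the
-- coordinates of a vector in the Π(m)-dual.
m-part : ∀ m k q .{{_ : NonZero m}} → gcd m k ≡ 1 → IsInteger (ι (+ (m * k)) ℚ.* q) →
         (∀ p → Prime p → ¬ (p ∣ m) → q ∈ℤ[ p ]) → IsInteger (ι (+ m) ℚ.* q)
m-part m k q@(ℚ.mkℚ _ d-1 _) coprime int local = clear-denominator m q
  (Coprimality.coprime-divisor d⊥k (subst (suc d-1 ∣_) (ℕ.*-comm m k) (denominator∣ (m * k) q int)))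
  where
  d⊥k : Coprime (suc d-1) k
  d⊥k = Coprimality.gcd≡1⇒coprime g≡1
    where
    g = gcd (suc d-1) k
    instance
      g≢0 : NonZero g
      g≢0 = ℕ.≢-nonZero (λ g≡0 → case gcd[m,n]≡0⇒m≡0 {suc d-1} {k} g≡0 of λ ())
    g≡1 : g ≡ 1
    g≡1 with g ℕ.≟ 1
    ... | yes g≡1 = g≡1
    ... | no  g≢1 with primeDivisor g g≢1
    ...   | p , pr , p∣g = ⊥-elim (local p pr (λ p∣m → ¬prime[1] (subst Prime (∣.∣1⇒≡1 (subst (p ∣_) coprime
              (gcd-greatest p∣m (∣.∣-trans p∣g (gcd[m,n]∣n (suc d-1) k))))) pr))
              (∣.∣-trans p∣g (gcd[m,n]∣m (suc d-1) k)))

coprime-integer : ∀ m k q → gcd m k ≡ 1 → IsInteger (ι (+ m) ℚ.* q) → IsInteger (ι (+ k) ℚ.* q) → IsInteger q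
coprime-integer m k q coprime int int′ =
  denominator∣1 (subst (ℚ.denominatorℕ q ∣_) coprime (gcd-greatest (denominator∣ m q int) (denominator∣ k q int′)))

integer-local : ∀ {q} p → Prime p → IsInteger q → q ∈ℤ[ p ]
integer-local {q} p pr int p∣d = ¬prime[1] (subst Prime (∣.∣1⇒≡1 (∣.∣-trans p∣d
  (denominator∣ 1 q (subst IsInteger (sym (ℚ.*-identityˡ q)) int)))) pr)

reciprocal : ∀ n → + 1 / suc n ℚ.* ι (+ suc n) ≡ ℚ.1ℚ
reciprocal n = ℚ.toℚᵘ-injective (ℚᵘ.≃-trans (ℚ.toℚᵘ-homo-* (+ 1 / suc n) (ι (+ suc n)))
  (ℚᵘ.≃-trans (ℚᵘ.*-cong (ℚ.toℚᵘ-fromℚᵘ (ℚᵘ.mkℚᵘ (+ 1) n)) (toℚᵘ-ι (+ suc n)))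
  (ℚᵘ.*≡* (lemma (+ suc n)))))
  where
  lemma : ∀ k → (+ 1 ℤ.* k) ℤ.* + 1 ≡ + 1 ℤ.* (k ℤ.* + 1)
  lemma = solve-∀

cancel-inverse : ∀ r s q → r ℚ.* s ≡ ℚ.1ℚ → r ℚ.* (s ℚ.* q) ≡ q
cancel-inverse r s q e = trans (sym (ℚ.*-assoc r s q)) (trans (cong (ℚ._* q) e) (ℚ.*-identityˡ q))

cancel-reciprocal : ∀ n q → + 1 / suc n ℚ.* (ι (+ suc n) ℚ.* q) ≡ q
cancel-reciprocal n q = cancel-inverse (+ 1 / suc n) (ι (+ suc n)) q (reciprocal n)

cancel-reciprocal′ : ∀ n q → ι (+ suc n) ℚ.* (+ 1 / suc n ℚ.* q) ≡ q
cancel-reciprocal′ n q = cancel-inverse (ι (+ suc n)) (+ 1 / suc n) q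
  (trans (ℚ.*-comm (ι (+ suc n)) (+ 1 / suc n)) (reciprocal n))


-- Integer matrices acting on rational vectors

Mat : ℕ → ℕ → Set
Mat m n = Fin m → Fin n → ℤ

infixl 7 _✶_
_✶_ : ∀ {l m n} → Mat l m → Mat m n → Mat l n
(A ✶ B) i j = Σℤ (λ k → A i k ℤ.* B k j)

_ᵗ : ∀ {m n} → Mat m n → Mat n m
(A ᵗ) i j = A j i

scalar : ∀ {n} → ℤ → Mat n n
scalar s i j = s ℤ.* ZΣ.indicator i j

act : ∀ {m n} → Mat m n → (Fin n → ℚ) → Fin m → ℚ
act M c i = Σℚ (λ j → ι (M i j) ℚ.* c j)

pair : ∀ {n} → (Fin n → ℚ) → (Fin n → ℚ) → ℚ
pair c d = Σℚ (λ i → c i ℚ.* d i)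

act-cong : ∀ {m n} (M : Mat m n) {c d} → (∀ j → c j ≡ d j) → ∀ i → act M c i ≡ act M d i
act-cong M e i = QΣ.Σ-cong (λ j → cong (ι (M i j) ℚ.*_) (e j))

act-≡ : ∀ {m n} {M M′ : Mat m n} c → (∀ i j → M i j ≡ M′ i j) → ∀ i → act M c i ≡ act M′ c i
act-≡ c e i = QΣ.Σ-cong (λ j → cong (λ x → ι x ℚ.* c j) (e i j))

act-integer : ∀ {m n} (M : Mat m n) {c} → (∀ j → IsInteger (c j)) → ∀ i → IsInteger (act M c i)
act-integer M int i = integer-Σ (λ j → integer-* (integer-ι (M i j)) (int j))

act-✶ : ∀ {l m n} (A : Mat l m) (B : Mat m n) c i → act A (act B c) i ≡ act (A ✶ B) c i
act-✶ A B c i = trans (QΣ.Σ-assoc (λ k → ι (A i k)) (λ k j → ι (B k j)) c)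
  (QΣ.Σ-cong (λ j → cong (ℚ._* c j) (sym (trans (ι-Σ (λ k → A i k ℤ.* B k j)) (QΣ.Σ-cong (λ k → ι-* (A i k) (B k j)))))))

act-*ʳ : ∀ {m n} (M : Mat m n) q c i → act M (λ j → q ℚ.* c j) i ≡ q ℚ.* act M c i
act-*ʳ M q c i = trans (QΣ.Σ-cong (λ j → *-leftComm (ι (M i j)) q (c j))) (QΣ.Σ-*ˡ q (λ j → ι (M i j) ℚ.* c j))

act-+ : ∀ {m n} (M : Mat m n) c d i → act M (λ j → c j ℚ.+ d j) i ≡ act M c i ℚ.+ act M d i
act-+ M c d i = trans (QΣ.Σ-cong (λ j → ℚ.*-distribˡ-+ (ι (M i j)) (c j) (d j)))
  (QΣ.Σ-+ (λ j → ι (M i j) ℚ.* c j) (λ j → ι (M i j) ℚ.* d j))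

act-*ˡ : ∀ {m n} s (M : Mat m n) c i → act (λ i j → s ℤ.* M i j) c i ≡ ι s ℚ.* act M c i
act-*ˡ s M c i = trans (QΣ.Σ-cong (λ j → trans (cong (ℚ._* c j) (ι-* s (M i j))) (ℚ.*-assoc (ι s) (ι (M i j)) (c j))))
  (QΣ.Σ-*ˡ (ι s) (λ j → ι (M i j) ℚ.* c j))

ι-indicator : ∀ {n} (i j : Fin n) → ι (ZΣ.indicator i j) ≡ QΣ.indicator i j
ι-indicator i j with i Fin.≟ j
... | yes _ = refl
... | no  _ = refl

act-scalar : ∀ {n} s (c : Fin n → ℚ) i → act (scalar s) c i ≡ ι s ℚ.* c i
act-scalar s c i = trans (act-*ˡ s ZΣ.indicator c i) (cong (ι s ℚ.*_)
  (trans (QΣ.Σ-cong (λ j → cong (ℚ._* c j) (ι-indicator i j))) (QΣ.Σ-indicator i c)))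

pair-act : ∀ {m n} (M : Mat m n) c d → pair (act M c) d ≡ pair c (act (M ᵗ) d)
pair-act M c d = begin
  Σℚ (λ i → act M c i ℚ.* d i)
    ≡⟨ QΣ.Σ-cong (λ i → trans (ℚ.*-comm _ (d i)) (cong (d i ℚ.*_) (QΣ.Σ-cong (λ j → ℚ.*-comm (ι (M i j)) (c j))))) ⟩
  Σℚ (λ i → d i ℚ.* Σℚ (λ j → c j ℚ.* ι (M i j))) ≡⟨ QΣ.Σ-adjoint d c (λ j i → ι (M i j)) ⟩
  Σℚ (λ j → c j ℚ.* Σℚ (λ i → d i ℚ.* ι (M i j)))
    ≡⟨ QΣ.Σ-cong (λ j → cong (c j ℚ.*_) (QΣ.Σ-cong (λ i → ℚ.*-comm (d i) (ι (M i j))))) ⟩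
  pair c (act (M ᵗ) d) ∎
  where open ≡-Reasoning

pair-cong : ∀ {n} {c c′ d d′ : Fin n → ℚ} → (∀ i → c i ≡ c′ i) → (∀ i → d i ≡ d′ i) → pair c d ≡ pair c′ d′
pair-cong e e′ = QΣ.Σ-cong (λ i → cong₂ ℚ._*_ (e i) (e′ i))

pair-congʳ : ∀ {n} (c : Fin n → ℚ) {d d′} → (∀ i → d i ≡ d′ i) → pair c d ≡ pair c d′
pair-congʳ c e = QΣ.Σ-cong (λ i → cong (c i ℚ.*_) (e i))

pair-*ˡ : ∀ {n} q (c d : Fin n → ℚ) → pair (λ i → q ℚ.* c i) d ≡ q ℚ.* pair c d
pair-*ˡ q c d = trans (QΣ.Σ-cong (λ i → ℚ.*-assoc q (c i) (d i))) (QΣ.Σ-*ˡ q (λ i → c i ℚ.* d i))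

pair-*ʳ : ∀ {n} q (c d : Fin n → ℚ) → pair c (λ i → q ℚ.* d i) ≡ q ℚ.* pair c d
pair-*ʳ q c d = trans (QΣ.Σ-cong (λ i → *-leftComm (c i) q (d i))) (QΣ.Σ-*ˡ q (λ i → c i ℚ.* d i))

pair-+ˡ : ∀ {n} (c c′ d : Fin n → ℚ) → pair (λ i → c i ℚ.+ c′ i) d ≡ pair c d ℚ.+ pair c′ d
pair-+ˡ c c′ d = trans (QΣ.Σ-cong (λ i → ℚ.*-distribʳ-+ (d i) (c i) (c′ i))) (QΣ.Σ-+ (λ i → c i ℚ.* d i) (λ i → c′ i ℚ.* d i))

pair-comm : ∀ {n} (c d : Fin n → ℚ) → pair c d ≡ pair d c
pair-comm c d = QΣ.Σ-cong (λ i → ℚ.*-comm (c i) (d i))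

pair-Σ : ∀ {m n} (c : Fin m → ℚ) (b : Fin m → Fin n → ℚ) y →
         pair (λ i → Σℚ (λ j → c j ℚ.* b j i)) y ≡ pair c (λ j → pair (b j) y)
pair-Σ c b y = trans (pair-comm _ y) (trans (QΣ.Σ-adjoint y c b) (QΣ.Σ-cong (λ j → cong (c j ℚ.*_) (pair-comm y (b j)))))

-- The form on Vec24

eighth : ℚ
eighth = + 1 / 8

·-comm : ∀ x y → x · y ≡ y · x
·-comm x y = cong (ℚ._* eighth) (pair-comm x y)

·-cong : ∀ {x x′ y y′} → x ≈ x′ → y ≈ y′ → x · y ≡ x′ · y′
·-cong {x} {x′} {y} {y′} e e′ = cong (ℚ._* eighth) (pair-cong {24} {x} {x′} {y} {y′} e e′)

·-+ˡ : ∀ x x′ y → (x +ᵥ x′) · y ≡ x · y ℚ.+ x′ · y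
·-+ˡ x x′ y = trans (cong (ℚ._* eighth) (pair-+ˡ x x′ y)) (ℚ.*-distribʳ-+ eighth (pair x y) (pair x′ y))

·-•ˡ : ∀ q x y → (q • x) · y ≡ q ℚ.* (x · y)
·-•ˡ q x y = trans (cong (ℚ._* eighth) (pair-*ˡ q x y)) (ℚ.*-assoc q (pair x y) eighth)

·-linComb : ∀ {n} (c : Fin n → ℚ) (b : Fin n → Vec24) y → linComb c b · y ≡ pair c (λ j → b j · y)
·-linComb c b y = trans (cong (ℚ._* eighth) (pair-Σ c b y)) (trans
  (sym (QΣ.Σ-*ʳ eighth (λ j → c j ℚ.* pair (b j) y))) (QΣ.Σ-cong (λ j → ℚ.*-assoc (c j) (pair (b j) y) eighth)))

linComb-cong : ∀ {n} {c c′ : Fin n → ℚ} (b : Fin n → Vec24) → (∀ j → c j ≡ c′ j) → linComb c b ≈ linComb c′ b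
linComb-cong b e i = QΣ.Σ-cong (λ j → cong (ℚ._* b j i) (e j))

linComb-• : ∀ {n} q (c : Fin n → ℚ) b → linComb (λ j → q ℚ.* c j) b ≈ (q • linComb c b)
linComb-• q c b i = pair-*ˡ q c (λ j → b j i)

linComb-+ : ∀ {n} (c c′ : Fin n → ℚ) b → linComb (λ j → c j ℚ.+ c′ j) b ≈ (linComb c b +ᵥ linComb c′ b)
linComb-+ c c′ b i = pair-+ˡ c c′ (λ j → b j i)

-- Lattices presented by a basis and a Gram matrix

record Basis (Λ : Lattice) (D : ℕ) (G : Mat D D) : Set where
  field
    F     : Fin D → Vec24
    gram  : ∀ i j → F i · F j ≡ ι (G i j)
    span⇒ : ∀ {x} → Λ x → Σ (Fin D → ℤ) λ z → x ≈ linComb (ι ∘ z) F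
    span⇐ : ∀ {x} (z : Fin D → ℤ) → x ≈ linComb (ι ∘ z) F → Λ x

-- A is the matrix of a similarity σ of norm factor m on coordinates and U that of m σ⁻¹; with N = m k and
-- H = N G⁻¹, the divisibility conditions say that σ maps the Π(m)-dual onto the lattice.
record Similar {D} (G H : Mat D D) (m : ℕ) : Set where
  field
    A U X V : Mat D D
    AU : ∀ i j → (A ✶ U) i j ≡ scalar (+ m) i j
    UA : ∀ i j → (U ✶ A) i j ≡ scalar (+ m) i j
    AG : ∀ i j → (A ᵗ ✶ G) i j ≡ (G ✶ U) i j
    AH : ∀ i j → (A ✶ H) i j ≡ + m ℤ.* X i j
    GU : ∀ i j → (G ✶ U) i j ≡ + m ℤ.* V i j

module Presented {Λ D} {G : Mat D D} (basis : Basis Λ D G) (n : ℕ) (H : Mat D D)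
  (HG : ∀ i j → (H ✶ G) i j ≡ scalar (+ suc n) i j) where

  open Basis basis

  private
    N : ℕ
    N = suc n
    r : ℚ
    r = + 1 / suc n

  inner : Vec24 → Fin D → ℚ
  inner x j = x · F j

  -- G⁻¹ applied to the inner products with the basis. This is linear on the whole ambient space,
  -- giving the coordinates of the orthogonal projection onto the span, so σ can be defined without
  -- choosing coordinates for each vector.
  coord : Vec24 → Fin D → ℚ
  coord x i = r ℚ.* act H (inner x) i

  combine : (Fin D → ℚ) → Vec24
  combine c = linComb c F

  inner-cong : ∀ {x y} → x ≈ y → ∀ j → inner x j ≡ inner y j
  inner-cong {x} {y} e j = ·-cong {x} {y} {F j} {F j} e (λ i → refl)

  coord-cong : ∀ {x y} → x ≈ y → ∀ j → coord x j ≡ coord y j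
  coord-cong e j = cong (r ℚ.*_) (act-cong H (inner-cong e) j)

  inner-combine : ∀ c j → inner (combine c) j ≡ act G c j
  inner-combine c j = trans (·-linComb c F (F j)) (QΣ.Σ-cong (λ i → trans (ℚ.*-comm (c i) (F i · F j))
    (cong (ℚ._* c i) (trans (·-comm (F i) (F j)) (gram j i)))))

  coord-combine : ∀ c j → coord (combine c) j ≡ c j
  coord-combine c j = begin
    r ℚ.* act H (inner (combine c)) j ≡⟨ cong (r ℚ.*_) (act-cong H (inner-combine c) j) ⟩
    r ℚ.* act H (act G c) j           ≡⟨ cong (r ℚ.*_) (trans (act-✶ H G c j) (trans (act-≡ c HG j) (act-scalar (+ N) c j))) ⟩
    r ℚ.* (ι (+ N) ℚ.* c j)           ≡⟨ cancel-reciprocal n (c j) ⟩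
    c j                               ∎
    where open ≡-Reasoning

  coord-+ : ∀ x y j → coord (x +ᵥ y) j ≡ coord x j ℚ.+ coord y j
  coord-+ x y j = trans (cong (r ℚ.*_) (trans (act-cong H (λ k → ·-+ˡ x y (F k)) j) (act-+ H (inner x) (inner y) j)))
    (ℚ.*-distribˡ-+ r (act H (inner x) j) (act H (inner y) j))

  coord-• : ∀ q x j → coord (q • x) j ≡ q ℚ.* coord x j
  coord-• q x j = trans (cong (r ℚ.*_) (trans (act-cong H (λ k → ·-•ˡ q x (F k)) j) (act-*ʳ H q (inner x) j)))
    (*-leftComm r q (act H (inner x) j))

  N-coord : ∀ x j → ι (+ N) ℚ.* coord x j ≡ act H (inner x) j
  N-coord x j = cancel-reciprocal′ n (act H (inner x) j)

  ΛQ⇒combine : ∀ {x} → ΛQ Λ x → x ≈ combine (coord x)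
  ΛQ⇒combine {x} (k , kx∈Λ) = λ i → trans (x≈ i) (linComb-cong F (λ j → sym (trans (coord-cong x≈ j) (coord-combine c j))) i)
    where
    z : Fin D → ℤ
    z = proj₁ (span⇒ kx∈Λ)
    c : Fin D → ℚ
    c j = + 1 / suc k ℚ.* ι (z j)
    x≈ : x ≈ combine c
    x≈ i = trans (sym (cancel-reciprocal k (x i))) (trans (cong (+ 1 / suc k ℚ.*_) (proj₂ (span⇒ kx∈Λ) i))
      (sym (linComb-• (+ 1 / suc k) (ι ∘ z) F i)))

  integer⇒Λ : ∀ {x} c → x ≈ combine c → (∀ j → IsInteger (c j)) → Λ x
  integer⇒Λ c x≈ int = span⇐ (λ j → proj₁ (int j)) (λ i → trans (x≈ i) (linComb-cong F (λ j → proj₂ (int j)) i))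

  combine∈ΛQ : ∀ {x} k c → x ≈ combine c → (∀ j → IsInteger (ι (+ suc k) ℚ.* c j)) → ΛQ Λ x
  combine∈ΛQ k c x≈ int = k , integer⇒Λ (λ j → ι (+ suc k) ℚ.* c j)
    (λ i → trans (cong (ι (+ suc k) ℚ.*_) (x≈ i)) (sym (linComb-• (ι (+ suc k)) c F i))) int

  Λ⇒combine : ∀ {x} → Λ x → x ≈ combine (coord x)
  Λ⇒combine {x} x∈Λ i = trans (proj₂ (span⇒ x∈Λ) i)
    (linComb-cong F (λ j → sym (trans (coord-cong (proj₂ (span⇒ x∈Λ)) j) (coord-combine (ι ∘ proj₁ (span⇒ x∈Λ)) j))) i)

  coord-integer : ∀ {x} → Λ x → ∀ j → IsInteger (coord x j)
  coord-integer x∈Λ j = proj₁ (span⇒ x∈Λ) j , trans (coord-cong (proj₂ (span⇒ x∈Λ)) j) (coord-combine (ι ∘ proj₁ (span⇒ x∈Λ)) j)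

  Λ⇒ΛQ : ∀ {x} → Λ x → ΛQ Λ x
  Λ⇒ΛQ {x} x∈Λ = combine∈ΛQ 0 (coord x) (Λ⇒combine x∈Λ)
    (λ j → subst IsInteger (sym (ℚ.*-identityˡ (coord x j))) (coord-integer x∈Λ j))

  F∈Λ : ∀ j → Λ (F j)
  F∈Λ j = span⇐ (ZΣ.indicator j) (λ i → sym (trans
    (QΣ.Σ-cong (λ k → cong (ℚ._* F k i) (ι-indicator j k))) (QΣ.Σ-indicator j (λ k → F k i))))

  form-expand : ∀ {x} c → x ≈ combine c → ∀ y → x · y ≡ pair c (λ j → inner y j)
  form-expand {x} c x≈ y = trans (·-cong {x} {combine c} {y} {y} x≈ (λ i → refl))
    (trans (·-linComb c F y) (pair-congʳ c (λ j → ·-comm (F j) y)))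

  inner-integer : ∀ {x} → Λ x → ∀ j → IsInteger (inner x j)
  inner-integer {x} x∈Λ j = subst IsInteger (sym (trans (inner-cong (Λ⇒combine x∈Λ) j) (inner-combine (coord x) j)))
    (act-integer G (coord-integer x∈Λ) j)

  integral : Integral Λ
  integral u v u∈Λ v∈Λ = subst IsInteger (sym (form-expand (coord u) (Λ⇒combine u∈Λ) v))
    (integer-Σ (λ j → integer-* (coord-integer u∈Λ j) (inner-integer v∈Λ j)))

  F∈Dual : ∀ j → Dual Λ (F j)
  F∈Dual j = Λ⇒ΛQ (F∈Λ j) , (λ u u∈Λ → integral (F j) u (F∈Λ j) u∈Λ)

  dual-inner : ∀ {v} → Dual Λ v → ∀ j → IsInteger (inner v j)
  dual-inner (_ , int) j = int (F j) (F∈Λ j)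

  -- The dual basis: the inner product with `F* i` is the i-th coordinate.
  F* : Fin D → Vec24
  F* i = combine (λ j → r ℚ.* ι (H i j))

  form-F* : ∀ i y → F* i · y ≡ coord y i
  form-F* i y = trans (form-expand (λ j → r ℚ.* ι (H i j)) (λ _ → refl) y) (pair-*ˡ r (ι ∘ H i) (inner y))

  F*∈Dual : ∀ i → Dual Λ (F* i)
  F*∈Dual i = combine∈ΛQ n (λ j → r ℚ.* ι (H i j)) (λ _ → refl)
      (λ j → subst IsInteger (sym (cancel-reciprocal′ n (ι (H i j)))) (integer-ι (H i j)))
    , (λ u u∈Λ → subst IsInteger (sym (form-F* i u)) (coord-integer u∈Λ i))

  -- N (v · w) pairs `H` applied to the inner products of v with the inner products of w, all of
  -- them integers for dual vectors.
  scaled-dual-integral : ScaledDualIntegral Λ N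
  scaled-dual-integral v w v∈Λ* w∈Λ* = subst IsInteger
    (trans (pair-*ˡ (ι (+ N)) (coord v) (inner w)) (cong (ι (+ N) ℚ.*_) (sym (form-expand (coord v) (ΛQ⇒combine (proj₁ v∈Λ*)) w))))
    (integer-Σ (λ j → integer-* (subst IsInteger (sym (N-coord v j)) (act-integer H (dual-inner v∈Λ*) j)) (dual-inner w∈Λ* j)))

  -- The dual basis has Gram matrix N⁻¹H, so l being admissible makes N divide l · `H i j`; a single
  -- entry coprime to N forces N to divide l.
  level : ∀ i j → Coprime N ℤ.∣ H i j ∣ → IsLevel Λ N
  level i j coprime = ℕ.s≤s ℕ.z≤n , scaled-dual-integral , minimal
    where
    minimal : ∀ l → 0 < l → ScaledDualIntegral Λ l → N ≤ l
    minimal l@(suc _) _ int = ∣.∣⇒≤ (Coprimality.coprime-divisor coprime (divides ℤ.∣ z ∣ (trans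
        (ℕ.*-comm ℤ.∣ H i j ∣ l) (trans (sym (ℤ.abs-* (+ l) (H i j))) (trans (cong ℤ.∣_∣ lH≡) (ℤ.abs-* z (+ N)))))))
      where
      z : ℤ
      z = proj₁ (int (F* j) (F* i) (F*∈Dual j) (F*∈Dual i))
      z≡ : ι (+ l) ℚ.* (r ℚ.* ι (H i j)) ≡ ι z
      z≡ = trans (cong (ι (+ l) ℚ.*_) (sym (trans (form-F* j (F* i)) (coord-combine (λ k → r ℚ.* ι (H i k)) j))))
        (proj₂ (int (F* j) (F* i) (F*∈Dual j) (F*∈Dual i)))
      lH≡ : + l ℤ.* H i j ≡ z ℤ.* + N
      lH≡ = ι-injective (begin
        ι (+ l ℤ.* H i j)                                 ≡⟨ ι-* (+ l) (H i j) ⟩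
        ι (+ l) ℚ.* ι (H i j)                             ≡⟨ cong (ι (+ l) ℚ.*_) (sym (cancel-reciprocal′ n (ι (H i j)))) ⟩
        ι (+ l) ℚ.* (ι (+ N) ℚ.* (r ℚ.* ι (H i j)))       ≡⟨ *-leftComm (ι (+ l)) (ι (+ N)) (r ℚ.* ι (H i j)) ⟩
        ι (+ N) ℚ.* (ι (+ l) ℚ.* (r ℚ.* ι (H i j)))       ≡⟨ cong (ι (+ N) ℚ.*_) z≡ ⟩
        ι (+ N) ℚ.* ι z                                   ≡⟨ ℚ.*-comm (ι (+ N)) (ι z) ⟩
        ι z ℚ.* ι (+ N)                                   ≡⟨ ι-* z (+ N) ⟨
        ι (z ℤ.* + N)                                     ∎)
        where open ≡-Reasoning

  module _ (m-1 k : ℕ) (mk≡N : suc m-1 * k ≡ N) (coprime : gcd (suc m-1) k ≡ 1) (S : Similar G H (suc m-1)) where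
    open Similar S

    private
      m : ℕ
      m = suc m-1

    σ : Vec24 → Vec24
    σ x = combine (act A (coord x))

    act-AU : ∀ c i → act A (act U c) i ≡ ι (+ m) ℚ.* c i
    act-AU c i = trans (act-✶ A U c i) (trans (act-≡ c AU i) (act-scalar (+ m) c i))

    norm-combine : ∀ c → norm (combine c) ≡ pair c (act G c)
    norm-combine c = trans (form-expand c (λ _ → refl) (combine c)) (pair-congʳ c (inner-combine c))

    -- In matrices, AᵗGA = GUA = mG.
    norm-A : ∀ c → pair (act A c) (act G (act A c)) ≡ ι (+ m) ℚ.* pair c (act G c)
    norm-A c = begin
      pair (act A c) (act G (act A c))       ≡⟨ pair-act A c (act G (act A c)) ⟩
      pair c (act (A ᵗ) (act G (act A c)))   ≡⟨ pair-congʳ c (λ i → trans (act-✶ (A ᵗ) G (act A c) i)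
                                                  (trans (act-≡ (act A c) AG i) (sym (act-✶ G U (act A c) i)))) ⟩
      pair c (act G (act U (act A c)))       ≡⟨ pair-congʳ c (act-cong G (λ i → trans (act-✶ U A c i)
                                                  (trans (act-≡ c UA i) (act-scalar (+ m) c i)))) ⟩
      pair c (act G (λ i → ι (+ m) ℚ.* c i)) ≡⟨ pair-congʳ c (act-*ʳ G (ι (+ m)) c) ⟩
      pair c (λ i → ι (+ m) ℚ.* act G c i)   ≡⟨ pair-*ʳ (ι (+ m)) c (act G c) ⟩
      ι (+ m) ℚ.* pair c (act G c)           ∎
      where open ≡-Reasoning

    σ-ΛQ : ∀ x → ΛQ Λ x → ΛQ Λ (σ x)
    σ-ΛQ x (l , lx∈Λ) = combine∈ΛQ l (act A (coord x)) (λ _ → refl) (λ j → subst IsInteger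
      (trans (act-cong A (coord-• (ι (+ suc l)) x) j) (act-*ʳ A (ι (+ suc l)) (coord x) j))
      (act-integer A (coord-integer lx∈Λ) j))

    σ-+ : ∀ x y → σ (x +ᵥ y) ≈ (σ x +ᵥ σ y)
    σ-+ x y i = trans (linComb-cong F (λ j → trans (act-cong A (coord-+ x y) j) (act-+ A (coord x) (coord y) j)) i)
      (linComb-+ (act A (coord x)) (act A (coord y)) F i)

    σ-• : ∀ q x → σ (q • x) ≈ (q • σ x)
    σ-• q x i = trans (linComb-cong F (λ j → trans (act-cong A (coord-• q x) j) (act-*ʳ A q (coord x) j)) i)
      (linComb-• q (act A (coord x)) F i)

    σ-norm : ∀ x → ΛQ Λ x → norm (σ x) ≡ ι (+ m) ℚ.* norm x
    σ-norm x x∈ΛQ = trans (norm-combine (act A (coord x))) (trans (norm-A (coord x))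
      (cong (ι (+ m) ℚ.*_) (sym (trans (·-cong {x} {combine (coord x)} {x} {combine (coord x)} (ΛQ⇒combine x∈ΛQ) (ΛQ⇒combine x∈ΛQ))
        (norm-combine (coord x))))))

    -- The inner products of x with the basis are integral at every prime: at p dividing m by the
    -- first condition, at the others because basis vectors are also dual vectors. Pairing with the
    -- dual basis makes the coordinates integral away from m, so m times them is integral. On the
    -- other side, AH = mX shows that k times the coordinates of σ x is X applied to integers. As m
    -- and k are coprime, the coordinates of σ x are integers.
    σ-ΠDual : ∀ x → ΠDual m Λ x → Λ (σ x)
    σ-ΠDual x (x∈ΛQ , at-m , off-m) = integer⇒Λ (act A (coord x)) (λ _ → refl)
      (λ i → coprime-integer m k (act A (coord x) i) coprime (m-integer i) (k-integer i))
      where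
      inner-int : ∀ j → IsInteger (inner x j)
      inner-int j = locally-integer (inner x j) local
        where
        local : ∀ p → Prime p → inner x j ∈ℤ[ p ]
        local p pr with p ∣.∣? m
        ... | yes p∣m = at-m (F j) (F∈Λ j) p pr p∣m
        ... | no  p∤m = off-m (F j) (F∈Dual j) p pr p∤m
      m-coord : ∀ j → IsInteger (ι (+ m) ℚ.* coord x j)
      m-coord j = m-part m k (coord x j) coprime
        (subst (λ l → IsInteger (ι (+ l) ℚ.* coord x j)) (sym mk≡N)
          (subst IsInteger (sym (N-coord x j)) (act-integer H inner-int j)))
        (λ p pr p∤m → subst (_∈ℤ[ p ]) (trans (·-comm x (F* j)) (form-F* j x)) (off-m (F* j) (F*∈Dual j) p pr p∤m))
      m-integer : ∀ i → IsInteger (ι (+ m) ℚ.* act A (coord x) i)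
      m-integer i = subst IsInteger (act-*ʳ A (ι (+ m)) (coord x) i) (act-integer A m-coord i)
      mk-A : ∀ i → ι (+ m) ℚ.* (ι (+ k) ℚ.* act A (coord x) i) ≡ ι (+ m) ℚ.* act X (inner x) i
      mk-A i = begin
        ι (+ m) ℚ.* (ι (+ k) ℚ.* act A (coord x) i) ≡⟨ ℚ.*-assoc (ι (+ m)) (ι (+ k)) (act A (coord x) i) ⟨
        (ι (+ m) ℚ.* ι (+ k)) ℚ.* act A (coord x) i
          ≡⟨ cong (ℚ._* act A (coord x) i) (trans (sym (ι-* (+ m) (+ k))) (cong ι (trans (sym (ℤ.pos-* m k)) (cong +_ mk≡N)))) ⟩
        ι (+ N) ℚ.* act A (coord x) i               ≡⟨ act-*ʳ A (ι (+ N)) (coord x) i ⟨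
        act A (λ j → ι (+ N) ℚ.* coord x j) i       ≡⟨ act-cong A (N-coord x) i ⟩
        act A (act H (inner x)) i                   ≡⟨ act-✶ A H (inner x) i ⟩
        act (A ✶ H) (inner x) i                     ≡⟨ act-≡ (inner x) AH i ⟩
        act (λ i j → + m ℤ.* X i j) (inner x) i     ≡⟨ act-*ˡ (+ m) X (inner x) i ⟩
        ι (+ m) ℚ.* act X (inner x) i               ∎
        where open ≡-Reasoning
      k-integer : ∀ i → IsInteger (ι (+ k) ℚ.* act A (coord x) i)
      k-integer i = subst IsInteger (trans (sym (cancel-reciprocal m-1 (act X (inner x) i)))
        (trans (cong (+ 1 / m ℚ.*_) (sym (mk-A i))) (cancel-reciprocal m-1 (ι (+ k) ℚ.* act A (coord x) i))))
        (act-integer X inner-int i)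

    σ-onto : ∀ y → Λ y → ∃[ x ] (ΠDual m Λ x × σ x ≈ y)
    σ-onto y y∈Λ = combine c , (c∈ΛQ , at-m , off-m) , (λ i → trans (linComb-cong F σc i) (sym (Λ⇒combine y∈Λ i)))
      where
      z c : Fin D → ℚ
      z = coord y
      -- `U` is m A⁻¹, so these are the coordinates of the preimage of y.
      c j = + 1 / m ℚ.* act U z j
      mc : ∀ j → IsInteger (ι (+ m) ℚ.* c j)
      mc j = subst IsInteger (sym (cancel-reciprocal′ m-1 (act U z j))) (act-integer U (coord-integer y∈Λ) j)
      σc : ∀ j → act A (coord (combine c)) j ≡ z j
      σc j = trans (act-cong A (coord-combine c) j) (trans (act-*ʳ A (+ 1 / m) (act U z) j)
        (trans (cong (+ 1 / m ℚ.*_) (act-AU z j)) (cancel-reciprocal m-1 (z j))))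
      c∈ΛQ : ΛQ Λ (combine c)
      c∈ΛQ = combine∈ΛQ m-1 c (λ _ → refl) mc
      inner-int : ∀ j → IsInteger (inner (combine c) j)
      inner-int j = subst IsInteger (sym (begin
        inner (combine c) j                             ≡⟨ inner-combine c j ⟩
        act G c j                                       ≡⟨ act-*ʳ G (+ 1 / m) (act U z) j ⟩
        + 1 / m ℚ.* act G (act U z) j                   ≡⟨ cong (+ 1 / m ℚ.*_) (trans (act-✶ G U z j) (trans (act-≡ z GU j) (act-*ˡ (+ m) V z j))) ⟩
        + 1 / m ℚ.* (ι (+ m) ℚ.* act V z j)             ≡⟨ cancel-reciprocal m-1 (act V z j) ⟩
        act V z j                                       ∎)) (act-integer V (coord-integer y∈Λ) j)
        where open ≡-Reasoning
      at-m : ∀ u → Λ u → ∀ p → Prime p → p ∣ m → (combine c · u) ∈ℤ[ p ]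
      at-m u u∈Λ p pr _ = integer-local p pr (subst IsInteger
        (sym (trans (·-comm (combine c) u) (form-expand (coord u) (Λ⇒combine u∈Λ) (combine c))))
        (integer-Σ (λ j → integer-* (coord-integer u∈Λ j) (inner-int j))))
      off-m : ∀ u → Dual Λ u → ∀ p → Prime p → ¬ (p ∣ m) → (combine c · u) ∈ℤ[ p ]
      -- The coordinates c become integral after multiplication by m, so the denominator of the
      -- inner product with a dual vector divides m.
      off-m u u∈Λ* p pr p∤m p∣den = p∤m (∣.∣-trans p∣den (denominator∣ m (combine c · u) (subst IsInteger
        (trans (pair-*ˡ (ι (+ m)) c (inner u)) (cong (ι (+ m) ℚ.*_) (sym (form-expand c (λ _ → refl) u))))
        (integer-Σ (λ j → integer-* (mc j) (dual-inner u∈Λ* j))))))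

    modularity : IsModularity m Λ σ
    modularity = σ-ΛQ , (λ x y _ _ → σ-+ x y) , (λ q x _ → σ-• q x) , σ-norm , σ-ΠDual , σ-onto

  hasDim : HasDim Λ D
  hasDim = F , (λ j → Λ⇒ΛQ (F∈Λ j)) , independent , (λ x x∈ΛQ → coord x , ΛQ⇒combine x∈ΛQ)
    where
    independent : ∀ c → combine c ≈ 0ᵥ → ∀ i → c i ≡ ℚ.0ℚ
    independent c c≈0 i = begin
      c i                                       ≡⟨ coord-combine c i ⟨
      -- Zero is rewritten as 0 times a vector, so that linearity of `coord` evaluates it; any
      -- vector would do in place of `F* i`.
      coord (combine c) i                       ≡⟨ coord-cong (λ j → trans (c≈0 j) (sym (ℚ.*-zeroˡ (F* i j)))) i ⟩
      coord (ℚ.0ℚ • F* i) i                     ≡⟨ coord-• ℚ.0ℚ (F* i) i ⟩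
      ℚ.0ℚ ℚ.* coord (F* i) i                   ≡⟨ ℚ.*-zeroˡ (coord (F* i) i) ⟩
      ℚ.0ℚ                                      ∎
      where open ≡-Reasoning

-- Automorphisms of the Golay code

-- Elements of M₂₄ with an explicit inverse, so that products and conjugates act as plain
-- compositions of functions.
record Aut : Set where
  field
    to from : Fin 24 → Fin 24
    to-from : ∀ i → to (from i) ≡ i
    from-to : ∀ i → from (to i) ≡ i
    closed  : ∀ w → InGolay w → InGolay (w ∘ to)

  perm : Permutation′ 24
  perm = Perm.permutation to from to-from from-to

  injective : ∀ {i j} → to i ≡ to j → i ≡ j
  injective {i} {j} e = trans (sym (from-to i)) (trans (cong from e) (from-to j))

open Aut

_∙_ : Aut → Aut → Aut
g ∙ h = record
  { to = λ i → to g (to h i) ; from = λ i → from h (from g i)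
  ; to-from = λ i → trans (cong (to g) (to-from h (from g i))) (to-from g i)
  ; from-to = λ i → trans (cong (from h) (from-to g (to h i))) (from-to h i)
  ; closed = λ w w∈C → closed h (w ∘ to g) (closed g w w∈C) }

inverse : Aut → Aut
inverse g = record { to = from g ; from = to g ; to-from = from-to g ; from-to = to-from g
  ; closed = Golay.code-permute⁻¹ (perm g) (closed g) }

conjugate : Aut → Aut → Aut
conjugate k g = inverse k ∙ (g ∙ k)

-- Relabelling: k carries standard points to the points that occur for g, and the conjugate shows
-- the same arrows between the standard points.
conjugate-image : ∀ k g {x y x′ y′} → to k x ≡ x′ → to k y ≡ y′ → to g x′ ≡ y′ → to (conjugate k g) x ≡ y
conjugate-image k g refl refl e = trans (cong (from k) e) (from-to k _)

-- Octads and pointwise stabilisers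

wt-mono : ∀ {n} {v w : Fin n → Bool} → (∀ i → T (v i) → T (w i)) → wt v ≤ wt w
wt-mono {zero} imp = ℕ.z≤n
wt-mono {suc n} {v} {w} imp = ℕ.+-mono-≤ (bit-mono (v Fin.zero) (w Fin.zero) (imp Fin.zero)) (wt-mono (imp ∘ Fin.suc))
  where
  bit-mono : ∀ a b → (T a → T b) → bit a ≤ bit b
  bit-mono false b     _   = ℕ.z≤n
  bit-mono true  true  _   = ℕ.≤-refl
  bit-mono true  false imp = ⊥-elim (imp tt)

wt-xor : ∀ {n} (v w : Fin n → Bool) → wt v ℕ.+ wt w ≡ wt (λ i → v i xor w i) ℕ.+ 2 * wt (λ i → v i ∧ w i)
wt-xor v w = begin
  wt v ℕ.+ wt w                                        ≡⟨ NΣ.Σ-+ (bit ∘ v) (bit ∘ w) ⟨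
  Σℕ (λ i → bit (v i) ℕ.+ bit (w i))                   ≡⟨ NΣ.Σ-cong (λ i → bits (v i) (w i)) ⟩
  Σℕ (λ i → bit (v i xor w i) ℕ.+ 2 * bit (v i ∧ w i)) ≡⟨ NΣ.Σ-+ (λ i → bit (v i xor w i)) (λ i → 2 * bit (v i ∧ w i)) ⟩
  wt (λ i → v i xor w i) ℕ.+ Σℕ (λ i → 2 * bit (v i ∧ w i))
    ≡⟨ cong (wt (λ i → v i xor w i) ℕ.+_) (NΣ.Σ-*ˡ 2 (λ i → bit (v i ∧ w i))) ⟩
  wt (λ i → v i xor w i) ℕ.+ 2 * wt (λ i → v i ∧ w i)  ∎
  where
  open ≡-Reasoning
  bits : ∀ a b → bit a ℕ.+ bit b ≡ bit (a xor b) ℕ.+ 2 * bit (a ∧ b)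
  bits true  true  = refl
  bits true  false = refl
  bits false true  = refl
  bits false false = refl

xor≡false : ∀ {a b} → a xor b ≡ false → a ≡ b
xor≡false {true}  {true}  _ = refl
xor≡false {false} {false} _ = refl

-- If the sum of the two octads were nonzero it would have weight at least 8, and then 16 ≥ 8 + 2 ·
-- 5.
octad-unique : ∀ {n} (C : (Fin n → Bool) → Set) →
  (∀ v w → C v → C w → C (λ i → v i xor w i)) → (∀ w → C w → wt w ≡ 0 ⊎ (8 ≤ wt w × wt w ℕ.% 4 ≡ 0)) →
  ∀ v w → C v → C w → wt v ≡ 8 → wt w ≡ 8 → 5 ≤ wt (λ i → v i ∧ w i) → ∀ i → v i ≡ w i
octad-unique C C-xor C-weight v w v∈C w∈C wv ww five with C-weight _ (C-xor v w v∈C w∈C)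
... | inj₁ wt≡0′ = λ i → xor≡false (wt≡0 (λ i → v i xor w i) wt≡0′ i)
... | inj₂ (8≤ , _) = ⊥-elim (ℕ.<⇒≱ (ℕ.m≤m+n 17 1) (subst (18 ≤_) (trans (sym (wt-xor v w)) (cong₂ ℕ._+_ wv ww))
      (ℕ.+-mono-≤ 8≤ (ℕ.*-monoʳ-≤ 2 five))))

-- The octad `w ∘ to g` shares with w at least the five fixed points, so it is w.
octad-stable : (g : Aut) (K w : Fin 24 → Bool) → InGolay w → wt w ≡ 8 → 5 ≤ wt (λ i → w i ∧ K i) →
  (∀ i → T (K i) → to g i ≡ i) → ∀ i → w (to g i) ≡ w i
octad-stable g K w w∈C w≡8 five fixes = octad-unique InGolay (λ _ _ → Golay.code-xor) (λ _ → golay-weight)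
  (w ∘ to g) w (closed g w w∈C) w∈C (trans (NΣ.Σ-permute (bit ∘ w) (perm g)) w≡8) w≡8
  (ℕ.≤-trans five (wt-mono {24} {λ i → w i ∧ K i} {λ i → w (to g i) ∧ w i} common))
  where
  common : ∀ i → T (w i ∧ K i) → T (w (to g i) ∧ w i)
  common i t = subst (λ j → T (w j ∧ w i)) (sym (fixes i (T-∧ʳ {w i} t))) (subst T (sym (Bool.∧-idem (w i))) (T-∧ˡ t))

word : ℕ → Fin 24 → Bool
word k i = lookup (decode 10 24 k) i ℕ.≡ᵇ 1

isWord : (Fin 24 → Bool) → Bool
isWord w = allᵇ (λ k → dot w (golayGen k) =ᵇ false)

isWord-sound : ∀ w → T (isWord w) → InGolay w
isWord-sound w t = Golay.orth⇒code (λ k → =ᵇ-sound (allᵇ-sound (λ k → dot w (golayGen k) =ᵇ false) t k))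

isStable : (K w : Fin 24 → Bool) → Bool
isStable K w = isWord w ∧ ((wt w ℕ.≡ᵇ 8) ∧ (5 ℕ.≤ᵇ wt (λ i → w i ∧ K i)))

isStable-sound : ∀ K w → T (isStable K w) → (g : Aut) → (∀ i → T (K i) → to g i ≡ i) → ∀ i → w (to g i) ≡ w i
isStable-sound K w t g = octad-stable g K w (isWord-sound w (T-∧ˡ t))
  (ℕ.≡ᵇ⇒≡ (wt w) 8 (T-∧ˡ (T-∧ʳ {isWord w} t))) (ℕ.≤ᵇ⇒≤ 5 _ (T-∧ʳ {wt w ℕ.≡ᵇ 8} (T-∧ʳ {isWord w} t)))

-- The octads of `ws` have five points in K, hence are preserved by everything that fixes K
-- pointwise. If they tell each point of `K′` from all other points, then `K′` is fixed as well.
separates : ∀ {n} (K K′ : Fin 24 → Bool) → Vec ℕ n → Bool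
separates K K′ ws = allᵇ (λ j → isStable K (word (lookup ws j))) ∧
  allᵇ (λ x → allᵇ (λ y → not (K′ x) ∨ ((x =ᶠ y) ∨ anyᵇ (λ j → word (lookup ws j) y xor word (lookup ws j) x))))

separates-sound : ∀ {n} K K′ (ws : Vec ℕ n) → T (separates K K′ ws) → (g : Aut) →
  (∀ i → T (K i) → to g i ≡ i) → ∀ i → T (K′ i) → to g i ≡ i
separates-sound {n} K K′ ws t g fixes x x∈K′ with to g x in eq
... | y = decide (K′ x) x∈K′ (x =ᶠ y) refl (anyᵇ differ) refl
      (allᵇ-sound (λ y → not (K′ x) ∨ ((x =ᶠ y) ∨ anyᵇ (λ j → word (lookup ws j) y xor word (lookup ws j) x)))
        (allᵇ-sound (λ x → allᵇ (λ y → not (K′ x) ∨ ((x =ᶠ y) ∨ anyᵇ (λ j → word (lookup ws j) y xor word (lookup ws j) x))))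
          (T-∧ʳ {allᵇ (λ j → isStable K (word (lookup ws j)))} t) x) y)
  where
  differ : Fin n → Bool
  differ j = word (lookup ws j) y xor word (lookup ws j) x
  same : ∀ j → word (lookup ws j) y ≡ word (lookup ws j) x
  same j = trans (cong (word (lookup ws j)) (sym eq)) (isStable-sound K (word (lookup ws j))
    (allᵇ-sound (λ j → isStable K (word (lookup ws j))) (T-∧ˡ t) j) g fixes x)
  decide : ∀ k → T k → ∀ e → e ≡ (x =ᶠ y) → ∀ a → a ≡ anyᵇ differ → T (not k ∨ (e ∨ a)) → y ≡ x
  decide true _ true  e≡ a a≡ _ = sym (=ᶠ-sound (subst T e≡ tt))
  decide true _ false e≡ true a≡ _ with anyᵇ-sound differ (subst T a≡ tt)
  ... | j , d = ⊥-elim (subst T (trans (cong (_xor word (lookup ws j) x) (same j)) (Bool.xor-same (word (lookup ws j) x))) d)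

-- Permutation tables and transversals of a stabiliser chain

Table : Set
Table = Vec (Fin 24) 24

decodeTable : ℕ → Table
decodeTable k = Vec.map (λ d → d ℕ.mod 24) (decode 100 24 k)

-- If y is not found, the last position is returned; `isAut` tests that the result really is an
-- inverse.
search : ∀ {n} → Vec (Fin 24) (suc n) → ℕ → Fin (suc n)
search {zero}  t       y = Fin.zero
search {suc n} (x ∷ t) y = if toℕ x ℕ.≡ᵇ y then Fin.zero else Fin.suc (search t y)

-- The form `dot` on stored vectors, used where a permuted row meets all twelve generators.
dotV : ∀ {n} → Vec Bool n → Vec Bool n → Bool
dotV []      []      = false
dotV (x ∷ v) (y ∷ w) = (x ∧ y) xor dotV v w

dotV≡dot : ∀ {n} (v w : Vec Bool n) → dotV v w ≡ dot (lookup v) (lookup w)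
dotV≡dot []      []      = refl
dotV≡dot (x ∷ v) (y ∷ w) = cong ((x ∧ y) xor_) (dotV≡dot v w)

-- By `Golay.code-permute`, twelve permuted rows against twelve rows decide whether the code is
-- preserved.
isAut : Table → Bool
isAut t = allᵇ (λ i → lookup t (search t (toℕ i)) =ᶠ i) ∧ (allᵇ (λ i → search t (toℕ (lookup t i)) =ᶠ i) ∧
  allᵇ (λ i → preserves (Vec.map (lookup (lookup golayRows i)) t)))
  where
  preserves : Vec Bool 24 → Bool
  preserves v = allᵇ (λ k → dotV v (lookup golayRows k) =ᵇ false)

fromTable : (t : Table) → T (isAut t) → Aut
fromTable t ok = record { to = to′ ; from = from′ ; to-from = to-from′ ; from-to = from-to′
  ; closed = Golay.code-permute (Perm.permutation to′ from′ to-from′ from-to′) orth }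
  where
  to′ from′ : Fin 24 → Fin 24
  to′ = lookup t
  from′ i = search t (toℕ i)
  ok′ : T (allᵇ (λ i → from′ (to′ i) =ᶠ i) ∧ _)
  ok′ = T-∧ʳ {allᵇ (λ i → to′ (from′ i) =ᶠ i)} ok
  to-from′ : ∀ i → to′ (from′ i) ≡ i
  to-from′ i = =ᶠ-sound (allᵇ-sound (λ i → to′ (from′ i) =ᶠ i) (T-∧ˡ ok) i)
  from-to′ : ∀ i → from′ (to′ i) ≡ i
  from-to′ i = =ᶠ-sound (allᵇ-sound (λ i → from′ (to′ i) =ᶠ i) (T-∧ˡ ok′) i)
  row : Fin 12 → Vec Bool 24
  row i = Vec.map (lookup (lookup golayRows i)) t
  orth : ∀ i k → dot (λ j → golayGen i (to′ j)) (golayGen k) ≡ false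
  orth i k = trans (BΣ.Σ-cong (λ j → cong (_∧ golayGen k j) (sym (Vec.lookup-map j (lookup (lookup golayRows i)) t))))
    (trans (sym (dotV≡dot (row i) (lookup golayRows k)))
      (=ᵇ-sound (allᵇ-sound (λ k → dotV (row i) (lookup golayRows k) =ᵇ false)
        (allᵇ-sound (λ i → allᵇ (λ k → dotV (row i) (lookup golayRows k) =ᵇ false))
          (T-∧ʳ {allᵇ (λ i → from′ (to′ i) =ᶠ i)} ok′) i) k)))

member : ∀ {n} → Vec (Fin 24) n → Fin 24 → Bool
member xs y = anyᵇ (λ i → lookup xs i =ᶠ y)

isTransversal : ∀ {n} (valid : Fin 24 → Bool) {m} (fixed : Vec (Fin 24) m) (b : Fin 24) → Vec Table n → Bool
isTransversal valid fixed b ts = allᵇ (λ i → isAut (lookup ts i)) ∧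
  allᵇ (λ p → not (valid p) ∨ anyᵇ (λ i → (lookup (lookup ts i) b =ᶠ p) ∧
    allᵇ (λ j → lookup (lookup ts i) (lookup fixed j) =ᶠ lookup fixed j)))

-- One step of a stabiliser chain: for each point of the orbit `valid` of b there is an element that
-- fixes the earlier base points and carries b to it. `table≡` keeps the tables accessible while the
-- transversals themselves are opaque.
record Transversal {n} (valid : Fin 24 → Bool) {m} (fixed : Vec (Fin 24) m) (b : Fin 24) (ts : Vec Table n) : Set where
  field
    element : Fin n → Aut
    table≡  : ∀ i x → to (element i) x ≡ lookup (lookup ts i) x
    reach   : ∀ p → T (valid p) → Σ (Fin n) λ i → to (element i) b ≡ p × (∀ j → to (element i) (lookup fixed j) ≡ lookup fixed j)

transversal : ∀ {n} valid {m} (fixed : Vec (Fin 24) m) b (ts : Vec Table n) → isTransversal valid fixed b ts ≡ true →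
              Transversal valid fixed b ts
transversal {n} valid fixed b ts ok≡ = record { element = el ; table≡ = λ i x → refl ; reach = reach }
  where
  ok : T (isTransversal valid fixed b ts)
  ok = ≡⇒T ok≡
  el : Fin n → Aut
  el i = fromTable (lookup ts i) (allᵇ-sound (λ i → isAut (lookup ts i)) (T-∧ˡ ok) i)
  good : Fin 24 → Fin n → Bool
  good p i = (lookup (lookup ts i) b =ᶠ p) ∧ allᵇ (λ j → lookup (lookup ts i) (lookup fixed j) =ᶠ lookup fixed j)
  reach : ∀ p → T (valid p) → Σ (Fin n) λ i → to (el i) b ≡ p × (∀ j → to (el i) (lookup fixed j) ≡ lookup fixed j)
  reach p v with anyᵇ-sound (good p) (T-imp (allᵇ-sound (λ p → not (valid p) ∨ anyᵇ (good p)) (T-∧ʳ {allᵇ (λ i → isAut (lookup ts i))} ok) p) v)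
  ... | i , t = i , =ᶠ-sound (T-∧ˡ t) , λ j → =ᶠ-sound
        (allᵇ-sound (λ j → lookup (lookup ts i) (lookup fixed j) =ᶠ lookup fixed j) (T-∧ʳ {lookup (lookup ts i) b =ᶠ p} t) j)

member-or-not : ∀ {n} (xs : Vec (Fin 24) n) p → (∃[ i ] lookup xs i ≡ p) ⊎ T (not (member xs p))
member-or-not xs p with member xs p in eq
... | false = inj₂ tt
... | true with anyᵇ-sound (λ i → lookup xs i =ᶠ p) (subst T (sym eq) tt)
...   | i , t = inj₁ (i , =ᶠ-sound t)

-- A permutation is a string of two-digit images, the image of the point 0 rightmost.

coset₁ : Vec Table 24
coset₁ = Vec.map decodeTable
  ( 232221201918171615141312111009080706050403020100
  ∷ 130602032217080412162315072110112009181900140501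
  ∷ 220410210903171105230812151820061601140013071902
  ∷ 050712230013162110110218062204172008141519010903
  ∷ 101321061816071722020511091915082314122003010004
  ∷ 180002090323071422191511011220162110080613041705
  ∷ 092320050401220718131415100011032108021917121606
  ∷ 010004130323102219111517060921080520120216181407
  ∷ 171116042322120013210109031807021415100620190508
  ∷ 171904071406031108121620210113051022182315020009
  ∷ 220715141109130502170821161201000320181904062310
  ∷ 040008181706141910210309052202151207132316200111
  ∷ 130917111519202203070008230602140516210104181012
  ∷ 031520120717210801000405100902111806142216192313
  ∷ 130500220916192002100807230611180103171221150414
  ∷ 140908202219170600010302160410211223131805071115
  ∷ 000321171114151201072305221810191308092004020616
  ∷ 052112111001191614131802042309070003200815062217
  ∷ 052114151622190223070920100611030001041217081318
  ∷ 050212160803141810150013201706211123070122090419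
  ∷ 020307130921140815050416172223110601001910121820
  ∷ 150313101206160717231908092022011114020405180021
  ∷ 161210110501080719000406150313211723091418022022
  ∷ 180519021420002208061501121316100409110721170323 ∷ [])

coset₂ : Vec Table 23
coset₂ = Vec.map decodeTable
  ( 232221201918171615141312111009080706050403020100
  ∷ 091811121403200407061910162223130815170121050200
  ∷ 091323160610180120120422081121071905021417150300
  ∷ 181911080123212010091412031502050706162217130400
  ∷ 102018130317061912232214160807211501040902110500
  ∷ 131812020314050120161108191022152109230417070600
  ∷ 041910140217201523081809050622111201162113030700
  ∷ 100201201211071805091321231606191417030422150800
  ∷ 030110110706121421181319052016230822020417150900
  ∷ 051406162317082009221807190313150411211201021000
  ∷ 120502101713162203200121180923150607080419141100
  ∷ 021504090803131114072223060121200517181019161200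
  ∷ 200215182221050916061217192310070801030414111300
  ∷ 192304011308071715030612110521161822091002201400
  ∷ 180617211309201005030704110216221901081214231500
  ∷ 181308041121190601102205021220230717090314151600
  ∷ 211018190703021422061615132304081201091120051700
  ∷ 191314210906170222030704230111081510051220161800
  ∷ 232114070802051813152016170410112201061203091900
  ∷ 062209010818131612031715021021190723050414112000
  ∷ 152022160603140810230218190113040511091217072100
  ∷ 100807202123061309011603181105021412041715192200
  ∷ 132211040516170806100719032015140901021812212300 ∷ [])

coset₃ : Vec Table 22
coset₃ = Vec.map decodeTable
  ( 232221201918171615141312111009080706050403020100
  ∷ 171108200409231606021219100715212218141305030100
  ∷ 111416030921131223180515021920171008072206040100
  ∷ 171506040821230920141607181310121911022203050100
  ∷ 040702160817221303151812092105232014191110060100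
  ∷ 171814031608230520102109131506021904221211070100
  ∷ 190523131403181712200616020421150922071110080100
  ∷ 021223071503192108051611221713062010041418090100
  ∷ 081406182316211520221704110719090313051202100100
  ∷ 130507080614170922122119102015020418162303110100
  ∷ 181913022205200323160617070811211009041415120100
  ∷ 141205190803212011170704090210151618062322130100
  ∷ 112307050309021622190617181204200821131510140100
  ∷ 171303050610022316211812080922140720041911150100
  ∷ 091507020320081712040519062114131823102211160100
  ∷ 231520120822141309051910110604071621031802170100
  ∷ 231505022209141708211907161112030620101304180100
  ∷ 081003140212110723051813040922211615172006190100
  ∷ 222116121015060719050411131702081403230918200100
  ∷ 031508171120042219052302130910181407061216210100
  ∷ 162312180609200419141305172111150807030210220100
  ∷ 221109151420161703041006182112051908130702230100 ∷ [])

coset₄ : Vec Table 21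
coset₄ = Vec.map decodeTable
  ( 232221201918171615141312111009080706050403020100
  ∷ 032019091505102111071823142206171608121304020100
  ∷ 082307161320221215101104141903060917211805020100
  ∷ 080915051912040721141318111022231603201706020100
  ∷ 060510041803191514231209110820221716211307020100
  ∷ 162212110918031307152306102005171421190408020100
  ∷ 201118191304100717150514061222082103231609020100
  ∷ 131209201723190618111522042103160807140510020100
  ∷ 121509031622080507180619171004201421231311020100
  ∷ 140319201322210506091718070804151110162312020100
  ∷ 141808170609101505190716212303120420112213020100
  ∷ 072111100513222303181908090412172016150614020100
  ∷ 132116082219051807060310110917142304122015020100
  ∷ 051923131422110912200410080615211703071816020100
  ∷ 061905141303100708162311220420091512182117020100
  ∷ 040613032221091407192011171210152316050818020100
  ∷ 182007231506090308042110171112161422051319020100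
  ∷ 151405111316101821090719081704031206232220020100
  ∷ 050913030620221923101811161714071512080421020100
  ∷ 111513231016092108030420071218051914061722020100
  ∷ 070815201410061705210904121611032218191323020100 ∷ [])

coset₅ : Vec Table 20
coset₅ = Vec.map decodeTable
  ( 232221201918171615141312111009080706050403020100
  ∷ 040915162108121813071914062322201711100503020100
  ∷ 171613200721051012141811152219040908230603020100
  ∷ 052008192215171109231612130418061021140703020100
  ∷ 122322092006101821071115051614131917040803020100
  ∷ 102313211918071508122006172205161114040903020100
  ∷ 111317051523061916221412180720080421091003020100
  ∷ 141016082115051320231922070604180912171103020100
  ∷ 140913181920051615232104060722081011171203020100
  ∷ 042319150908102211121620142117061805071303020100
  ∷ 191120181221081004151323060509071722161403020100
  ∷ 071411062009041821122208171923131605101503020100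
  ∷ 181704070912130622201008231514111905211603020100
  ∷ 121918131121102206072014160515092308041703020100
  ∷ 140711061909231508172221122004161310051803020100
  ∷ 222010070504111714061216131518230821091903020100
  ∷ 060416151719111405090821071312231810222003020100
  ∷ 221016152319090514110820121807171304062103020100
  ∷ 231618211220140407051309150619101108172203020100
  ∷ 041309111906101615122214201721080518072303020100 ∷ [])

coset₆ : Vec Table 3
coset₆ = Vec.map decodeTable
  ( 232221201918171615141312111009080706050403020100
  ∷ 091823141517221916060507131221081020110403020100
  ∷ 111518202313091705062110190716141208220403020100 ∷ [])

coset₇ : Vec Table 16
coset₇ = Vec.map decodeTable
  ( 232221201918171615141312111009080706050403020100
  ∷ 111716192008222113091512231014180705060403020100
  ∷ 152122091406161723191112131020050718080403020100
  ∷ 222315081819111321061612171005200714090403020100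
  ∷ 061419162115092018220812051017130723110403020100
  ∷ 181914172223200906210512081016110715130403020100
  ∷ 171113180820231516052112221006190709140403020100
  ∷ 082009221711191405160612181021230713150403020100
  ∷ 191806112322080514150912201013170721160403020100
  ∷ 140618131521050819232012091011160722170403020100
  ∷ 131617140905212211202312151019060708180403020100
  ∷ 161311060509152317082212211018140720190403020100
  ∷ 211523050614131122181712161008090719200403020100
  ∷ 200805231117180609131412191015220716210403020100
  ∷ 090508151316061820111912141023210717220403020100
  ∷ 050920211613141908171812061022150711230403020100 ∷ [])

patterns : Vec Table 12
patterns = Vec.map decodeTable
  ( 171422152120062309190510111218080716130104030200
  ∷ 231106172019081505211310180114221216090704030200
  ∷ 180813190117160710110615092223122021140504030200
  ∷ 111620211713221405091807151219231008060401030200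
  ∷ 092023170805111915221410131218160421060701030200
  ∷ 121920130618041122102117151408092316070501030200
  ∷ 190811171321091622051507061220231014180304010200
  ∷ 062311150917201905142110161213180322080704010200
  ∷ 140311211315202316081718070912221910060504010200
  ∷ 221617052014111321092307151008181219060403010200
  ∷ 182223050817211519201410060409161211130703010200
  ∷ 041816152208070911121914201721062313100503010200 ∷ [])

-- One element for each of the orders 2, 3, 4, 5, 6, 7, 8, 11, 14, 15, 23. M₂₃ has a single class
-- for each of the orders 2, 3, 4, 5, 6, 8 and two mutually inverse classes for each of 7, 11, 14,
-- 15, 23, so up to inversion nothing else remains.
reps : Vec Table 11
reps = Vec.map decodeTable
  ( 062221171915200918141112131016050723080304010200
  ∷ 181422091906201615211107051217081023130401030200
  ∷ 171422152120062309190510111218080716130104030200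
  ∷ 141923210508112015160912131006220117180704030200
  ∷ 211916140718091210231120131506012217080504030200
  ∷ 231106172019081505211310180114221216090704030200
  ∷ 052306191813221411151710091221160708200104030200
  ∷ 121923081609011114072115172213182006100504030200
  ∷ 131508211409061118172310050120161222190704030200
  ∷ 180813190117160710110615092223122021140504030200
  ∷ 140108211309181706112320071510192212160504030200 ∷ [])

-- For each pattern and each element of the stabiliser of five points, twelve digits holding the indices
-- in coset₁, …, coset₇ of a conjugator to a representative (in base 24), its sign and its class.
conjugators : Vec (Vec ℕ 3) 12
conjugators =
  ( (057151344823019504029847018346425057055248065767018536988672055037657088055998600216055616049288055611359472019686746153020650647703021215452190055421312335020847927598055622492311018345885696
    ∷ 019511450654055810707322056778592392057912557808055249281562019691569152055237179034055823524042021233885386056970040344020645197194019118260224056001134592020267423838020259736795019131752650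
    ∷ 018935119872018557894303019896710538056391303168019124570964019111697000056773902576057918475092019888982868019317325824056953020156055815459864057151174236056585337036018362893259057917247624 ∷ [])
  ∷ (074726799600075316290840046438023168075299358672075497676168073383542784074726028312047202435072046820229120046246920192047011332096076271805720047393538048075697033608047584641024045864714240
    ∷ 028092137472029620961280029812064256027901034496028856549376028283240448029047652352030003167232028665446400028474343424029238755328030194270208029429858304027709931520030385373184027518828544
    ∷ 051042803328051425009280051807215232080663304072078751358928079701738120050660597376052380524160051616112256080269693680053144936064052953833088079900735320080856250200079899352704079697987736 ∷ [])
  ∷ (079882756704052368396491052000327016080853700776089446855224083910131712057331316505065564246016064210599936050838524701055631592786080650979952083519963136065174077440056776741915082556485632
    ∷ 066697484382065740700512066333210192037076798683097844929344091729428480036691771392027711330920098052228864092692905984065371740669093083074560036883413729098054788032066323035728065374586040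
    ∷ 087737681664055057261992074735275584088694017920088290830016064989425177075489887064066891597350073581003504064228029455047394620363083150118264057917532336045866113640056184856416048163171165 ∷ [])
  ∷ (010718868812038049575332039559174564038807952864038987208120009172942848036701482272037466918328011476649333039179816160038242110820039569397412038047605988037083044044010328062689038223714336
    ∷ 038616961252038033356152038226741580039198602976009366440552036897414628037267947168011468668123010136900188037275214924038413269024037459194144036701767588009946925920036705239520039376262308
    ∷ 009175486666009955418716010513232023010718908618010713624727010711302295011288346624009190109335009561268828011277405012009754221396011857017684009372917911010339135488009748488343010531233792 ∷ [])
  ∷ (039181296355037282494705038993449190036704605944037476467808038995976568038986914912037658910021038608725644039580067616037664907305037279149792039384559392039368282784038224289550038795366079
    ∷ 039377080608010714228085038613336288038035857696038240864160039006088800011477957851036708648562011468376801039388230514010900936074037652689272037076890786036706103218037092696802038814822514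
    ∷ 037464391392037650869664011296081290009764535326038428799712011102464861037285128696038804612700038811748188038798441952009381451817038999540832036886143324037668722340038996158692037269640032 ∷ [])
  ∷ (038997120456089067509064038811284424010137747456083512474056038230318311036707881656083897642424084662036424037275066525037090287955088291434312090027512184083896421832089836094664037267174770
    ∷ 083337973176087156769032038620554696038431184745036890937288037086502595083533942728038223519090009374599623085443534792037468215670089641428552089256478536038431497672088103963064082765176264
    ∷ 039197806710087344232840082749499848082567182648037473544531085053946824011106305418038417889144038806601536038986600392084099703752090021992904087928755384037075157223089267244552037083410806 ∷ [])
  ∷ (037094555616038624205445038606568312038049532512039387991224037265512416036902519520038986906147038797449935038987253581036696269921036700295217039562129248038611461984036701334783038619649824
    ∷ 037651555680039371026721038614687244038814823992038241390705038238042336037663416419038429742608038232077135037074725848039189216262038226833827038222138437038620336992038232050784036885126470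
    ∷ 020843105628019702339927019704843744020836697047018930098674018349480663020451856114020257016412019504334112020645681052001346960224000975003799020849541792002493700712020083625650000000000000 ∷ [])
  ∷ (039001751395037269735039038619101417036891420576038806971683038040701304037461853894039003529813038614084493039558560901037265968268038622594126037279414607038226806792036706274466037649143392
    ∷ 056193636816057348306696055050989410057921205402018553992346020086809949020835800363019127301274056380913904021213138263020645208303018542524656056197987138055424790202019306936560056771867016
    ∷ 018930813944018363908021056393727192020834633053020843059440019696441584021021555804056568239496056197349712056949274956057541788612018537217116055820898492018919462187056006007024055037885532 ∷ [])
  ∷ (057717451389036896222136039384167664037283915081020848502615078363896472038614034438078742922736075885939936039384609928056395149188055242287376075873887472074550748320057535204560078544750608
    ∷ 055428266112074926436208056377107022039187756272080470328472080283676872038236745507038413391088057340918902055820817600036895515888079134273312019131566072037848373079076064471088074934295584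
    ∷ 056767418808037460195159037652186441080849175240080457868656055819161592055234810104075506822376073392233064075693898008039370354734038222288112055059838887018540672240080650228752038416534928 ∷ [])
  ∷ (018559270372021234766258020262300772000382233802018921141600000395938144019686002067019887216864019321464178019305933490018359576595020279161248002496673179021230863204001534325985018555137235
    ∷ 021031670884021024001248019116833764021042106080021038156508018747937884018356922012018730503891001159584768021217412691019493092896001737457193021033721444000207055872001740849492020464092819
    ∷ 020267576736020454397207019696479127000782798049018930522912019305926163019504229476000386273384018366371428019878917715000393276055019310586579020644523232001719946695019116675940021232903831 ∷ [])
  ∷ (019887599670055823179656019504850369021221459165057151245651019687936392020452348296055441237968056377053720018750143427020661173187056584810275056970738627056205435963057335222664020655068278
    ∷ 019124078770000203655370018937895712021041905906020645625180019877235219000961075611020086449778020079694752019879814547020850671763020452089756019120368480020457008796001358235850000195182299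
    ∷ 057352155480020082879094020083647939020466751709056185336776019509757889055246595523057525034320056011629219056951109000020641543560018350633526018730513800055439231547018363721155055238060499 ∷ [])
  ∷ (037859984883020267633895056206510851056968363248057729366432019701778038036892637763018541858248021035075053038985079875019890778486055055908392056196684915056579574219018744594512037277138499
    ∷ 037458232899036893047347001720356571021022047092037847698803020642912835037276529715038029592520038422222968039384268083021232521447037856314035037093818312037651077576036711114819037083395016
    ∷ 056950297347018733859907020832702408056951038923038416745331019703962482057157586160039559453251039567678408021214785910057141487008055818916467020078100307037075708995055234182696019320595062 ∷ []) ∷ [])

-- The base of a stabiliser chain with orbit lengths 24, 23, 22, 21, 20, 3, 16: five points, then b₆
-- among the three further points of their octad, then b₇ among the sixteen points outside that
-- octad.
b₁ b₂ b₃ b₄ b₅ b₆ b₇ : Fin 24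
b₁ = # 0
b₂ = # 1
b₃ = # 2
b₄ = # 3
b₅ = # 4
b₆ = # 7
b₇ = # 5

first₅ : Vec (Fin 24) 5
first₅ = b₁ ∷ b₂ ∷ b₃ ∷ b₄ ∷ b₅ ∷ []

first₆ : Vec (Fin 24) 6
first₆ = b₁ ∷ b₂ ∷ b₃ ∷ b₄ ∷ b₅ ∷ b₆ ∷ []

first₇ : Vec (Fin 24) 7
first₇ = b₁ ∷ b₂ ∷ b₃ ∷ b₄ ∷ b₅ ∷ b₆ ∷ b₇ ∷ []

baseOctad : Fin 24 → Bool
baseOctad = word 000000000001010010011111

outside : ∀ {n} → Vec (Fin 24) n → Fin 24 → Bool
outside xs = not ∘ member xs

areAuts : ∀ {n} → Vec Table n → Bool
areAuts ts = allᵇ (λ i → isAut (lookup ts i))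

areAuts-element : ∀ {n} (ts : Vec Table n) → areAuts ts ≡ true → Fin n → Aut
areAuts-element ts ok i = fromTable (lookup ts i) (allᵇ-sound (λ i → isAut (lookup ts i)) (≡⇒T ok) i)

-- The tables are evaluated here once and for all.
abstract

  tr₁ : Transversal (outside []) [] b₁ coset₁
  tr₁ = transversal (outside []) [] b₁ coset₁ refl

  tr₂ : Transversal (outside (b₁ ∷ [])) (b₁ ∷ []) b₂ coset₂
  tr₂ = transversal (outside (b₁ ∷ [])) (b₁ ∷ []) b₂ coset₂ refl

  tr₃ : Transversal (outside (b₁ ∷ b₂ ∷ [])) (b₁ ∷ b₂ ∷ []) b₃ coset₃
  tr₃ = transversal (outside (b₁ ∷ b₂ ∷ [])) (b₁ ∷ b₂ ∷ []) b₃ coset₃ refl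

  tr₄ : Transversal (outside (b₁ ∷ b₂ ∷ b₃ ∷ [])) (b₁ ∷ b₂ ∷ b₃ ∷ []) b₄ coset₄
  tr₄ = transversal (outside (b₁ ∷ b₂ ∷ b₃ ∷ [])) (b₁ ∷ b₂ ∷ b₃ ∷ []) b₄ coset₄ refl

  tr₅ : Transversal (outside (b₁ ∷ b₂ ∷ b₃ ∷ b₄ ∷ [])) (b₁ ∷ b₂ ∷ b₃ ∷ b₄ ∷ []) b₅ coset₅
  tr₅ = transversal (outside (b₁ ∷ b₂ ∷ b₃ ∷ b₄ ∷ [])) (b₁ ∷ b₂ ∷ b₃ ∷ b₄ ∷ []) b₅ coset₅ refl

  tr₆ : Transversal (λ p → baseOctad p ∧ outside first₅ p) first₅ b₆ coset₆
  tr₆ = transversal (λ p → baseOctad p ∧ outside first₅ p) first₅ b₆ coset₆ refl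

  tr₇ : Transversal (not ∘ baseOctad) first₆ b₇ coset₇
  tr₇ = transversal (not ∘ baseOctad) first₆ b₇ coset₇ refl

  patternAut : Fin 12 → Aut
  patternAut = areAuts-element patterns refl

  pattern≡ : ∀ p x → to (patternAut p) x ≡ lookup (lookup patterns p) x
  pattern≡ p x = refl

rep : Fin 11 → Fin 24 → Fin 24
rep c = lookup (lookup reps c)

-- The fixed lattice only depends on the group generated by g, so representatives are needed up to inversion.
InClass : Fin 11 → (Fin 24 → Fin 24) → (Fin 24 → Fin 24) → Set
InClass c k g = (∀ x → g (k x) ≡ k (rep c x)) ⊎ (∀ x → g (k (rep c x)) ≡ k x)

Classified : Aut → Set
Classified g = Σ (Fin 11) λ c → Σ Aut λ k → InClass c (to k) (to g)

classified-conjugate : ∀ k g → Classified (conjugate k g) → Classified g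
classified-conjugate k g (c , h , inj₁ e) = c , k ∙ h , inj₁ λ x →
  trans (sym (to-from k (to g (to k (to h x))))) (cong (to k) (e x))
classified-conjugate k g (c , h , inj₂ e) = c , k ∙ h , inj₂ λ x →
  trans (sym (to-from k (to g (to k (to h (rep c x)))))) (cong (to k) (e x))

-- The reductions modulo n only make the indices total; the decoded conjugator is tested, not
-- trusted.
module Leaf (code : ℕ) where

  digit : ∀ {n} .{{_ : NonZero n}} → Fin 7 → Fin n
  digit {n} l = lookup (decode 24 7 code) l ℕ.mod n

  class : Fin 11
  class = (code ℕ./ (24 ℕ.^ 7) ℕ./ 2) ℕ.mod 11

  inverted : Bool
  inverted = (code ℕ./ (24 ℕ.^ 7)) ℕ.% 2 ℕ.≡ᵇ 1

-- Tests g k = k r, or g k r = k in the inverted case, at all points. `check` takes the selected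
-- tables as arguments so that they are selected once for all 24 points.
isClassified : Vec Table 24 → Vec Table 23 → Vec Table 22 → Vec Table 21 → Vec Table 20 → Vec Table 3 → Vec Table 16 →
               Vec Table 11 → ℕ → (Fin 24 → Fin 24) → Bool
isClassified c₁ c₂ c₃ c₄ c₅ c₆ c₇ rs code g = check (lookup rs class) (lookup c₁ (digit 0F)) (lookup c₂ (digit 1F))
  (lookup c₃ (digit 2F)) (lookup c₄ (digit 3F)) (lookup c₅ (digit 4F)) (lookup c₆ (digit 5F)) (lookup c₇ (digit 6F))
  where
  open Leaf code
  check : Table → Table → Table → Table → Table → Table → Table → Table → Bool
  check r t₁ t₂ t₃ t₄ t₅ t₆ t₇ = if inverted then allᵇ (λ x → g (k (lookup r x)) =ᶠ k x) else allᵇ (λ x → g (k x) =ᶠ k (lookup r x))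
    where
    k : Fin 24 → Fin 24
    k x = lookup t₁ (lookup t₂ (lookup t₃ (lookup t₄ (lookup t₅ (lookup t₆ (lookup t₇ x))))))

leafCode : Fin 12 → Fin 3 → Fin 16 → ℕ
leafCode p i j = lookup (decode 1000000000000 16 (lookup (lookup conjugators p) i)) j

allClassified : Vec Table 24 → Vec Table 23 → Vec Table 22 → Vec Table 21 → Vec Table 20 → Vec Table 3 → Vec Table 16 →
                Vec Table 11 → Vec Table 12 → Bool
allClassified c₁ c₂ c₃ c₄ c₅ c₆ c₇ rs ps = allᵇ λ p → allᵇ λ i → allᵇ λ j →
  isClassified c₁ c₂ c₃ c₄ c₅ c₆ c₇ rs (leafCode p i j) (λ x → lookup (lookup ps p) (lookup (lookup c₆ i) (lookup (lookup c₇ j) x)))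

allClassifiedOk : allClassified coset₁ coset₂ coset₃ coset₄ coset₅ coset₆ coset₇ reps patterns ≡ true
allClassifiedOk = refl

-- Classification up to conjugacy and inversion

-- Stated for arbitrary tables, so that nothing is evaluated again when it is applied.
allClassified-sound : ∀ c₁ c₂ c₃ c₄ c₅ c₆ c₇ rs ps → allClassified c₁ c₂ c₃ c₄ c₅ c₆ c₇ rs ps ≡ true → ∀ p i j →
  T (isClassified c₁ c₂ c₃ c₄ c₅ c₆ c₇ rs (leafCode p i j) (λ x → lookup (lookup ps p) (lookup (lookup c₆ i) (lookup (lookup c₇ j) x))))
allClassified-sound c₁ c₂ c₃ c₄ c₅ c₆ c₇ rs ps t p i j =
  allᵇ-sound (ok p i) (allᵇ-sound (λ i → allᵇ (ok p i)) (allᵇ-sound (λ p → allᵇ (λ i → allᵇ (ok p i))) (≡⇒T t) p) i) j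
  where
  ok : Fin 12 → Fin 3 → Fin 16 → Bool
  ok p i j = isClassified c₁ c₂ c₃ c₄ c₅ c₆ c₇ rs (leafCode p i j)
    (λ x → lookup (lookup ps p) (lookup (lookup c₆ i) (lookup (lookup c₇ j) x)))

leaf-classified : ∀ p i j → T (isClassified coset₁ coset₂ coset₃ coset₄ coset₅ coset₆ coset₇ reps (leafCode p i j)
  (λ x → lookup (lookup patterns p) (lookup (lookup coset₆ i) (lookup (lookup coset₇ j) x))))
leaf-classified = allClassified-sound coset₁ coset₂ coset₃ coset₄ coset₅ coset₆ coset₇ reps patterns allClassifiedOk

isClassified-sound : ∀ code g → T (isClassified coset₁ coset₂ coset₃ coset₄ coset₅ coset₆ coset₇ reps code g) →
  (h : Aut) → (∀ x → to h x ≡ g x) → Classified h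
isClassified-sound code g t h h≡g = class , k , inClass inverted t
  where
  open Leaf code
  open Transversal
  _⟨_⟩ : ∀ {n} → Vec Table n → Fin n → Fin 24 → Fin 24
  (c ⟨ i ⟩) x = lookup (lookup c i) x
  k : Aut
  k = element tr₁ (digit 0F) ∙ (element tr₂ (digit 1F) ∙ (element tr₃ (digit 2F) ∙ (element tr₄ (digit 3F) ∙
      (element tr₅ (digit 4F) ∙ (element tr₆ (digit 5F) ∙ element tr₇ (digit 6F))))))
  k′ : Fin 24 → Fin 24
  k′ x = (coset₁ ⟨ digit 0F ⟩) ((coset₂ ⟨ digit 1F ⟩) ((coset₃ ⟨ digit 2F ⟩) ((coset₄ ⟨ digit 3F ⟩)
      ((coset₅ ⟨ digit 4F ⟩) ((coset₆ ⟨ digit 5F ⟩) ((coset₇ ⟨ digit 6F ⟩) x))))))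
  k≡ : ∀ x → to k x ≡ k′ x
  k≡ x = trans (table≡ tr₁ (digit 0F) _) (cong (coset₁ ⟨ digit 0F ⟩)
    (trans (table≡ tr₂ (digit 1F) _) (cong (coset₂ ⟨ digit 1F ⟩)
    (trans (table≡ tr₃ (digit 2F) _) (cong (coset₃ ⟨ digit 2F ⟩)
    (trans (table≡ tr₄ (digit 3F) _) (cong (coset₄ ⟨ digit 3F ⟩)
    (trans (table≡ tr₅ (digit 4F) _) (cong (coset₅ ⟨ digit 4F ⟩)
    (trans (table≡ tr₆ (digit 5F) _) (cong (coset₆ ⟨ digit 5F ⟩)
    (table≡ tr₇ (digit 6F) x))))))))))))
  inClass : ∀ inv → T (if inv then allᵇ (λ x → g (k′ (rep class x)) =ᶠ k′ x) else allᵇ (λ x → g (k′ x) =ᶠ k′ (rep class x))) →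
            InClass class (to k) (to h)
  inClass true  t = inj₂ λ x → trans (h≡g _) (trans (cong g (k≡ (rep class x)))
    (trans (=ᶠ-sound (allᵇ-sound (λ x → g (k′ (rep class x)) =ᶠ k′ x) t x)) (sym (k≡ x))))
  inClass false t = inj₁ λ x → trans (h≡g _) (trans (cong g (k≡ x))
    (trans (=ᶠ-sound (allᵇ-sound (λ x → g (k′ x) =ᶠ k′ (rep class x)) t x)) (sym (k≡ (rep class x)))))

-- The pointwise stabiliser of five points

FixesAll : ∀ {n} → Vec (Fin 24) n → Aut → Set
FixesAll xs g = ∀ i → to g (lookup xs i) ≡ lookup xs i

fixes-member : ∀ {n} (xs : Vec (Fin 24) n) g → FixesAll xs g → ∀ i → T (member xs i) → to g i ≡ i
fixes-member xs g fixes i t with anyᵇ-sound (λ j → lookup xs j =ᶠ i) t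
... | j , e = trans (cong (to g) (sym (=ᶠ-sound e))) (trans (fixes j) (=ᶠ-sound e))

fixes-snoc : ∀ {n} (xs : Vec (Fin 24) n) x g → FixesAll xs g → to g x ≡ x → FixesAll (xs Vec.∷ʳ x) g
fixes-snoc []       x g fixes e Fin.zero    = e
fixes-snoc (y ∷ xs) x g fixes e Fin.zero    = fixes Fin.zero
fixes-snoc (y ∷ xs) x g fixes e (Fin.suc i) = fixes-snoc xs x g (fixes ∘ Fin.suc) e i

fixes-init : ∀ {n} (xs : Vec (Fin 24) n) x g → FixesAll (xs Vec.∷ʳ x) g → FixesAll xs g
fixes-init (y ∷ xs) x g fixes Fin.zero    = fixes Fin.zero
fixes-init (y ∷ xs) x g fixes (Fin.suc i) = fixes-init xs x g (fixes ∘ Fin.suc) i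

quotient-fixes : ∀ {n} (xs : Vec (Fin 24) n) k g → FixesAll xs k → FixesAll xs g → FixesAll xs (inverse k ∙ g)
quotient-fixes xs k g fk fg i = trans (cong (from k) (trans (fg i) (sym (fk i)))) (from-to k (lookup xs i))

-- Distinct octads meet in at most four points, so an octad other than `baseOctad` with five points
-- in the base contains b₇ and meets `baseOctad` in exactly four points, all from the base. It
-- therefore misses 10 and 12, the last two points of `baseOctad`, which have to wait for a second
-- round with more points known to be fixed.
fixes-most : ∀ g → FixesAll first₇ g → ∀ x → T (outside (# 10 ∷ # 12 ∷ []) x) → to g x ≡ x
fixes-most g fixes = separates-sound (member first₇) (outside (# 10 ∷ # 12 ∷ []))
  ( 000000000010100100111110 ∷ 100000001000000110110011 ∷ 000011000000001000110111 ∷ 000001000000000111101101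
  ∷ 000100010000100010100111 ∷ 100000100100000000101111 ∷ 001000000110000010110101 ∷ 100010010000000010111100
  ∷ 000000000001010010011111 ∷ [])
  tt g (fixes-member first₇ g fixes)

fixes-base⇒id : ∀ g → FixesAll first₇ g → ∀ x → to g x ≡ x
fixes-base⇒id g fixes x with member-or-not (# 10 ∷ # 12 ∷ []) x
... | inj₂ x∉rest = fixes-most g fixes x x∉rest
... | inj₁ (i , refl) = separates-sound (outside (# 10 ∷ # 12 ∷ [])) (member (# 10 ∷ # 12 ∷ []))
  (000000000001010010011111 ∷ 100000110001110101000000 ∷ 100000000000110001110101 ∷ [])
  tt g (fixes-most g fixes) (lookup (# 10 ∷ # 12 ∷ []) i) (rest i)
  where
  rest : ∀ i → T (member (# 10 ∷ # 12 ∷ []) (lookup (# 10 ∷ # 12 ∷ []) i))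
  rest 0F = tt
  rest 1F = tt

quotient-id : ∀ h r s → (∀ x → to (inverse s ∙ (inverse r ∙ h)) x ≡ x) → ∀ x → to h x ≡ to r (to s x)
quotient-id h r s e x = trans (sym (to-from r (to h x)))
  (cong (to r) (trans (sym (to-from s (from r (to h x)))) (cong (to s) (e x))))

-- Sifting: h preserves the octad through the five points, so b₆ goes to one of its three other
-- points, and dividing by an element of the transversal makes b₆ fixed. Now b₇ stays outside the
-- octad and is treated in the same way, after which seven points are fixed and the quotient is the
-- identity.
stabiliser₅ : ∀ h → FixesAll first₅ h → Σ (Fin 3) λ i → Σ (Fin 16) λ j →
  ∀ x → to h x ≡ to (Transversal.element tr₆ i) (to (Transversal.element tr₇ j) x)
stabiliser₅ h fixes = i , j , quotient-id h r s (fixes-base⇒id h₂ fixes₂)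
  where
  open Transversal
  octad : ∀ h → FixesAll first₅ h → ∀ x → baseOctad (to h x) ≡ baseOctad x
  octad h fixes = isStable-sound (member first₅) baseOctad tt h (fixes-member first₅ h fixes)
  outside₅ : T (outside first₅ (to h b₆))
  outside₅ with member-or-not first₅ (to h b₆)
  ... | inj₂ t = t
  ... | inj₁ (i , e) = ⊥-elim (notBase i (injective h (trans (fixes i) e)))
    where
    notBase : ∀ i → lookup first₅ i ≢ b₆
    notBase i e with trans (cong toℕ e) refl
    notBase 0F e | ()
    notBase 1F e | ()
    notBase 2F e | ()
    notBase 3F e | ()
    notBase 4F e | ()
  valid₆ : T (baseOctad (to h b₆) ∧ outside first₅ (to h b₆))
  valid₆ = subst (λ b → T (b ∧ outside first₅ (to h b₆))) (sym (octad h fixes b₆)) outside₅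
  i : Fin 3
  i = proj₁ (reach tr₆ (to h b₆) valid₆)
  r h₁ : Aut
  r = element tr₆ i
  h₁ = inverse r ∙ h
  fixes₁ : FixesAll first₆ h₁
  fixes₁ = fixes-snoc first₅ b₆ h₁ (quotient-fixes first₅ r h (proj₂ (proj₂ (reach tr₆ (to h b₆) valid₆))) fixes)
    (trans (cong (from r) (sym (proj₁ (proj₂ (reach tr₆ (to h b₆) valid₆))))) (from-to r b₆))
  valid₇ : T (not (baseOctad (to h₁ b₇)))
  valid₇ = subst (T ∘ not) (sym (octad h₁ (fixes-init first₅ b₆ h₁ fixes₁) b₇)) tt
  j : Fin 16
  j = proj₁ (reach tr₇ (to h₁ b₇) valid₇)
  s h₂ : Aut
  s = element tr₇ j
  h₂ = inverse s ∙ h₁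
  fixes₂ : FixesAll first₇ h₂
  fixes₂ = fixes-snoc first₆ b₇ h₂ (quotient-fixes first₆ s h₁ (proj₂ (proj₂ (reach tr₇ (to h₁ b₇) valid₇))) fixes₁)
    (trans (cong (from s) (sym (proj₁ (proj₂ (reach tr₇ (to h₁ b₇) valid₇))))) (from-to s b₇))

Maps : Vec (Fin 24) 5 → Aut → Set
Maps ys g = ∀ i → to g (lookup first₅ i) ≡ lookup ys i

hasImages : Fin 12 → Vec (Fin 24) 5 → Bool
hasImages p ys = allᵇ (λ i → lookup (lookup patterns p) (lookup first₅ i) =ᶠ lookup ys i)

-- g and the pattern's element agree on five points, so they differ by one of the 48 elements fixing
-- these, and the product is in the table of conjugators.
pattern-classified : ∀ p ys → T (hasImages p ys) → ∀ g → Maps ys g → Classified g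
pattern-classified p ys t g maps = isClassified-sound (leafCode p i j) leaf (leaf-classified p i j) g g≡leaf
  where
  s h : Aut
  s = patternAut p
  h = inverse s ∙ g
  fixes : FixesAll first₅ h
  fixes i = trans (cong (from s) (trans (maps i) (sym (trans (pattern≡ p (lookup first₅ i))
    (=ᶠ-sound (allᵇ-sound (λ i → lookup (lookup patterns p) (lookup first₅ i) =ᶠ lookup ys i) t i)))))) (from-to s (lookup first₅ i))
  i : Fin 3
  i = proj₁ (stabiliser₅ h fixes)
  j : Fin 16
  j = proj₁ (proj₂ (stabiliser₅ h fixes))
  leaf : Fin 24 → Fin 24
  leaf x = lookup (lookup patterns p) (lookup (lookup coset₆ i) (lookup (lookup coset₇ j) x))
  g≡leaf : ∀ x → to g x ≡ leaf x
  g≡leaf x = trans (sym (to-from s (to g x))) (trans (cong (to s) (trans (proj₂ (proj₂ (stabiliser₅ h fixes)) x)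
    (trans (Transversal.table≡ tr₆ i (to (Transversal.element tr₇ j) x)) (cong (lookup (lookup coset₆ i)) (Transversal.table≡ tr₇ j x)))))
    (pattern≡ p (lookup (lookup coset₆ i) (lookup (lookup coset₇ j) x))))

-- Four of the images of b₁, …, b₅ are among these points, given by their indices q; m is the fifth index.
-- The image of b₅ is then b_m, or can be moved to b₆ or b₇.
module _ (q : Vec (Fin 5) 4) (m : Fin 5) (p p₆ p₇ : Fin 12)
  (cover : T (allᵇ (λ i → not (not (i =ᶠ m)) ∨ anyᵇ (λ j → lookup q j =ᶠ i)))) where

  images : Fin 24 → Vec (Fin 24) 5
  images y = Vec.map (lookup first₅) q Vec.∷ʳ y

  maps-snoc : ∀ g y → (∀ j → to g (lookup first₅ (Fin.inject₁ j)) ≡ lookup first₅ (lookup q j)) → to g b₅ ≡ y → Maps (images y) g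
  maps-snoc g y four five i = go i
    where
    entry : ∀ j → lookup (images y) (Fin.inject₁ j) ≡ lookup first₅ (lookup q j)
    entry = entry′ q
      where
      entry′ : ∀ {n} (q : Vec (Fin 5) n) j → lookup (Vec.map (lookup first₅) q Vec.∷ʳ y) (Fin.inject₁ j) ≡ lookup first₅ (lookup q j)
      entry′ (x ∷ q) Fin.zero    = refl
      entry′ (x ∷ q) (Fin.suc j) = entry′ q j
    last : ∀ {n} (q : Vec (Fin 24) n) → lookup (q Vec.∷ʳ y) (Fin.fromℕ n) ≡ y
    last []      = refl
    last (x ∷ q) = last q
    go : Maps (images y) g
    go 0F = trans (four 0F) (sym (entry 0F))
    go 1F = trans (four 1F) (sym (entry 1F))
    go 2F = trans (four 2F) (sym (entry 2F))
    go 3F = trans (four 3F) (sym (entry 3F))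
    go 4F = trans five (sym (last (Vec.map (lookup first₅) q)))

  five-points : T (hasImages p (images (lookup first₅ m))) → T (hasImages p₆ (images b₆)) → T (hasImages p₇ (images b₇)) →
    ∀ g → (∀ j → to g (lookup first₅ (Fin.inject₁ j)) ≡ lookup first₅ (lookup q j)) → Classified g
  five-points t t₆ t₇ g four = split (member-or-not first₅ (to g b₅))
    where
    notLast : ∀ j → lookup first₅ (Fin.inject₁ j) ≢ b₅
    notLast 0F ()
    notLast 1F ()
    notLast 2F ()
    notLast 3F ()
    old : ∀ i → lookup first₅ i ≡ to g b₅ → Dec (i ≡ m) → Classified g
    old i e (yes refl) = pattern-classified p (images (lookup first₅ m)) t g (maps-snoc g _ four (sym e))
    -- By `cover`, every index other than m is already taken by the image of one of b₁, ..., b₄,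
    -- against injectivity.
    old i e (no i≢m) = let (j , j≡) = anyᵇ-sound (λ j → lookup q j =ᶠ i)
                                        (T-imp (allᵇ-sound (λ i → not (not (i =ᶠ m)) ∨ anyᵇ (λ j → lookup q j =ᶠ i)) cover i) (T-≢ i≢m)) in
      ⊥-elim (notLast j (injective g (trans (four j) (trans (cong (lookup first₅) (=ᶠ-sound {i = lookup q j} {i} j≡)) e))))
    -- As k fixes all five points, conjugating by it keeps the four known images and renames only
    -- the image of b₅.
    moved : ∀ p′ y → T (hasImages p′ (images y)) → (k : Aut) → FixesAll first₅ k → to k y ≡ to g b₅ → Classified g
    moved p′ y t′ k fix e = classified-conjugate k g (pattern-classified p′ (images y) t′ (conjugate k g)
      (maps-snoc (conjugate k g) y (λ j → conjugate-image k g (fix (Fin.inject₁ j)) (fix (lookup q j)) (four j))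
        (conjugate-image k g (fix 4F) e refl)))
    new : T (outside first₅ (to g b₅)) → ∀ b → baseOctad (to g b₅) ≡ b → Classified g
    new out true  eq = let (i , e , fix) = Transversal.reach tr₆ (to g b₅) (subst (λ b → T (b ∧ outside first₅ (to g b₅))) (sym eq) out) in
      moved p₆ b₆ t₆ (Transversal.element tr₆ i) fix e
    new out false eq = let (j , e , fix) = Transversal.reach tr₇ (to g b₅) (subst (T ∘ not) (sym eq) tt) in
      moved p₇ b₇ t₇ (Transversal.element tr₇ j) (fixes-init first₅ b₆ (Transversal.element tr₇ j) fix) e
    split : (∃[ i ] lookup first₅ i ≡ to g b₅) ⊎ T (outside first₅ (to g b₅)) → Classified g
    split (inj₁ (i , e)) = old i e (i Fin.≟ m)
    split (inj₂ out)     = new out (baseOctad (to g b₅)) refl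

-- Following the orbit of a moved point

distinct : ∀ {x y : Fin 24} → T (not (x =ᶠ y)) → x ≢ y
distinct {x} t refl = subst (T ∘ not) (T⇒≡ (=ᶠ-complete {i = x} refl)) t

-- The orbit of b₂ has closed up, so b₄ is followed next: b₁, b₂, b₃ are already images, hence b₄ is
-- fixed or goes to a new point, which is renamed b₅.
cycle₂-classified : ∀ g → to g b₁ ≡ b₁ → to g b₂ ≡ b₃ → to g b₃ ≡ b₂ → Classified g
cycle₂-classified g e₁ e₂ e₃ = go (member-or-not (b₁ ∷ b₂ ∷ b₃ ∷ b₄ ∷ []) (to g b₄))
  where
  go : (∃[ i ] lookup (b₁ ∷ b₂ ∷ b₃ ∷ b₄ ∷ []) i ≡ to g b₄) ⊎ T (outside (b₁ ∷ b₂ ∷ b₃ ∷ b₄ ∷ []) (to g b₄)) → Classified g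
  go (inj₁ (0F , e)) = ⊥-elim (distinct {b₁} {b₄} tt (injective g (trans e₁ e)))
  go (inj₁ (1F , e)) = ⊥-elim (distinct {b₃} {b₄} tt (injective g (trans e₃ e)))
  go (inj₁ (2F , e)) = ⊥-elim (distinct {b₂} {b₄} tt (injective g (trans e₂ e)))
  go (inj₁ (3F , e)) = five-points (0F ∷ 2F ∷ 1F ∷ 3F ∷ []) 4F (# 9) (# 10) (# 11) tt tt tt tt g four
    where
    four : ∀ j → to g (lookup first₅ (Fin.inject₁ j)) ≡ lookup first₅ (lookup (0F ∷ 2F ∷ 1F ∷ 3F ∷ []) j)
    four 0F = e₁
    four 1F = e₂
    four 2F = e₃
    four 3F = sym e
  go (inj₂ new) = classified-conjugate k g (five-points (0F ∷ 2F ∷ 1F ∷ 4F ∷ []) 3F (# 6) (# 7) (# 8) tt tt tt tt (conjugate k g) four)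
    where
    r = Transversal.reach tr₅ (to g b₄) new
    k = Transversal.element tr₅ (proj₁ r)
    fix = proj₂ (proj₂ r)
    four : ∀ j → to (conjugate k g) (lookup first₅ (Fin.inject₁ j)) ≡ lookup first₅ (lookup (0F ∷ 2F ∷ 1F ∷ 4F ∷ []) j)
    four 0F = conjugate-image k g (fix 0F) (fix 0F) e₁
    four 1F = conjugate-image k g (fix 1F) (fix 2F) e₂
    four 2F = conjugate-image k g (fix 2F) (fix 1F) e₃
    four 3F = conjugate-image k g (fix 3F) (proj₁ (proj₂ r)) refl

-- Among the first four points only b₂ is still free as the image of b₄, closing a 3-cycle;
-- otherwise the image is new and renamed b₅.
path₃-classified : ∀ g → to g b₁ ≡ b₁ → to g b₂ ≡ b₃ → to g b₃ ≡ b₄ → Classified g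
path₃-classified g e₁ e₂ e₃ = go (member-or-not (b₁ ∷ b₂ ∷ b₃ ∷ b₄ ∷ []) (to g b₄))
  where
  go : (∃[ i ] lookup (b₁ ∷ b₂ ∷ b₃ ∷ b₄ ∷ []) i ≡ to g b₄) ⊎ T (outside (b₁ ∷ b₂ ∷ b₃ ∷ b₄ ∷ []) (to g b₄)) → Classified g
  go (inj₁ (0F , e)) = ⊥-elim (distinct {b₁} {b₄} tt (injective g (trans e₁ e)))
  go (inj₁ (2F , e)) = ⊥-elim (distinct {b₂} {b₄} tt (injective g (trans e₂ e)))
  go (inj₁ (3F , e)) = ⊥-elim (distinct {b₃} {b₄} tt (injective g (trans e₃ e)))
  go (inj₁ (1F , e)) = five-points (0F ∷ 2F ∷ 3F ∷ 1F ∷ []) 4F (# 3) (# 4) (# 5) tt tt tt tt g four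
    where
    four : ∀ j → to g (lookup first₅ (Fin.inject₁ j)) ≡ lookup first₅ (lookup (0F ∷ 2F ∷ 3F ∷ 1F ∷ []) j)
    four 0F = e₁
    four 1F = e₂
    four 2F = e₃
    four 3F = sym e
  go (inj₂ new) = classified-conjugate k g (five-points (0F ∷ 2F ∷ 3F ∷ 4F ∷ []) 1F (# 0) (# 1) (# 2) tt tt tt tt (conjugate k g) four)
    where
    r = Transversal.reach tr₅ (to g b₄) new
    k = Transversal.element tr₅ (proj₁ r)
    fix = proj₂ (proj₂ r)
    four : ∀ j → to (conjugate k g) (lookup first₅ (Fin.inject₁ j)) ≡ lookup first₅ (lookup (0F ∷ 2F ∷ 3F ∷ 4F ∷ []) j)
    four 0F = conjugate-image k g (fix 0F) (fix 0F) e₁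
    four 1F = conjugate-image k g (fix 1F) (fix 2F) e₂
    four 2F = conjugate-image k g (fix 2F) (fix 3F) e₃
    four 3F = conjugate-image k g (fix 3F) (proj₁ (proj₂ r)) refl

path₂-classified : ∀ g → to g b₁ ≡ b₁ → to g b₂ ≡ b₃ → Classified g
path₂-classified g e₁ e₂ = go (member-or-not (b₁ ∷ b₂ ∷ b₃ ∷ []) (to g b₃))
  where
  go : (∃[ i ] lookup (b₁ ∷ b₂ ∷ b₃ ∷ []) i ≡ to g b₃) ⊎ T (outside (b₁ ∷ b₂ ∷ b₃ ∷ []) (to g b₃)) → Classified g
  go (inj₁ (0F , e)) = ⊥-elim (distinct {b₁} {b₃} tt (injective g (trans e₁ e)))
  go (inj₁ (1F , e)) = cycle₂-classified g e₁ e₂ (sym e)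
  go (inj₁ (2F , e)) = ⊥-elim (distinct {b₂} {b₃} tt (injective g (trans e₂ e)))
  go (inj₂ new) = classified-conjugate k g (path₃-classified (conjugate k g) (conjugate-image k g (fix 0F) (fix 0F) e₁)
          (conjugate-image k g (fix 1F) (fix 2F) e₂) (conjugate-image k g (fix 2F) (proj₁ (proj₂ r)) refl))
    where
    r = Transversal.reach tr₄ (to g b₃) new
    k = Transversal.element tr₄ (proj₁ r)
    fix = proj₂ (proj₂ r)

path₁-classified : ∀ g → to g b₁ ≡ b₁ → to g b₂ ≢ b₂ → Classified g
path₁-classified g e₁ moved = go (member-or-not (b₁ ∷ b₂ ∷ []) (to g b₂))
  where
  go : (∃[ i ] lookup (b₁ ∷ b₂ ∷ []) i ≡ to g b₂) ⊎ T (outside (b₁ ∷ b₂ ∷ []) (to g b₂)) → Classified g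
  go (inj₁ (0F , e)) = ⊥-elim (distinct {b₁} {b₂} tt (injective g (trans e₁ e)))
  go (inj₁ (1F , e)) = ⊥-elim (moved (sym e))
  go (inj₂ new) = classified-conjugate k g (path₂-classified (conjugate k g) (conjugate-image k g (fix 0F) (fix 0F) e₁)
          (conjugate-image k g (fix 1F) (proj₁ (proj₂ r)) refl))
    where
    r = Transversal.reach tr₃ (to g b₂) new
    k = Transversal.element tr₃ (proj₁ r)
    fix = proj₂ (proj₂ r)

fixed-classified : ∀ g a → to g b₁ ≡ b₁ → to g a ≢ a → Classified g
fixed-classified g a e₁ moved = go (member-or-not (b₁ ∷ []) (a))
  where
  go : (∃[ i ] lookup (b₁ ∷ []) i ≡ a) ⊎ T (outside (b₁ ∷ []) (a)) → Classified g
  go (inj₁ (0F , refl)) = ⊥-elim (moved e₁)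
  go (inj₂ new) = classified-conjugate k g (path₁-classified (conjugate k g) (conjugate-image k g (fix 0F) (fix 0F) e₁)
          λ e → moved (trans (sym (to-from k (to g a))) (trans (cong (λ x → to k (from k (to g x))) (sym (proj₁ (proj₂ r))))
            (trans (cong (to k) e) (proj₁ (proj₂ r))))))
    where
    r = Transversal.reach tr₂ a new
    k = Transversal.element tr₂ (proj₁ r)
    fix = proj₂ (proj₂ r)

-- The fixed point becomes b₁, the moved point b₂, and each new image along the orbit the next base
-- point. The renaming element is always taken from the stabiliser of the points already placed, so
-- earlier arrows persist.
classify : ∀ g i₀ a → to g i₀ ≡ i₀ → to g a ≢ a → Classified g
classify g i₀ a e₀ moved = classified-conjugate k g (fixed-classified (conjugate k g) (from k a)
    (conjugate-image k g (proj₁ (proj₂ r)) (proj₁ (proj₂ r)) e₀)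
    λ e → moved (trans (sym (to-from k (to g a))) (trans (cong (λ x → to k (from k (to g x))) (sym (to-from k a)))
      (trans (cong (to k) e) (to-from k a)))))
  where
  r = Transversal.reach tr₁ i₀ tt
  k = Transversal.element tr₁ (proj₁ r)

-- Fixed lattices

Fixed : (Fin 24 → Fin 24) → Lattice
Fixed f x = Leech x × (∀ i → x (f i) ≡ x i)

fixed-cong : ∀ f {x y} → x ≈ y → Fixed f y → Fixed f x
fixed-cong f e ((z , y≡ , z∈Λ) , inv) = (z , (λ i → trans (e i) (y≡ i)) , z∈Λ) , λ i → trans (e (f i)) (trans (inv i) (sym (e i)))

·-permute : ∀ (k : Aut) x y → (λ i → x (to k i)) · (λ i → y (to k i)) ≡ x · y
·-permute k x y = cong (ℚ._* eighth) (QΣ.Σ-permute (λ i → x i ℚ.* y i) (perm k))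

leech-∘ : ∀ (k : Aut) x → Leech x → Leech (λ i → x (to k i))
leech-∘ k x (z , x≡ , z∈Λ) = (λ i → z (to k i)) , (λ i → x≡ (to k i)) , Leechℤ.leech-permute {z} (perm k) (λ {w} → closed k w) z∈Λ

iterate : (Fin 24 → Fin 24) → ℕ → Fin 24 → Fin 24
iterate h zero    i = i
iterate h (suc n) i = h (iterate h n i)

iterate-comm : ∀ h n i → iterate h n (h i) ≡ h (iterate h n i)
iterate-comm h zero    i = refl
iterate-comm h (suc n) i = cong h (iterate-comm h n i)

-- Composition with k is an isometry of the Leech lattice that exchanges the two fixed lattices;
-- `pre` inverts the representative, as the inverted case demands.
module _ (c : Fin 11) (pre : Fin 24 → Fin 24) (pre≡ : ∀ i → rep c (pre i) ≡ i) (k : Aut) (f : Fin 24 → Fin 24)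
  (inClass : InClass c (to k) f) where

  pull : ∀ x → Fixed f x → Fixed (rep c) (λ i → x (to k i))
  pull x (x∈Λ , inv) = leech-∘ k x x∈Λ , invariant inClass
    where
    invariant : InClass c (to k) f → ∀ i → x (to k (rep c i)) ≡ x (to k i)
    invariant (inj₁ e) i = trans (cong x (sym (e i))) (inv (to k i))
    invariant (inj₂ e) i = trans (sym (inv (to k (rep c i)))) (cong x (e i))

  push : ∀ y → Fixed (rep c) y → Fixed f (λ i → y (from k i))
  push y (y∈Λ , inv) = leech-∘ (inverse k) y y∈Λ , λ i → trans
      (cong (λ p → y (from k (f p))) (sym (to-from k i))) (invariant inClass (from k i))
    where
    invariant : InClass c (to k) f → ∀ j → y (from k (f (to k j))) ≡ y j
    invariant (inj₁ e) j = trans (cong (y ∘ from k) (e j)) (trans (cong y (from-to k (rep c j))) (inv j))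
    invariant (inj₂ e) j = begin
      -- Here only f k r = k is known, so j is first written as the image of a point under the
      -- representative.
      y (from k (f (to k j)))               ≡⟨ cong (λ p → y (from k (f (to k p)))) (pre≡ j) ⟨
      y (from k (f (to k (rep c (pre j))))) ≡⟨ cong (y ∘ from k) (e (pre j)) ⟩
      y (from k (to k (pre j)))             ≡⟨ cong y (from-to k (pre j)) ⟩
      y (pre j)                             ≡⟨ inv (pre j) ⟨
      y (rep c (pre j))                     ≡⟨ cong y (pre≡ j) ⟩
      y j                                   ∎
      where open ≡-Reasoning

  transport : ∀ {D} {G : Mat D D} → Basis (Fixed (rep c)) D G → Basis (Fixed f) D G
  transport basis = record
    { F = λ j i → F j (from k i)
    ; gram = λ i j → trans (·-permute (inverse k) (F i) (F j)) (gram i j)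
    ; span⇒ = λ {x} x∈Λ → proj₁ (span⇒ (pull x x∈Λ)) ,
        λ i → trans (cong x (sym (to-from k i))) (proj₂ (span⇒ (pull x x∈Λ)) (from k i))
    ; span⇐ = λ z x≈ → fixed-cong f x≈ (push (linComb (ι ∘ z) F) (span⇐ z (λ i → refl))) }
    where open Basis basis

  -- Conjugacy up to inversion passes to powers, so f and the representative have the same order.
  iterate-inClass : ∀ n → (∀ i → iterate f n (to k i) ≡ to k (iterate (rep c) n i)) ⊎
                          (∀ i → iterate f n (to k (iterate (rep c) n i)) ≡ to k i)
  iterate-inClass n = go inClass
    where
    go : InClass c (to k) f → (∀ i → iterate f n (to k i) ≡ to k (iterate (rep c) n i)) ⊎
                              (∀ i → iterate f n (to k (iterate (rep c) n i)) ≡ to k i)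
    go (inj₁ e) = inj₁ (same n)
      where
      same : ∀ n i → iterate f n (to k i) ≡ to k (iterate (rep c) n i)
      same zero    i = refl
      same (suc n) i = trans (cong f (same n i)) (e (iterate (rep c) n i))
    go (inj₂ e) = inj₂ (opposite n)
      where
      opposite : ∀ n i → iterate f n (to k (iterate (rep c) n i)) ≡ to k i
      opposite zero    i = refl
      opposite (suc n) i = trans (sym (iterate-comm f n (to k (rep c (iterate (rep c) n i)))))
        (trans (cong (iterate f n) (e (iterate (rep c) n i))) (opposite n i))

  iterate-id⇒ : ∀ n → IsIdentity (iterate f n) → IsIdentity (iterate (rep c) n)
  iterate-id⇒ n id-f i with iterate-inClass n
  ... | inj₁ e = injective k (trans (sym (e i)) (id-f (to k i)))
  ... | inj₂ e = injective k (trans (sym (id-f (to k (iterate (rep c) n i)))) (e i))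

  iterate-id⇐ : ∀ n → IsIdentity (iterate (rep c) n) → IsIdentity (iterate f n)
  iterate-id⇐ n id-r i with iterate-inClass n
  ... | inj₁ e = trans (cong (iterate f n) (sym (to-from k i))) (trans (e (from k i)) (trans (cong (to k) (id-r (from k i))) (to-from k i)))
  ... | inj₂ e = trans (cong (iterate f n) (trans (sym (to-from k i)) (cong (to k) (sym (id-r (from k i)))))) (trans (e (from k i)) (to-from k i))

-- Certificates for the fixed lattices of the representatives

_=ᶻ_ : ℤ → ℤ → Bool
(+ a)      =ᶻ (+ b)      = a ℕ.≡ᵇ b
-[1+ a ]   =ᶻ -[1+ b ]   = a ℕ.≡ᵇ b
(+ _)      =ᶻ -[1+ _ ]   = false
-[1+ _ ]   =ᶻ (+ _)      = false

=ᶻ-sound : ∀ a b → T (a =ᶻ b) → a ≡ b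
=ᶻ-sound (+ a)    (+ b)    t = cong +_ (ℕ.≡ᵇ⇒≡ a b t)
=ᶻ-sound -[1+ a ] -[1+ b ] t = cong -[1+_] (ℕ.≡ᵇ⇒≡ a b t)

_=ᴹ_ : ∀ {m n} → Mat m n → Mat m n → Bool
A =ᴹ B = allᵇ (λ i → allᵇ (λ j → A i j =ᶻ B i j))

=ᴹ-sound : ∀ {m n} (A B : Mat m n) → T (A =ᴹ B) → ∀ i j → A i j ≡ B i j
=ᴹ-sound A B t i j = =ᶻ-sound (A i j) (B i j) (allᵇ-sound (λ j → A i j =ᶻ B i j) (allᵇ-sound (λ i → allᵇ (λ j → A i j =ᶻ B i j)) t i) j)

ITable : ℕ → ℕ → Set
ITable m n = Vec (Vec ℤ n) m

entry : ∀ {m n} → ITable m n → Mat m n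
entry t i j = lookup (lookup t i) j

tabulateᴹ : ∀ {m n} → Mat m n → ITable m n
tabulateᴹ A = tabulate (λ i → tabulate (A i))

entry-tabulateᴹ : ∀ {m n} (A : Mat m n) i j → entry (tabulateᴹ A) i j ≡ A i j
entry-tabulateᴹ A i j = trans (cong (λ v → lookup v j) (Vec.lookup∘tabulate (λ i → tabulate (A i)) i)) (Vec.lookup∘tabulate (A i) j)

decodeℤ : ∀ m n → ℕ → ITable m n
decodeℤ m n k = Vec.map (λ row → Vec.map (λ x → x ℤ.⊖ 50) (decode 100 n row)) (decode (100 ℕ.^ n) {{ℕ.m^n≢0 100 n}} m k)

-- By `Leechℤ.glue`, a single codeword test replaces the four residue classes modulo 4.
leechWith : Bool → Vec ℤ 24 → Bool
leechWith m v = allᵇ (λ i → (lookup v i ℤ.% + 2) ℕ.≡ᵇ bit m) ∧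
  (isWord (λ i → (lookup v i ℤ.% + 4) ℕ.≡ᵇ (2 ℕ.+ bit m)) ∧ (Σℤ (lookup v) ℤ.% + 8 ℕ.≡ᵇ 4 * bit m))

isLeech : Vec ℤ 24 → Bool
isLeech v = leechWith false v ∨ leechWith true v

leechWith-sound : ∀ m v → T (leechWith m v) → LeechInt (lookup v)
leechWith-sound m v t = Leechℤ.glue⇒leech (Leechℤ.glue (lookup v) m
  (λ i → ℕ.≡ᵇ⇒≡ _ _ (allᵇ-sound (λ i → (lookup v i ℤ.% + 2) ℕ.≡ᵇ bit m) (T-∧ˡ t) i))
  (isWord-sound (λ i → (lookup v i ℤ.% + 4) ℕ.≡ᵇ (2 ℕ.+ bit m)) (T-∧ˡ t′))
  (ℕ.≡ᵇ⇒≡ _ _ (T-∧ʳ {isWord (λ i → (lookup v i ℤ.% + 4) ℕ.≡ᵇ (2 ℕ.+ bit m))} t′)))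
  where
  t′ = T-∧ʳ {allᵇ (λ i → (lookup v i ℤ.% + 2) ℕ.≡ᵇ bit m)} t

isLeech-sound : ∀ v → T (isLeech v) → LeechInt (lookup v)
isLeech-sound v t = go (leechWith false v) refl
  where
  go : ∀ b → leechWith false v ≡ b → LeechInt (lookup v)
  go true  e = leechWith-sound false v (≡⇒T e)
  go false e = leechWith-sound true v (subst (λ b → T (b ∨ leechWith true v)) e t)

-- M holds the sums of L over the fibres of r. That Fᵗ M is 8 on indicators of fibres says that inner products with
-- L, divided by 8, are coordinates with respect to F.
reconstruct : ∀ {m n} (F L M : Mat m n) (r : Fin n → Fin n) → (∀ j p → M j p ≡ (L ✶ (λ k p → ZΣ.indicator (r k) p)) j p) →
  (∀ i p → (F ᵗ ✶ M) i p ≡ + 8 ℤ.* ZΣ.indicator (r i) p) → ∀ (z : Fin n → ℤ) → (∀ k → z (r k) ≡ z k) →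
  ∀ (c : Fin m → ℤ) → (∀ j → Σℤ (λ k → L j k ℤ.* z k) ≡ + 8 ℤ.* c j) → ∀ i → z i ≡ Σℤ (λ j → c j ℤ.* F j i)
reconstruct {m} {n} F L M r M≡ FM≡ z z-inv c Lz≡ i = ℤ.*-cancelˡ-≡ (+ 8) (z i) (Σℤ (λ j → c j ℤ.* F j i)) (begin
  + 8 ℤ.* z i                                        ≡⟨ cong (ℤ._*_ (+ 8)) (sym (restrict i)) ⟩
  + 8 ℤ.* Σℤ (λ p → ZΣ.indicator (r i) p ℤ.* z p)    ≡⟨ ZΣ.Σ-*ˡ (+ 8) (λ p → ZΣ.indicator (r i) p ℤ.* z p) ⟨
  Σℤ (λ p → + 8 ℤ.* (ZΣ.indicator (r i) p ℤ.* z p))  ≡⟨ ZΣ.Σ-cong (λ p → trans (sym (ℤ.*-assoc (+ 8) (ZΣ.indicator (r i) p) (z p)))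
                                                          (cong (λ x → x ℤ.* z p) (sym (FM≡ i p)))) ⟩
  Σℤ (λ p → (F ᵗ ✶ M) i p ℤ.* z p)                   ≡⟨ ZΣ.Σ-assoc (λ j → F j i) M z ⟨
  Σℤ (λ j → F j i ℤ.* Σℤ (λ p → M j p ℤ.* z p))      ≡⟨ ZΣ.Σ-cong (λ j → cong (ℤ._*_ (F j i)) (trans (Mz j) (Lz≡ j))) ⟩
  Σℤ (λ j → F j i ℤ.* (+ 8 ℤ.* c j))                 ≡⟨ ZΣ.Σ-cong (λ j → lemma (F j i) (c j)) ⟩
  Σℤ (λ j → + 8 ℤ.* (c j ℤ.* F j i))                 ≡⟨ ZΣ.Σ-*ˡ (+ 8) (λ j → c j ℤ.* F j i) ⟩
  + 8 ℤ.* Σℤ (λ j → c j ℤ.* F j i)                   ∎)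
  where
  open ≡-Reasoning
  lemma : ∀ f c → f ℤ.* (+ 8 ℤ.* c) ≡ + 8 ℤ.* (c ℤ.* f)
  lemma = solve-∀
  restrict : ∀ i → Σℤ (λ p → ZΣ.indicator (r i) p ℤ.* z p) ≡ z i
  restrict i = trans (ZΣ.Σ-indicator (r i) z) (z-inv i)
  Mz : ∀ j → Σℤ (λ p → M j p ℤ.* z p) ≡ Σℤ (λ k → L j k ℤ.* z k)
  Mz j = trans (ZΣ.Σ-cong (λ p → cong (λ x → x ℤ.* z p) (M≡ j p)))
    (trans (sym (ZΣ.Σ-assoc (L j) (λ k p → ZΣ.indicator (r k) p) z))
      (ZΣ.Σ-cong (λ k → cong (ℤ._*_ (L j k)) (restrict k))))

ι-pair : ∀ {n} (a b : Fin n → ℤ) → pair (ι ∘ a) (ι ∘ b) ≡ ι (Σℤ (λ i → a i ℤ.* b i))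
ι-pair a b = sym (trans (ι-Σ (λ i → a i ℤ.* b i)) (QΣ.Σ-cong (λ i → ι-* (a i) (b i))))

ι-form : ∀ (a b : Fin 24 → ℤ) s → Σℤ (λ i → a i ℤ.* b i) ≡ + 8 ℤ.* s → (ι ∘ a) · (ι ∘ b) ≡ ι s
ι-form a b s e = trans (cong (ℚ._* eighth) (trans (ι-pair a b) (trans (cong ι e) (ι-* (+ 8) s))))
  (trans (ℚ.*-comm (ι (+ 8) ℚ.* ι s) eighth) (cancel-reciprocal 7 (ι s)))

-- Stored as a table, so that the sums are computed once before the product with Fᵗ.
fibreSums : ∀ {m} → Table → ITable m 24 → ITable m 24
fibreSums o L = tabulateᴹ (entry L ✶ (λ k p → ZΣ.indicator (lookup o k) p))

-- The table o chooses a point in the cycle of each i. The test exhibits i as an iterate of r at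
-- `o i`, which makes every invariant vector agree at `o i` and i.
orbitOk : ℕ → Table → Table → Bool
orbitOk n r o = allᵇ (λ i → anyᵇ {suc n} (λ e → iterate (lookup r) (toℕ e) (lookup o i) =ᶠ i))

basisOk : ∀ {D} → Table → Table → ITable D 24 → ITable D 24 → ITable D D → Bool
basisOk r o F L G =
  allᵇ (λ j → isLeech (lookup F j)) ∧ (allᵇ (λ j → isLeech (lookup L j)) ∧
  (((λ j i → entry F j (lookup r i)) =ᴹ entry F) ∧ (((entry F ✶ (entry F ᵗ)) =ᴹ (λ i j → + 8 ℤ.* entry G i j)) ∧
  inverseOn (fibreSums o L))))
  where
  inverseOn : ITable _ 24 → Bool
  inverseOn M = (entry F ᵗ ✶ entry M) =ᴹ (λ i p → + 8 ℤ.* ZΣ.indicator (lookup o i) p)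

iterate-invariant : ∀ {A : Set} (x : Fin 24 → A) f → (∀ i → x (f i) ≡ x i) → ∀ n i → x (iterate f n i) ≡ x i
iterate-invariant x f inv zero    i = refl
iterate-invariant x f inv (suc n) i = trans (inv (iterate f n i)) (iterate-invariant x f inv n i)

basisOk-sound : ∀ {D} n r o (F L : ITable D 24) (G : ITable D D) → T (orbitOk n r o) → T (basisOk r o F L G) →
                Basis (Fixed (lookup r)) D (entry G)
basisOk-sound {D} n r o F L G orbits t₁ = record
  { F = λ j i → ι (entry F j i)
  ; gram = λ i j → ι-form (entry F i) (entry F j) (entry G i j) (=ᴹ-sound (entry F ✶ (entry F ᵗ)) (λ i j → + 8 ℤ.* entry G i j) (T-∧ˡ t₄) i j)
  ; span⇒ = λ {x} → coordinates x
  ; span⇐ = combination }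
  where
  t₂ = T-∧ʳ {allᵇ (λ j → isLeech (lookup F j))} t₁
  t₃ = T-∧ʳ {allᵇ (λ j → isLeech (lookup L j))} t₂
  t₄ = T-∧ʳ {(λ j i → entry F j (lookup r i)) =ᴹ entry F} t₃
  t₅ = T-∧ʳ {(entry F ✶ (entry F ᵗ)) =ᴹ (λ i j → + 8 ℤ.* entry G i j)} t₄
  M : Mat D 24
  M = entry (fibreSums o L)
  M≡ : ∀ j p → M j p ≡ (entry L ✶ (λ k p → ZΣ.indicator (lookup o k) p)) j p
  M≡ = entry-tabulateᴹ (entry L ✶ (λ k p → ZΣ.indicator (lookup o k) p))
  orbit-const : ∀ {x : Vec24} → (∀ i → x (lookup r i) ≡ x i) → ∀ i → x (lookup o i) ≡ x i
  orbit-const {x} inv i = let (e , t) = anyᵇ-sound {suc n} (λ e → iterate (lookup r) (toℕ e) (lookup o i) =ᶠ i)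
                                (allᵇ-sound (λ i → anyᵇ {suc n} (λ e → iterate (lookup r) (toℕ e) (lookup o i) =ᶠ i)) orbits i) in
    trans (sym (iterate-invariant x (lookup r) inv (toℕ e) (lookup o i))) (cong x (=ᶠ-sound t))
  coordinates : ∀ x → Fixed (lookup r) x → Σ (Fin D → ℤ) λ c → x ≈ linComb (ι ∘ c) (λ j i → ι (entry F j i))
  coordinates x ((z , x≡ , z∈Λ) , inv) = c , λ i → trans (x≡ i) (trans
      (cong ι (reconstruct (entry F) (entry L) M (lookup o) M≡
        (=ᴹ-sound (entry F ᵗ ✶ M) (λ i p → + 8 ℤ.* ZΣ.indicator (lookup o i) p) t₅) z z-inv c (λ j → proj₂ (product j)) i))
      (sym (ι-pair c (λ j → entry F j i))))
    where
    -- Integrality of Leech inner products: the quotient q is the j-th coordinate of z in the basis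
    -- `F`.
    product : ∀ j → ∃[ q ] Σℤ (λ k → entry L j k ℤ.* z k) ≡ + 8 ℤ.* q
    product j = Leechℤ.leech-inner {entry L j} {z} (isLeech-sound (lookup L j) (allᵇ-sound (λ j → isLeech (lookup L j)) (T-∧ˡ t₂) j)) z∈Λ
    c : Fin D → ℤ
    c j = proj₁ (product j)
    z-inv : ∀ k → z (lookup o k) ≡ z k
    z-inv k = ι-injective (trans (sym (x≡ (lookup o k))) (trans (orbit-const {x} inv k) (x≡ k)))
  combination : ∀ {x} c → x ≈ linComb (ι ∘ c) (λ j i → ι (entry F j i)) → Fixed (lookup r) x
  combination {x} c x≈ = fixed-cong (lookup r) {x} {λ i → ι (z i)} (λ i → trans (x≈ i) (ι-pair c (λ j → entry F j i)))
    ((z , (λ i → refl) , Leechℤ.leech-Σ c (λ j → isLeech-sound (lookup F j) (allᵇ-sound (λ j → isLeech (lookup F j)) (T-∧ˡ t₁) j)))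
    , λ i → cong ι (ZΣ.Σ-cong (λ j → cong (ℤ._*_ (c j)) (=ᴹ-sound (λ j i → entry F j (lookup r i)) (entry F) (T-∧ˡ t₃) j i))))
    where
    z : Fin 24 → ℤ
    z i = Σℤ (λ j → c j ℤ.* entry F j i)

-- Certificates for modularities, order and level

similarOk : ∀ {D} → Mat D D → Mat D D → ℕ → Mat D D → Mat D D → Bool
similarOk G H m A U = ((A ✶ U) =ᴹ scalar (+ m)) ∧ (((U ✶ A) =ᴹ scalar (+ m)) ∧ (((A ᵗ ✶ G) =ᴹ (G ✶ U)) ∧
  (divisible (A ✶ H) ∧ divisible (G ✶ U))))
  where
  divisible : Mat _ _ → Bool
  divisible M = M =ᴹ (λ i j → + m ℤ.* (M i j ℤ./ℕ suc (ℕ.pred m)))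

similarOk-sound : ∀ {D} (G H : Mat D D) m A U → T (similarOk G H m A U) → Similar G H m
similarOk-sound G H m A U t₁ = record
  { A = A ; U = U ; X = quotient (A ✶ H) ; V = quotient (G ✶ U)
  ; AU = =ᴹ-sound (A ✶ U) (scalar (+ m)) (T-∧ˡ t₁)
  ; UA = =ᴹ-sound (U ✶ A) (scalar (+ m)) (T-∧ˡ t₂)
  ; AG = =ᴹ-sound (A ᵗ ✶ G) (G ✶ U) (T-∧ˡ t₃)
  ; AH = =ᴹ-sound (A ✶ H) (λ i j → + m ℤ.* quotient (A ✶ H) i j) (T-∧ˡ t₄)
  ; GU = =ᴹ-sound (G ✶ U) (λ i j → + m ℤ.* quotient (G ✶ U) i j) (T-∧ʳ {(A ✶ H) =ᴹ (λ i j → + m ℤ.* quotient (A ✶ H) i j)} t₄) }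
  where
  quotient : Mat _ _ → Mat _ _
  quotient M i j = M i j ℤ./ℕ suc (ℕ.pred m)
  t₂ = T-∧ʳ {(A ✶ U) =ᴹ scalar (+ m)} t₁
  t₃ = T-∧ʳ {(U ✶ A) =ᴹ scalar (+ m)} t₂
  t₄ = T-∧ʳ {(A ᵗ ✶ G) =ᴹ (G ✶ U)} t₃

-- Covers the divisor 1 for all lattices, so the stored lists contain only the exact divisors
-- greater than 1.
similar-id : ∀ {D} (G H : Mat D D) → Similar G H 1
similar-id G H = record
  { A = scalar (+ 1) ; U = scalar (+ 1) ; X = H ; V = G
  ; AU = λ i j → idˡ (scalar (+ 1)) i j ; UA = λ i j → idˡ (scalar (+ 1)) i j
  ; AG = λ i j → trans (transposeId i j) (trans (idˡ G i j) (sym (idʳ G i j)))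
  ; AH = λ i j → trans (idˡ H i j) (sym (ℤ.*-identityˡ (H i j)))
  ; GU = λ i j → trans (idʳ G i j) (sym (ℤ.*-identityˡ (G i j))) }
  where
  indicator-sym : ∀ {n} (i j : Fin n) → ZΣ.indicator i j ≡ ZΣ.indicator j i
  indicator-sym i j with i Fin.≟ j | j Fin.≟ i
  ... | yes _ | yes _ = refl
  ... | no  _ | no  _ = refl
  ... | yes e | no  f = ⊥-elim (f (sym e))
  ... | no  f | yes e = ⊥-elim (f (sym e))
  idˡ : ∀ {m n} (M : Mat m n) i j → (scalar (+ 1) ✶ M) i j ≡ M i j
  idˡ M i j = trans (ZΣ.Σ-cong (λ k → cong (λ x → x ℤ.* M k j) (ℤ.*-identityˡ (ZΣ.indicator i k)))) (ZΣ.Σ-indicator i (λ k → M k j))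
  idʳ : ∀ {m n} (M : Mat m n) i j → (M ✶ scalar (+ 1)) i j ≡ M i j
  idʳ M i j = trans (ZΣ.Σ-cong (λ k → trans (ℤ.*-comm (M i k) _) (cong (λ x → x ℤ.* M i k)
    (trans (ℤ.*-identityˡ (ZΣ.indicator k j)) (indicator-sym k j))))) (ZΣ.Σ-indicator j (M i))
  transposeId : ∀ i j → (scalar (+ 1) ᵗ ✶ G) i j ≡ (scalar (+ 1) ✶ G) i j
  transposeId i j = ZΣ.Σ-cong (λ k → cong (λ x → + 1 ℤ.* x ℤ.* G k j) (indicator-sym k i))

Similarities : ℕ → Set
Similarities D = List (ℕ × ITable D D × ITable D D)

hasSimilarity : ∀ {D} → Mat D D → Mat D D → ℕ → Similarities D → Bool
hasSimilarity G H m List.[]                   = m ℕ.≡ᵇ 1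
hasSimilarity G H m ((m′ , A , U) List.∷ ss) = ((m ℕ.≡ᵇ m′) ∧ similarOk G H m (entry A) (entry U)) ∨ hasSimilarity G H m ss

hasSimilarity-sound : ∀ {D} (G H : Mat D D) m ss → T (hasSimilarity G H m ss) → Similar G H m
hasSimilarity-sound G H m List.[] t = subst (Similar G H) (sym (ℕ.≡ᵇ⇒≡ m 1 t)) (similar-id G H)
hasSimilarity-sound G H m ((m′ , A , U) List.∷ ss) t = go (found) refl
  where
  found : Bool
  found = (m ℕ.≡ᵇ m′) ∧ similarOk G H m (entry A) (entry U)
  go : ∀ b → found ≡ b → Similar G H m
  go true  e = similarOk-sound G H m (entry A) (entry U) (T-∧ʳ {m ℕ.≡ᵇ m′} (≡⇒T e))
  go false e = hasSimilarity-sound G H m ss (subst (λ b → T (b ∨ hasSimilarity G H m ss)) e t)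

-- Both factors divide N = n + 1, so each ranges over 0, ..., N.
modularOk : ∀ {D} → ℕ → Mat D D → Mat D D → Similarities D → Bool
modularOk n G H ss = allᵇ {suc (suc n)} (λ m → allᵇ {suc (suc n)} (λ k →
  not ((toℕ m * toℕ k ℕ.≡ᵇ suc n) ∧ (gcd (toℕ m) (toℕ k) ℕ.≡ᵇ 1)) ∨ hasSimilarity G H (toℕ m) ss))

modularOk-sound : ∀ {D} n (G H : Mat D D) ss → T (modularOk n G H ss) → ∀ m k → m * k ≡ suc n → gcd m k ≡ 1 → Similar G H m
modularOk-sound n G H ss t m k mk≡ coprime = hasSimilarity-sound G H m ss (subst (λ m → T (hasSimilarity G H m ss)) (Fin.toℕ-fromℕ< m<)
  (T-imp (allᵇ-sound (test (Fin.fromℕ< m<)) (allᵇ-sound (λ m → allᵇ (test m)) t (Fin.fromℕ< m<)) (Fin.fromℕ< k<))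
    (T-∧ (ℕ.≡⇒≡ᵇ _ _ (trans (cong₂ _*_ (Fin.toℕ-fromℕ< m<) (Fin.toℕ-fromℕ< k<)) mk≡))
         (ℕ.≡⇒≡ᵇ _ _ (trans (cong₂ gcd (Fin.toℕ-fromℕ< m<) (Fin.toℕ-fromℕ< k<)) coprime)))))
  where
  test : Fin (suc (suc n)) → Fin (suc (suc n)) → Bool
  test m k = not ((toℕ m * toℕ k ℕ.≡ᵇ suc n) ∧ (gcd (toℕ m) (toℕ k) ℕ.≡ᵇ 1)) ∨ hasSimilarity G H (toℕ m) ss
  m< : m < suc (suc n)
  m< = ℕ.s≤s (∣.∣⇒≤ (divides k (trans (sym mk≡) (ℕ.*-comm m k))))
  k< : k < suc (suc n)
  k< = ℕ.s≤s (∣.∣⇒≤ (divides m (sym mk≡)))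

orderOk : ℕ → Table → Bool
orderOk n r = allᵇ (λ i → iterate (lookup r) (suc n) i =ᶠ i) ∧
  -- The exponents 1, ..., n, where the order is n + 1.
  allᵇ {n} (λ k → anyᵇ (λ i → not (iterate (lookup r) (suc (toℕ k)) i =ᶠ i)))

levelOk : ∀ {D} → ℕ → Mat D D → Bool
levelOk n H = anyᵇ (λ i → anyᵇ (λ j → gcd (suc n) ℤ.∣ H i j ∣ ℕ.≡ᵇ 1))

isExceptional : ℕ → List ℕ → Bool
isExceptional N List.[]       = false
isExceptional N (M List.∷ Ms) = (N ℕ.≡ᵇ M) ∨ isExceptional N Ms

isExceptional-complete : ∀ N Ms → N ∈ Ms → T (isExceptional N Ms)
isExceptional-complete N (M List.∷ Ms) (here refl) rewrite T⇒≡ (ℕ.≡⇒≡ᵇ N N refl) = tt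
isExceptional-complete N (M List.∷ Ms) (there p) with N ℕ.≡ᵇ M
... | true  = tt
... | false = isExceptional-complete N Ms p

-- The lower bound 4 is inherited from the Leech lattice, so it remains to find 4 on the diagonal of
-- the Gram matrix and to compare dimensions.
extremalOk : ∀ {D} → ℕ → Mat D D → Bool
extremalOk {dim} n G = not (isExceptional (suc n) exceptionalN) ∨
  ((D (suc n) ℕ.≡ᵇ dim) ∧ anyᵇ (λ i → G i i =ᶻ (+ 4)))

record LatticeData : Set where
  field
    order-1 dim : ℕ
    generator orbit : Table
    F L : ITable dim 24
    G H : ITable dim dim
    similarities : Similarities dim

certified : LatticeData → Bool
certified x = orbitOk order-1 generator orbit ∧ (basisOk generator orbit F L G ∧ (((entry H ✶ entry G) =ᴹ scalar (+ suc order-1)) ∧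
  (orderOk order-1 generator ∧ (levelOk order-1 (entry H) ∧
  (modularOk order-1 (entry G) (entry H) similarities ∧ extremalOk order-1 (entry G))))))
  where open LatticeData x

-- The Gram matrix and the adjoints of the similarities are computed from this data. None of it is
-- trusted: `certified` tests everything after decoding.
record Encoded : Set where
  field
    order-1 dim orbit F L H : ℕ
    sims : List (ℕ × ℕ)

-- The factor 8 comes from the scaling of coordinates by √8; that the division is exact is tested in
-- `basisOk`.
gramTable : ∀ {D} → ITable D 24 → ITable D D
gramTable F = tabulateᴹ (λ i j → (entry F ✶ (entry F ᵗ)) i j ℤ./ℕ 8)

-- The adjoint G⁻¹ Aᵗ G of A.
adjointTable : ∀ {D} → ℕ → ITable D D → ITable D D → ITable D D → ITable D D
adjointTable n G H A = divide (times (tabulateᴹ (entry H ✶ (entry A ᵗ))) G)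
  where
  times : ITable _ _ → ITable _ _ → ITable _ _
  times A B = tabulateᴹ (entry A ✶ entry B)
  divide : ITable _ _ → ITable _ _
  divide = Vec.map (Vec.map (ℤ._/ℕ suc n))

latticeData : Table → Encoded → LatticeData
latticeData r x = build (decodeℤ dim 24 F) (decodeℤ dim dim H)
  where
  open Encoded x
  build : ITable dim 24 → ITable dim dim → LatticeData
  build F H = record { order-1 = order-1 ; dim = dim ; generator = r ; orbit = decodeTable orbit
    ; F = F ; L = decodeℤ dim 24 L ; G = gramTable F ; H = H
    ; similarities = List.map (λ (m , A) → m , decodeℤ dim dim A , adjointTable order-1 (gramTable F) H (decodeℤ dim dim A)) sims }

module Certified (x : LatticeData) (t₁ : T (certified x)) where

  open LatticeData x

  private
    f : Fin 24 → Fin 24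
    f = lookup generator
    t₂ = T-∧ʳ {orbitOk order-1 generator orbit} t₁
    t₃ = T-∧ʳ {basisOk generator orbit F L G} t₂
    t₄ = T-∧ʳ {(entry H ✶ entry G) =ᴹ scalar (+ suc order-1)} t₃
    t₅ = T-∧ʳ {orderOk order-1 generator} t₄
    t₆ = T-∧ʳ {levelOk order-1 (entry H)} t₅
    t₇ = T-∧ʳ {modularOk order-1 (entry G) (entry H) similarities} t₆

  basis : Basis (Fixed f) dim (entry G)
  basis = basisOk-sound order-1 generator orbit F L G (T-∧ˡ t₁) (T-∧ˡ t₂)

  HG : ∀ i j → (entry H ✶ entry G) i j ≡ scalar (+ suc order-1) i j
  HG = =ᴹ-sound (entry H ✶ entry G) (scalar (+ suc order-1)) (T-∧ˡ t₃)

  similar : ∀ m k → m * k ≡ suc order-1 → gcd m k ≡ 1 → Similar (entry G) (entry H) m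
  similar = modularOk-sound order-1 (entry G) (entry H) similarities (T-∧ˡ t₆)

  unit-entry : ∃[ i ] ∃[ j ] gcd (suc order-1) ℤ.∣ entry H i j ∣ ≡ 1
  unit-entry =
    let (i , t)  = anyᵇ-sound (λ i → anyᵇ (λ j → gcd (suc order-1) ℤ.∣ entry H i j ∣ ℕ.≡ᵇ 1)) (T-∧ˡ t₅)
        (j , t′) = anyᵇ-sound (λ j → gcd (suc order-1) ℤ.∣ entry H i j ∣ ℕ.≡ᵇ 1) t
    in i , j , ℕ.≡ᵇ⇒≡ _ 1 t′

  identity : IsIdentity (iterate f (suc order-1))
  identity i = =ᶠ-sound (allᵇ-sound (λ i → iterate f (suc order-1) i =ᶠ i) (T-∧ˡ (T-∧ˡ t₄)) i)

  nontrivial : ∀ k → 0 < k → k < suc order-1 → ¬ IsIdentity (iterate f k)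
  nontrivial (suc k) _ (ℕ.s≤s k<) id =
    let (i , t) = anyᵇ-sound (λ i → not (iterate f (suc (toℕ (Fin.fromℕ< k<))) i =ᶠ i))
                    (allᵇ-sound (λ k → anyᵇ (λ i → not (iterate f (suc (toℕ k)) i =ᶠ i)))
                      (T-∧ʳ {allᵇ (λ i → iterate f (suc order-1) i =ᶠ i)} (T-∧ˡ t₄)) (Fin.fromℕ< k<))
    in distinct t (trans (cong (λ n → iterate f (suc n) i) (Fin.toℕ-fromℕ< k<)) (id i))

  extremal : suc order-1 ∈ exceptionalN → D (suc order-1) ≡ dim × ∃[ i ] entry G i i ≡ + 4
  extremal p = ℕ.≡ᵇ⇒≡ _ _ (T-∧ˡ t) , let (i , e) = anyᵇ-sound (λ i → entry G i i =ᶻ (+ 4)) (T-∧ʳ {D (suc order-1) ℕ.≡ᵇ dim} t) in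
      i , =ᶻ-sound (entry G i i) (+ 4) e
    where
    t : T ((D (suc order-1) ℕ.≡ᵇ dim) ∧ anyᵇ (λ i → entry G i i =ᶻ (+ 4)))
    t = T-imp (T-∧ʳ {modularOk order-1 (entry G) (entry H) similarities} t₆) (isExceptional-complete (suc order-1) exceptionalN p)

-- Matrices are strings of two-digit entries offset by 50, the first entry rightmost.

classData : Vec Encoded 11
classData =
  ( record { order-1 = 1 ; dim = 16
    ; orbit = 062221171915170915141112111009050706050303010100
    ; F = 505050505050505050465050505050505050505050505054525252525050525050505052505050505252505050505050504850485250485050505048505050505050505050484852505052504848505048505050505050504850504848505052515149495151495151495153515151515151514949515149505050505050505050505052504850504850504848525252494949494949494949495147515149515149514949494951494951514949514949514949494749495149494949515149514949515149514949474949495149494951494949494951515151515149514949515151515149495151494949515147494951514949514949474951494949494949495151494951514951495149494949495149515349515151515151494951515151514951515151494949495151514951514949515147505050505050505050505054505050505050505050505054505048485250485050505048505250525050525050505050515151515151515151515151515151515151515151515147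
    ; L = 475151515159494941494949515153535151454357574551505250525058485042505050504848565052464258544450525052485242525060505050505050425046585840445450465050525058485238505050505052585054424060564450494949514959475139495151494951595153413961554549565050485040524862505250504848424846606040465450505050505040525062505250505048465048565840425650504850525060485238504850505050585250424258544850524848505038525260505050505050445050566040445650465252525262484640505050505252545050444058564450475151515161494739494951514951554951474357554349564850484840504860505050505050445048565844485450465052525064485040505050485248585052423860564450454951535161495141514951495349595151413959554551485250525256485042505050485050565050464258544650524850505240545258505050525052445046586040445650
    ; H = 54485151494749514953494851525151485450495053514849495250494751485150544948505249485452475353515151494954524748525248494947495153495048525449485252464952474749504753504749565247494952525047494849515248485254484952524852525051514849525247485452484851495150524949485252494952544648514749495353495448464952484658524655555249495252494952524848525448515052504850474952524851514648564947474751495347475052494755514956555048524753494747525149555047555851525151515149495050495252475051545151485153504851525349504748525158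
    ; sims = (2 , 50524951505249525052504949514850484851495049505050504949514851504950505150515050515150505050505050514850505148504850504850514851495148495049495048504949524950524948534950475248515049535048535050495151494951505250525150495049515148514951505150505049515049505150505049495049494850505050505050515052515349515252515049524949495050515150504951515050515050505049514949485250494949525049525051505151495151515350525149515048525149524952505153505350495248485050495151524950515150485051494951514952495050495050515050504850) List.∷ List.[] }
  ∷ record { order-1 = 2 ; dim = 12
    ; orbit = 061414091906091615140507050709080706050401010100
    ; F = 514949495151495149495151515149495151515149494953505050505050505050505250525050525050525252525250515151495151494951515149514949514951514751515149494949515149514951494949494951514949494749494951505050505050504650505050505050505050505050505054505050505050505050505050505050465050505050505054515151494951495149514951495149515151495149494953505050505250504848505048504850524850504850505050495151514949514951515151515151495149515351515149505050485250485048505050505048525050505250505052505050505050505050505050505050505050504650505046494949494949494949494949494949494949494949494953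
    ; L = 505048505052485050525044545252505448505050504650515347574949455149495147494949515549514951515151505050485052505052525246505250505048505050504850515745575151455151495145495149515545514947534951484848485052524850525054485250504652505050505250515547595149435149494947475149495349534951534951535747574949435149495143495551515347514949534751505250525050505048505048544850505250485050504850465052485050525050525450545250504850465050484850505050525248465050504852485050505050525050505250504850525050485048525052485050505248524852505050465052464852545050485250545048504850465050465250
    ; H = 544952514848515254484952495448515052525049505350524854514848505053494752515151544851525053515150485048485450484846515148485248515054515049525348515250524851545253495251525050504850525453485051544953534649535358495053485049515152494849545248495347515153525050525649525052504848515153484954
    ; sims = (3 , 485151515050485051495150515048505050495051505050495251505250505051504950485251505149485252505049514849484951524850505050505050504949485150495149505150515151485250505051505150514951485050495050475151535251475251485051484950504948505150495149494848514950485150495151505049525251505050504951) List.∷ List.[] }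
  ∷ record { order-1 = 3 ; dim = 10
    ; orbit = 061414091409060609140510111009080706050101010100
    ; F = 505050505050505050504852485250524850485050505052525050505050525250504850505050505252485050505052494949514951494951495151495151495349515151515149505050505050505050505050505050545050505050505054515151515151515151515151515151514751515151515151495151515151494951514949514951475149494949494951505050505050505050505050465050505450505050505050494949494949494949494949494949494949494949494953505050505050505050505050505050544650505050505050525050505050525250505052525250525052505050505050
    ; L = 485048505450484850505052505048505054485052505050505050504848505052504848505052505052505250505050504650545050505050505050505050505050505050505050534753453943515345635147515365515141495741455951534553494549495149575549495155494949474943515751505052524648505452525050505052505046504846485450484654505054505852505248485246505046504846505250534153493947495349635347495357494947495343455551515147535553494753434953494547514955514755494549524852484450505450545250505254505046504646505250
    ; H = 54494852484847464547495452495050495053484852544851525153555252494854484847464547485051485451535452524850524851545353555447495147535356555555465053465453555856564553554552555556625547485247525455565558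
    ; sims = (4 , 49525149505152484850504951524950515151494949515150484950515151524951525150505050494951494851505248495149514950484950515151495049495048515051494751495049485050515248515249464951535250494948514847495153) List.∷ List.[] }
  ∷ record { order-1 = 4 ; dim = 8
    ; orbit = 140514140505061415140612061006050106050101010100
    ; F = 505050505050505050505054505050505050505050505054514951514949515149515151515351494951494949494951515151515151515151515147515151515151515151515151514951514949495151514949495349495149495151515151505050505050505054505050505450505050505050505050505050505050505046505046505050505050505050505050505050505050505050505046504650505050505050505050525052525050505252525052505250505050505050505050
    ; L = 484650505050485250505050445054565252504852484852505252485048544850524650565048464850505448524850524852504852484650505250525050505252525050505250505248505248525050524650565048445048505448544850494951495149455151495549455151554951494755454951434947555351515549514949455151534949494951474951514949494949494951535149474953535149494951474951445248545648525450544850485050504848485050504850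
    ; H = 54484848545552534854525247455046485254524645484648525254464549465447464658585355554545455862525852504849535254525346464655585258
    ; sims = (5 , 52494848484850504952525052504952505151525448485248515051525048515047494746505448524947484550534850494946485051485249494846515247) List.∷ List.[] }
  ∷ record { order-1 = 5 ; dim = 8
    ; orbit = 120712120718061210121112111006010706010101010100
    ; F = 515151515151515151514951495151495151494949494947504850504848505048504850484850504850505050505050505050505050525048505250524852505052505050505052514951514953495151515151515149514949515151515149515151515151495149515151514949495149494949494953505050505050505050504650465050505050505050505050495149495151514949495149514951515151515151515147525052525050505252525052505250505050505050505050
    ; L = 674947434551494951474947514951535551514751474749814943534149474757415337474143535959615349374749335151555351535549515155495151474549475351515151724844504452484856425244484444545658565048425050744846464850464854465042504448545654544650484850255357515351535345554759515553474545455151575151335351575549515347554953515149474549515351515149725050424648484654484846524650545652524852485050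
    ; H = 54505152494947465054484952485352514854524852474852495254495147464952484954505452494852515054505047534747545058564652484652505658
    ; sims = (2 , 51505049515049515050525051495050504949505049505050505048505050495051515049505050504949504950505049515151505049505050505250505050)
      List.∷ (3 , 48515050505050484950525050485050505050505150514950505050495052485048505150485051514850505150515050485149504850515049515050495052)
      List.∷ (6 , 52485052494952524950544951485149514848514950495252494952515048545052524850525049505248504852485146535348505150474652524650505046) List.∷ List.[] }
  ∷ record { order-1 = 6 ; dim = 6
    ; orbit = 230805080808080505051301080105080105050101010100
    ; F = 515149515151514949495351515149515149495151515151534949494949494949494949494949494949494949494949465050505050505050505050505050505050505050505046494949494949494949495349494949494949494949494949494951494949495151515151495151495151515151515147494949494949494949494949494949494949494949494953
    ; L = 505672503650463432565054566458565644504848463850515573493945493333574949576357555943514949453749495775473747473131594949576759595941514747473549504430486254526668425250463436444058525252546450504432506052506466425052443642464454505252566250494323496357517367414955413545433753455151517351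
    ; H = 545252475253525452475151525254475052474747564846525150485453535152465356
    ; sims = (7 , 505048495249494850495248494952505448495250494751525148515049505249535251) List.∷ List.[] }
  ∷ record { order-1 = 7 ; dim = 6
    ; orbit = 050506050505050606060510061006060706050101010100
    ; F = 494951494949495151514949514951515351495151515149494949494949494949494951495149495149495151515147505050505050505050505048504850504850505252525248505050505050505050505054505450505050505050505050484850484848485050504848504850504850485050505048494949494949494949494949494949494949494949494953
    ; L = 714353554349494149554745555541555153414951495351355347455353515749475355474555475147575147534949714351534747514549554945535543514953395151475551674551554545494353534947555543514953434953475351355349455353515747474955474557514947595149514749705464524254501850543640666034605052404456564652
    ; H = 544952524853495448474949524856544854524754565053484948505447534954534756
    ; sims = (8 , 495049495254515154485249525248525252514847515052514849494848505149515053) List.∷ List.[] }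
  ∷ record { order-1 = 10 ; dim = 4
    ; orbit = 070107070107010107070707010107070706010101010100
    ; F = 494949494949494949494949494949494953494949494949514951514951494951515151494951515151494949494953505050505050505050505050505050505046505050505046494949494949494949494949494949494949494949494953
    ; L = 495561454151454145555147575749494751554949613749484446545650525452505052464848505450465050465450495757494351454347555147595751474749554549573749474341555947555955474955394149515149435351416551
    ; H = 54515148515452495152545048495054
    ; sims = (11 , 50544851525149544851505249485449) List.∷ List.[] }
  ∷ record { order-1 = 13 ; dim = 4
    ; orbit = 130505050505050505051301050105050105050101010100
    ; F = 494949494949494949494951495149495149495151515147494949494949494949494949494949494949494949494953505050505050505050505052505250505250505252525252465050505050505050504650505050505050505050505050
    ; L = 554151454959574747494543495945495153554351495549475551554939475153495357474555535145475349494551495351554943455153475153514553555147475551514751505050505050505052504850505250504852485248505050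
    ; H = 54504949505451494951545049495054
    ; sims = (2 , 49495050514950505050494950505149)
      List.∷ (7 , 52525051485249504950484850495248)
      List.∷ (14 , 54505151504651494949504649514650) List.∷ List.[] }
  ∷ record { order-1 = 14 ; dim = 4
    ; orbit = 010806010101010108010608010801080106010101010100
    ; F = 515151515151515151515151515151515151515151515155505248505050505052504852505250525048505050505046504848505050505048504848504850485048505050505050494949494949494949494949494949494949494949494953
    ; L = 454749534945475349555153515151515349475351495151505050505050505252484850525250485050505048505050484446544646445252545054524852505452465254485250454751555147475145514753515347534751495153495151
    ; H = 54525251525451525251564851524856
    ; sims = (3 , 51485050524950505150494850495251)
      List.∷ (5 , 51504850515148484850495053484949)
      List.∷ (15 , 52514648514948525648484948474951) List.∷ List.[] }
  ∷ record { order-1 = 22 ; dim = 2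
    ; orbit = 010101010101010101010101010101010101010101010100
    ; F = 515151515151515151515151515151515151515151515155494949494949494949494949494949494949494949494953
    ; L = 555949454353474945575345555551434555574747574151555949454157474941574945555949414757574545573951
    ; H = 54515156
    ; sims = (23 , 49544451) List.∷ List.[] } ∷ [])

allCertified : ∀ {n} → Vec Table n → Vec Encoded n → Bool
allCertified rs xs = allᵇ (λ c → certified (latticeData (lookup rs c) (lookup xs c)))

allCertified-sound : ∀ {n} (rs : Vec Table n) xs → allCertified rs xs ≡ true → ∀ c → T (certified (latticeData (lookup rs c) (lookup xs c)))
allCertified-sound rs xs t = allᵇ-sound (λ c → certified (latticeData (lookup rs c) (lookup xs c))) (≡⇒T t)

abstract

  certificate : ∀ c → T (certified (latticeData (lookup reps c) (lookup classData c)))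
  certificate = allCertified-sound reps classData refl

  repAut : Fin 11 → Aut
  repAut = areAuts-element reps refl

  repAut≡ : ∀ c i → to (repAut c) i ≡ rep c i
  repAut≡ c i = refl

rep-preimage : ∀ c i → rep c (from (repAut c) i) ≡ i
rep-preimage c i = trans (sym (repAut≡ c (from (repAut c) i))) (to-from (repAut c) i)

-- Strong modularity and extremality of the fixed lattices

leech-minNorm : ∀ v → Leech v → ¬ (v ≈ 0ᵥ) → + 4 / 1 ℚ.≤ norm v
leech-minNorm v (z , v≡ , z∈Λ) v≢0 = subst (+ 4 / 1 ℚ.≤_) (sym norm≡)
  (ℚ.*-monoʳ-≤-nonNeg eighth (ι-mono-≤ (Leechℤ.leech-min {z} z∈Λ (λ z≡0 → v≢0 (λ i → trans (v≡ i) (cong ι (z≡0 i)))))))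
  where
  norm≡ : norm v ≡ ι (Σℤ (λ i → z i ℤ.* z i)) ℚ.* eighth
  norm≡ = trans (·-cong {v} {ι ∘ z} {v} {ι ∘ z} v≡ v≡) (cong (ℚ._* eighth) (ι-pair z z))

module _ (x : LatticeData) (t : T (certified x)) where

  open LatticeData x using (order-1; dim; G; H)
  open Certified x t

  module _ {Λ : Lattice} (Λ-basis : Basis Λ dim (entry G)) where

    private
      module P = Presented Λ-basis order-1 (entry H) HG

    stronglyModular : StronglyModular (suc order-1) Λ
    stronglyModular = P.integral , (suc order-1 , lev , ∣.∣-refl) , modular
      where
      lev : IsLevel Λ (suc order-1)
      lev = let (i , j , e) = unit-entry in P.level i j (Coprimality.gcd≡1⇒coprime e)
      modular : ∀ m k → m * k ≡ suc order-1 → gcd m k ≡ 1 → ∃[ σ ] IsModularity m Λ σ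
      modular (suc m) k mk≡ coprime = P.σ m k mk≡ coprime (similar (suc m) k mk≡ coprime)
        , P.modularity m k mk≡ coprime (similar (suc m) k mk≡ coprime)

    extremality : (∀ v → Λ v → Leech v) → suc order-1 ∈ exceptionalN → HasDim Λ (D (suc order-1)) × MinNorm Λ (+ 4 / 1)
    extremality Λ⊆Leech p = subst (HasDim Λ) (sym (proj₁ (extremal p))) P.hasDim
      , (F i , P.F∈Λ i , F≢0 , norm≡4) , λ v v∈Λ → leech-minNorm v (Λ⊆Leech v v∈Λ)
      where
      open Basis Λ-basis using (F; gram)
      i : Fin dim
      i = proj₁ (proj₂ (extremal p))
      norm≡4 : norm (F i) ≡ + 4 / 1
      norm≡4 = trans (gram i i) (cong ι (proj₂ (proj₂ (extremal p))))
      F≢0 : ¬ (F i ≈ 0ᵥ)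
      F≢0 F≈0 = case trans (sym norm≡4) (·-cong {F i} {0ᵥ} {F i} {0ᵥ} F≈0 F≈0) of λ ()

pow≡iterate : ∀ g n i → pow g n i ≡ iterate (g ⟨$⟩ʳ_) n i
pow≡iterate g zero    i = refl
pow≡iterate g (suc n) i = cong (g ⟨$⟩ʳ_) (pow≡iterate g n i)

order-unique : ∀ g {N} M → HasOrder g N → 0 < M → IsIdentity (iterate (g ⟨$⟩ʳ_) M) →
  (∀ k → 0 < k → k < M → ¬ IsIdentity (iterate (g ⟨$⟩ʳ_) k)) → N ≡ M
order-unique g {N} M (0<N , id-N , min-N) 0<M id-M min-M with ℕ.<-cmp N M
... | tri< N<M _ _ = ⊥-elim (min-M N 0<N N<M (λ i → trans (sym (pow≡iterate g N i)) (id-N i)))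
... | tri≈ _ N≡M _ = N≡M
... | tri> _ _ M<N = ⊥-elim (min-N M 0<M M<N (λ i → trans (pow≡iterate g M i) (id-M i)))

fromPermutation : (g : Permutation′ 24) → InM24 g → Aut
fromPermutation g g∈M₂₄ = record { to = g ⟨$⟩ʳ_ ; from = g ⟨$⟩ˡ_
  ; to-from = λ i → Perm.inverseʳ g ; from-to = λ i → Perm.inverseˡ g ; closed = g∈M₂₄ }

theorem3 : (g : Permutation′ 24) (i₀ : Fin 24) (N : ℕ)
    → InM24 g
    → g ⟨$⟩ʳ i₀ ≡ i₀
    → HasOrder g N
    → 1 < N
    → StronglyModular N (Λfix g)
    × (N ∈ exceptionalN → HasDim (Λfix g) (D N) × MinNorm (Λfix g) (+ 4 / 1))
theorem3 g i₀ N g∈M₂₄ fixed order 1<N = conclude (classify (fromPermutation g g∈M₂₄) i₀ (proj₁ moved) fixed (proj₂ moved))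
  where
  moved : ∃[ i ] g ⟨$⟩ʳ i ≢ i
  -- As 1 < N, minimality of the order at exponent 1 says that g itself is not the identity.
  moved = Fin.¬∀⟶∃¬ 24 (λ i → g ⟨$⟩ʳ i ≡ i) (λ i → (g ⟨$⟩ʳ i) Fin.≟ i) (proj₂ (proj₂ order) 1 (ℕ.s≤s ℕ.z≤n) 1<N)
  conclude : Classified (fromPermutation g g∈M₂₄) → StronglyModular N (Λfix g) × (N ∈ exceptionalN → HasDim (Λfix g) (D N) × MinNorm (Λfix g) (+ 4 / 1))
  conclude (c , k , inClass) = subst (λ N → StronglyModular N (Λfix g) × (N ∈ exceptionalN → HasDim (Λfix g) (D N) × MinNorm (Λfix g) (+ 4 / 1)))
      (sym N≡) (stronglyModular x (certificate c) basis , extremality x (certificate c) basis (λ v → proj₁))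
    where
    x : LatticeData
    x = latticeData (lookup reps c) (lookup classData c)
    module X = Certified x (certificate c)
    basis : Basis (Λfix g) (LatticeData.dim x) (entry (LatticeData.G x))
    basis = transport c (from (repAut c)) (rep-preimage c) k (g ⟨$⟩ʳ_) inClass X.basis
    -- The class determines the order, since powers of g and of the representative become trivial
    -- together.
    N≡ : N ≡ suc (LatticeData.order-1 x)
    N≡ = order-unique g (suc (LatticeData.order-1 x)) order (ℕ.s≤s ℕ.z≤n)
      (iterate-id⇐ c (from (repAut c)) (rep-preimage c) k (g ⟨$⟩ʳ_) inClass (suc (LatticeData.order-1 x)) X.identity)
      (λ n 0<n n< id → X.nontrivial n 0<n n< (iterate-id⇒ c (from (repAut c)) (rep-preimage c) k (g ⟨$⟩ʳ_) inClass n id))
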